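{- For every $\varepsilon>0$ there is a sample-based convexity tester (with parameter $\varepsilon$) for sets in $\{0,\pm1\}^n$ with sample complexity $3^{\widetilde O(n^{3/4}/\varepsilon)}$, where the $\widetilde O(\cdot)$ hides a factor of $\log^{1/4} n$.
   Context: A set $S\subseteq\{0,\pm1\}^n$ is convex if $S=\mathrm{Conv}(S)\cap\{0,\pm1\}^n$, where $\mathrm{Conv}(S)\subseteq\mathbb{R}^n$ is the convex hull. For $S,T\subseteq\{0,\pm1\}^n$, $\mathrm{dist}(S,T)=|S\,\Delta\,T|/3^n$, where $S\,\Delta\,T$ is the symmetric difference; $S$ is $\varepsilon$-far from convex if $\mathrm{dist}(S,T)\ge\varepsilon$ for every convex $T\subseteq\{0,\pm1\}^n$. A convexity tester with parameter $\varepsilon$ is a randomized algorithm with membership-oracle access to an unknown $S\subseteq\{0,\pm1\}^n$ that accepts with probability at least $2/3$ if $S$ is convex, and rejects with probability at least $2/3$ if $S$ is $\varepsilon$-far from convex (so two-sided error is allowed). It is sample-based if its queries are independent uniformly random points of $\{0,\pm1\}^n$; its sample complexity is the number of such queries.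
   Formalization: The parameter ε is a positive rational rather than a real number, and the convex hull Conv(S) is formed with rational instead of real coefficients, which gives the same convex subsets of {0,±1}^n. -}

module Defs where

open import Data.Bool.Base using (Bool; true; false; not; _xor_; T)
open import Data.Fin.Base using (Fin)
open import Data.Integer.Base as ℤ using (+_)
open import Data.List.Base as List using (List; filterᵇ)
open import Data.List.NonEmpty.Base as List⁺ using (List⁺; _∷_; [_]; toList)
open import Data.Nat.Base as ℕ using (ℕ; zero; suc)
open import Data.Nat.Logarithm using (⌊log₂_⌋)
open import Data.Nat.Properties using (m^n≢0)
open import Data.Product.Base using (_×_; _,_; ∃)
open import Data.Rational.Base as ℚ using (ℚ; 0ℚ; 1ℚ; _≤_; _*_; _/_)
open import Data.Vec.Base as Vec using (Vec; []; _∷_; lookup)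
open import Function.Bundles using (_⇔_)
open import Relation.Binary.PropositionalEquality using (_≡_)

open import Algebra.Definitions.RawSemiring ℚ.+-*-rawSemiring using (sum; _^_)

data Trit : Set where
  -𝟏 𝟎 +𝟏 : Trit

value : Trit → ℚ
value -𝟏 = ℚ.- 1ℚ
value 𝟎  = 0ℚ
value +𝟏 = 1ℚ

Point : ℕ → Set
Point n = Vec Trit n

-- A set is given by its membership oracle.
Subset : ℕ → Set
Subset n = Point n → Bool

_∈_ : ∀ {n} → Point n → Subset n → Set
x ∈ S = T (S x)

_Δ_ : ∀ {n} → Subset n → Subset n → Subset n
(S Δ S′) x = S x xor S′ x

embed : ∀ {n} → Point n → Fin n → ℚ
embed x j = value (lookup x j)

-- Convex hulls are taken in ℚⁿ rather than ℝⁿ. On rational points the two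
-- hulls of a set of rational points coincide, because a finite system of
-- linear inequalities with rational coefficients that has a real solution
-- also has a rational one.
record Conv {n : ℕ} (S : Subset n) (y : Fin n → ℚ) : Set where
  field
    size        : ℕ
    weight      : Fin size → ℚ
    point       : Fin size → Point n
    point∈S     : ∀ i → point i ∈ S
    weight≥0    : ∀ i → 0ℚ ≤ weight i
    weights≡1   : sum weight ≡ 1ℚ
    combination : ∀ j → sum (λ i → weight i * embed (point i) j) ≡ y j

Convex : ∀ {n} → Subset n → Set
Convex S = ∀ x → x ∈ S ⇔ Conv S (embed x)

-- The lists below enumerate finite types without repetition.

vectors : ∀ {A : Set} → List⁺ A → ∀ n → List⁺ (Vec A n)
vectors as zero    = [ [] ]
vectors as (suc n) = List⁺.concatMap (λ a → List⁺.map (a ∷_) (vectors as n)) as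

pairs : ∀ {A B : Set} → List⁺ A → List⁺ B → List⁺ (A × B)
pairs as bs = List⁺.concatMap (λ a → List⁺.map (a ,_) bs) as

points : ∀ n → List⁺ (Point n)
points = vectors (-𝟏 ∷ 𝟎 List.∷ +𝟏 List.∷ List.[])

bitstrings : ∀ r → List⁺ (Vec Bool r)
bitstrings = vectors (false ∷ true List.∷ List.[])

count : ∀ {A : Set} → (A → Bool) → List⁺ A → ℕ
count p as = List.length (filterᵇ p (toList as))

∣_∣ : ∀ {n} → Subset n → ℕ
∣_∣ {n} S = count S (points n)

dist : ∀ {n} → Subset n → Subset n → ℚ
dist {n} S S′ = _/_ (+ ∣ S Δ S′ ∣) (3 ℕ.^ n) {{m^n≢0 3 n}}

FarFromConvex : ∀ {n} → ℚ → Subset n → Set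
FarFromConvex ε S = ∀ S′ → Convex S′ → ε ≤ dist S S′

-- Probability of an event under the uniform distribution on Ω.
Pr : ∀ {A : Set} → List⁺ A → (A → Bool) → ℚ
Pr Ω event = + count event Ω / List⁺.length Ω

-- Besides the labelled samples, the algorithm sees a uniformly random string
-- of private bits. There is no bound on its running time.
record SampleBasedAlgorithm (n : ℕ) : Set where
  field
    samples : ℕ
    bits    : ℕ
    accepts : Vec Bool bits → Vec (Point n × Bool) samples → Bool

  -- Listing all sample tuples once each makes the samples independent and
  -- uniform, and independent of the private bits.
  runs : List⁺ (Vec Bool bits × Vec (Point n) samples)
  runs = pairs (bitstrings bits) (vectors (points n) samples)

  acceptsOn : Subset n → Vec Bool bits × Vec (Point n) samples → Bool
  acceptsOn S (ρ , xs) = accepts ρ (Vec.map (λ x → x , S x) xs)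

  Pr-accept Pr-reject : Subset n → ℚ
  Pr-accept S = Pr runs (acceptsOn S)
  Pr-reject S = Pr runs (λ run → not (acceptsOn S run))

open SampleBasedAlgorithm public using (samples; Pr-accept; Pr-reject)

record IsConvexityTester {n : ℕ} (ε : ℚ) (A : SampleBasedAlgorithm n) : Set where
  field
    accepts-convex : ∀ S → Convex S → + 2 / 3 ≤ Pr-accept A S
    rejects-far    : ∀ S → FarFromConvex ε S → + 2 / 3 ≤ Pr-reject A S

fromℕ : ℕ → ℚ
fromℕ k = + k / 1

-- m ≤ 3 ^ k for some natural number k ≤ C · n^(3/4) · (log n)^(1/4) / ε. For
-- ε > 0 the bound on k is written with the denominator cleared and both sides
-- raised to the fourth power. For n ≥ 2, rounding log₂ n down changes it by at
-- most a factor of 2, which the constant C absorbs.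
SampleBound : (C : ℕ) (ε : ℚ) (n m : ℕ) → Set
SampleBound C ε n m = ∃ λ k →
  m ℕ.≤ 3 ℕ.^ k ×
  (fromℕ k * ε) ^ 4 ≤ fromℕ (C ℕ.^ 4 ℕ.* n ℕ.^ 3 ℕ.* ⌊log₂ n ⌋)

{-# OPTIONS --safe #-}
{- A linear functional separates a convex set S from any point outside it. Gordan's alternative
   provides the functional and decides convexity. Consider a random walk on {0,±1}ⁿ whose M steps turn
   disjoint sets of zero coordinates into random signs. After an exit from S, the values of the
   separating functional along the rest of the walk are the partial sums of a symmetric exchangeable
   walk, and by Sparre Andersen's theorem these stay positive with probability of order at least
   1/√M, in which case the exit was the last one. Hence the walk crosses the boundary of S only O(√M)
   times on average. If the proportion of zeros changes by O(1/√n) during the whole walk, then the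
   laws of the steps are comparable to the uniform law, so that a single step changes membership
   with probability O(1/√M). A noise operator therefore bounds the Fourier weight of S beyond degree
   d = O(M √n) by O(1/√M). With M of order 1/ε², the functions of degree less than d form a space of
   dimension 3^O(n^(3/4)/ε), and about as many samples suffice to estimate the projection of S. The
   tester looks for a convex set close to this estimate and compares it with S on fresh samples. -}
module Submission where

open import Defs
open import Data.Bool.Base using (Bool; true; false; not; _∧_; _xor_; if_then_else_; T)
open import Data.Bool.Properties using (T?; ∧-assoc; ∧-comm; ∧-identityʳ)
open import Data.Empty using (⊥-elim)
open import Data.Fin.Base using (Fin; zero; suc)
open import Data.Integer.Base as ℤ using (ℤ; 0ℤ; 1ℤ; -1ℤ)
import Data.Integer.Properties as ℤ
import Data.Integer.Tactic.RingSolver as ℤ-Solver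
open import Data.List.Base as List using (List; []; _∷_; _++_; allFin; concat; concatMap; filterᵇ; length; map; null; tabulate)
open import Data.List.Membership.Propositional using () renaming (_∈_ to _∈ₗ_)
open import Data.List.Membership.Propositional.Properties using (∈-concatMap⁺; ∈-filter⁺; ∈-filter⁻; ∈-lookup; ∈-map⁺; ∈-map⁻)
open import Data.List.NonEmpty.Base as List⁺ using (List⁺; _∷_; toList)
open import Data.List.Properties as List using (++-assoc; ++-identityʳ; length-++)
open import Data.List.Relation.Unary.All as All using (All; []; _∷_; all?)
import Data.List.Relation.Unary.All.Properties as All
open import Data.List.Relation.Unary.Any as Any using (here; there)
open import Data.Maybe.Base using (Maybe; just; nothing)
open import Data.Nat.Base as ℕ using (ℕ; zero; suc; s≤s; z≤n)
import Data.Nat.DivMod as ℕ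
open import Data.Nat.Logarithm using (⌊log₂_⌋; ⌊log₂⌋-mono-≤)
import Data.Nat.Properties as ℕ
import Data.Nat.Tactic.RingSolver as ℕ-Solver
open import Data.Product.Base using (_×_; _,_; proj₁; proj₂; map₁; map₂; ∃)
open import Data.Rational.Base as ℚ using (ℚ; 0ℚ; 1ℚ; ½; _+_; _*_; -_; _-_; _≤_; _<_; 1/_; NonZero; nonNegative; positive)
open import Data.Rational.Properties
open import Algebra.Definitions.RawSemiring ℚ.+-*-rawSemiring using (sum; _^_)
import Data.Rational.Unnormalised.Base as ℚᵘ
import Data.Rational.Unnormalised.Properties as ℚᵘ
open import Data.Sign.Base as Sign using (Sign; opposite)
open import Data.Sum.Base using (_⊎_; inj₁; inj₂)
open import Data.Unit.Base using (⊤; tt)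
open import Data.Vec.Base as Vec using (Vec; []; _∷_; lookup)
import Data.Vec.Properties as Vec
open import Function.Base using (_∘_; id; case_of_)
open import Function.Bundles using (Equivalence; mk⇔)
open import Level using (0ℓ)
open import Relation.Binary.Definitions using (tri<; tri≈; tri>)
open import Relation.Binary.PropositionalEquality using (_≡_; _≢_; refl; sym; trans; cong; cong₂; subst; module ≡-Reasoning)
open import Relation.Nullary using (Dec; yes; no; ¬_)
open import Relation.Nullary.Decidable using (dec-false; dec-true; dec⇒maybe; does; map′)
open import Tactic.RingSolver using (solve-∀)
open import Tactic.RingSolver.Core.AlmostCommutativeRing using (AlmostCommutativeRing; fromCommutativeRing)

-- All probabilities are finite sums of rationals, and no root is ever taken: the walk has M = r * r
-- steps with r of order 1/ε, so that √M is the natural number r, and n^(3/4) is met only as a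
-- fourth power. The walk is random in two independent ways. Its steps come in random order with
-- random signs; for fixed labels of the coordinates this yields the exchangeability behind Sparre
-- Andersen's theorem. The labels are drawn independently for each coordinate; for a fixed order and
-- fixed signs this makes the law of a step a product. Exchanging the two expectations lets the
-- bound on exits meet these laws. The obstacle is that zeros are only used up along the walk and
-- never restored, so that most steps start from a distorted law. The labels are therefore centred:
-- a step with i steps before and j steps after it has drift (j - i) η, and the mirrored step has
-- the opposite drift. In the product of the two likelihoods the terms of first order cancel, and a
-- drift of order 1/√n in each of n coordinates costs only a constant factor.

private variable
  α β γ : Set

-- Inequalities and finite sums of rationals

ℚ-ring : AlmostCommutativeRing 0ℓ 0ℓ
ℚ-ring = fromCommutativeRing +-*-commutativeRing (λ x → dec⇒maybe (0ℚ ≟ x))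

2ℚ : ℚ
2ℚ = 1ℚ + 1ℚ

*-mono-≤-nonNeg : ∀ {a b c d} → 0ℚ ≤ a → 0ℚ ≤ d → a ≤ b → c ≤ d → a * c ≤ b * d
*-mono-≤-nonNeg {a} {b} {c} {d} 0≤a 0≤d a≤b c≤d = ≤-trans
  (*-monoˡ-≤-nonNeg a {{nonNegative 0≤a}} c≤d)
  (*-monoʳ-≤-nonNeg d {{nonNegative 0≤d}} a≤b)

*-monoˡ-≤ : ∀ {a b c} → 0ℚ ≤ c → a ≤ b → c * a ≤ c * b
*-monoˡ-≤ {c = c} 0≤c = *-monoˡ-≤-nonNeg c {{nonNegative 0≤c}}

*-monoʳ-≤ : ∀ {a b c} → 0ℚ ≤ c → a ≤ b → a * c ≤ b * c
*-monoʳ-≤ {c = c} 0≤c = *-monoʳ-≤-nonNeg c {{nonNegative 0≤c}}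

0≤* : ∀ {a b} → 0ℚ ≤ a → 0ℚ ≤ b → 0ℚ ≤ a * b
0≤* {a} {b} 0≤a 0≤b = ≤-trans (≤-reflexive (sym (*-zeroˡ 0ℚ))) (*-mono-≤-nonNeg ≤-refl 0≤b 0≤a 0≤b)

0≤+ : ∀ {a b} → 0ℚ ≤ a → 0ℚ ≤ b → 0ℚ ≤ a + b
0≤+ = +-mono-≤

p≤q⇒0≤q-p : ∀ {p q} → p ≤ q → 0ℚ ≤ q - p
p≤q⇒0≤q-p {p} {q} p≤q = ≤-trans (≤-reflexive (sym (+-inverseʳ p))) (+-monoˡ-≤ (- p) p≤q)

0≤q-p⇒p≤q : ∀ {p q} → 0ℚ ≤ q - p → p ≤ q
0≤q-p⇒p≤q {p} {q} 0≤q-p = begin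
  p            ≡⟨ +-identityˡ p ⟨
  0ℚ + p       ≤⟨ +-monoˡ-≤ p 0≤q-p ⟩
  (q - p) + p  ≡⟨ eq p q ⟩
  q            ∎
  where
  open ≤-Reasoning
  eq : ∀ p q → (q - p) + p ≡ q
  eq = solve-∀ ℚ-ring

0≤p² : ∀ p → 0ℚ ≤ p * p
0≤p² p with ≤-total 0ℚ p
... | inj₁ 0≤p = 0≤* 0≤p 0≤p
... | inj₂ p≤0 = ≤-trans (0≤* (neg-antimono-≤ p≤0) (neg-antimono-≤ p≤0)) (≤-reflexive (eq p))
  where
  eq : ∀ p → (- p) * (- p) ≡ p * p
  eq = solve-∀ ℚ-ring

𝟙 : Bool → ℚ
𝟙 true  = 1ℚ
𝟙 false = 0ℚ

0≤1 : 0ℚ ≤ 1ℚ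
0≤1 = nonNegative⁻¹ 1ℚ

0≤𝟙 : ∀ b → 0ℚ ≤ 𝟙 b
0≤𝟙 true  = 0≤1
0≤𝟙 false = ≤-refl

𝟙≤1 : ∀ b → 𝟙 b ≤ 1ℚ
𝟙≤1 true  = ≤-refl
𝟙≤1 false = 0≤1

𝟙-∧ : ∀ a b → 𝟙 (a ∧ b) ≡ 𝟙 a * 𝟙 b
𝟙-∧ true  b = sym (*-identityˡ (𝟙 b))
𝟙-∧ false b = sym (*-zeroˡ (𝟙 b))

𝟙-not : ∀ b → 𝟙 (not b) ≡ 1ℚ - 𝟙 b
𝟙-not true  = refl
𝟙-not false = refl

∑ : List α → (α → ℚ) → ℚ
∑ []       f = 0ℚ
∑ (x ∷ xs) f = f x + ∑ xs f

∑-cong-All : ∀ {xs} {f g : α → ℚ} → All (λ x → f x ≡ g x) xs → ∑ xs f ≡ ∑ xs g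
∑-cong-All []       = refl
∑-cong-All (e ∷ es) = cong₂ _+_ e (∑-cong-All es)

∑-cong : ∀ (xs : List α) {f g : α → ℚ} → (∀ x → f x ≡ g x) → ∑ xs f ≡ ∑ xs g
∑-cong []       e = refl
∑-cong (x ∷ xs) e = cong₂ _+_ (e x) (∑-cong xs e)

∑-mono-All : ∀ {xs} {f g : α → ℚ} → All (λ x → f x ≤ g x) xs → ∑ xs f ≤ ∑ xs g
∑-mono-All []       = ≤-refl
∑-mono-All (e ∷ es) = +-mono-≤ e (∑-mono-All es)

∑-mono : ∀ (xs : List α) {f g : α → ℚ} → (∀ x → f x ≤ g x) → ∑ xs f ≤ ∑ xs g
∑-mono []       e = ≤-refl
∑-mono (x ∷ xs) e = +-mono-≤ (e x) (∑-mono xs e)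

∑-0 : ∀ (xs : List α) → ∑ xs (λ _ → 0ℚ) ≡ 0ℚ
∑-0 []       = refl
∑-0 (x ∷ xs) = trans (+-identityˡ _) (∑-0 xs)

0≤∑ : ∀ (xs : List α) {f : α → ℚ} → (∀ x → 0ℚ ≤ f x) → 0ℚ ≤ ∑ xs f
0≤∑ xs 0≤f = ≤-trans (≤-reflexive (sym (∑-0 xs))) (∑-mono xs 0≤f)

∑-++ : ∀ (xs ys : List α) {f : α → ℚ} → ∑ (xs ++ ys) f ≡ ∑ xs f + ∑ ys f
∑-++ []       ys {f} = sym (+-identityˡ (∑ ys f))
∑-++ (x ∷ xs) ys {f} = trans (cong (f x +_) (∑-++ xs ys)) (sym (+-assoc (f x) (∑ xs f) (∑ ys f)))

∑-map : ∀ (h : α → β) xs {f : β → ℚ} → ∑ (map h xs) f ≡ ∑ xs (λ x → f (h x))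
∑-map h []           = refl
∑-map h (x ∷ xs) {f} = cong (f (h x) +_) (∑-map h xs)

∑-concatMap : ∀ (h : α → List β) xs {f : β → ℚ} → ∑ (concatMap h xs) f ≡ ∑ xs (λ x → ∑ (h x) f)
∑-concatMap h []           = refl
∑-concatMap h (x ∷ xs) {f} = trans (∑-++ (h x) _) (cong (∑ (h x) f +_) (∑-concatMap h xs))

private
  interchange : ∀ a b c d → (a + b) + (c + d) ≡ (a + c) + (b + d)
  interchange = solve-∀ ℚ-ring

∑-+ : ∀ (xs : List α) {f g : α → ℚ} → ∑ xs (λ x → f x + g x) ≡ ∑ xs f + ∑ xs g
∑-+ []               = refl
∑-+ (x ∷ xs) {f} {g} = trans (cong (f x + g x +_) (∑-+ xs)) (interchange (f x) (g x) (∑ xs f) (∑ xs g))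

∑-*ˡ : ∀ (xs : List α) c {f : α → ℚ} → ∑ xs (λ x → c * f x) ≡ c * ∑ xs f
∑-*ˡ []       c     = sym (*-zeroʳ c)
∑-*ˡ (x ∷ xs) c {f} = trans (cong (c * f x +_) (∑-*ˡ xs c)) (sym (*-distribˡ-+ c (f x) (∑ xs f)))

∑-*ʳ : ∀ (xs : List α) c {f : α → ℚ} → ∑ xs (λ x → f x * c) ≡ ∑ xs f * c
∑-*ʳ []       c     = sym (*-zeroˡ c)
∑-*ʳ (x ∷ xs) c {f} = trans (cong (f x * c +_) (∑-*ʳ xs c)) (sym (*-distribʳ-+ c (f x) (∑ xs f)))

∑-swap : ∀ (xs : List α) (ys : List β) {f : α → β → ℚ} →
         ∑ xs (λ x → ∑ ys (f x)) ≡ ∑ ys (λ y → ∑ xs (λ x → f x y))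
∑-swap []       ys     = sym (∑-0 ys)
∑-swap (x ∷ xs) ys {f} = trans (cong (∑ ys (f x) +_) (∑-swap xs ys)) (sym (∑-+ ys))

-- Signed words, their arrangements, cuts and splits

Word : Set → Set
Word α = List (Sign × α)

flip : Sign × α → Sign × α
flip (s , a) = opposite s , a

-- Time reversal together with a change of all signs. It preserves sums over arrangements and turns
-- the walk as seen from its end into the walk as seen from its start.
reflect : Word α → Word α
reflect []      = []
reflect (x ∷ w) = reflect w ++ flip x ∷ []

insertions : Sign × α → Word α → List (Word α)
insertions x []      = (x ∷ []) ∷ []
insertions x (y ∷ w) = (x ∷ y ∷ w) ∷ map (y ∷_) (insertions x w)

-- For distinct letters, each order with each choice of signs is produced once. Up to the factor
-- `orderings`, sums over this list are thus expectations over a uniformly random order with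
-- independent fair signs; the recursive form serves induction on the letters.
arrangements : List α → List (Word α)
arrangements []      = [] ∷ []
arrangements (a ∷ D) = concatMap (λ w → insertions (Sign.+ , a) w ++ insertions (Sign.- , a) w) (arrangements D)

cuts : Word α → List (Word α × Word α)
cuts []      = ([] , []) ∷ []
cuts (x ∷ w) = ([] , x ∷ w) ∷ map (map₁ (x ∷_)) (cuts w)

splits : List α → List (List α × List α)
splits []      = ([] , []) ∷ []
splits (a ∷ D) = map (map₁ (a ∷_)) (splits D) ++ map (map₂ (a ∷_)) (splits D)

∑-insertions : ∀ x (y : Sign × α) w F →
  ∑ (insertions x (y ∷ w)) F ≡ F (x ∷ y ∷ w) + ∑ (insertions x w) (λ v → F (y ∷ v))
∑-insertions x y w F = cong (F (x ∷ y ∷ w) +_) (∑-map (y ∷_) (insertions x w))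

∑-arrangements : ∀ (a : α) D F → ∑ (arrangements (a ∷ D)) F ≡
  ∑ (arrangements D) (λ w → ∑ (insertions (Sign.+ , a) w) F + ∑ (insertions (Sign.- , a) w) F)
∑-arrangements a D F = trans (∑-concatMap _ (arrangements D))
  (∑-cong (arrangements D) λ w → ∑-++ (insertions (Sign.+ , a) w) (insertions (Sign.- , a) w))

∑-cuts : ∀ (x : Sign × α) w F → ∑ (cuts (x ∷ w)) F ≡ F ([] , x ∷ w) + ∑ (cuts w) (λ (ρ , τ) → F (x ∷ ρ , τ))
∑-cuts x w F = cong (F ([] , x ∷ w) +_) (∑-map (map₁ (x ∷_)) (cuts w))

∑-splits : ∀ (a : α) D F → ∑ (splits (a ∷ D)) F ≡ ∑ (splits D) (λ (B , C) → F (a ∷ B , C) + F (B , a ∷ C))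
∑-splits a D F = begin
  ∑ (splits (a ∷ D)) F
    ≡⟨ ∑-++ (map (map₁ (a ∷_)) (splits D)) _ ⟩
  ∑ (map (map₁ (a ∷_)) (splits D)) F + ∑ (map (map₂ (a ∷_)) (splits D)) F
    ≡⟨ cong₂ _+_ (∑-map _ (splits D)) (∑-map _ (splits D)) ⟩
  ∑ (splits D) (λ (B , C) → F (a ∷ B , C)) + ∑ (splits D) (λ (B , C) → F (B , a ∷ C))
    ≡⟨ ∑-+ (splits D) ⟨
  ∑ (splits D) (λ (B , C) → F (a ∷ B , C) + F (B , a ∷ C)) ∎
  where open ≡-Reasoning

arrangements-elim : (P : List α → Word α → Set) → P [] [] →
  (∀ s a D w → P D w → All (P (a ∷ D)) (insertions (s , a) w)) →
  ∀ D → All (P D) (arrangements D)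
arrangements-elim P base step []      = base ∷ []
arrangements-elim P base step (a ∷ D) = All.concat⁺ (All.map⁺ (All.map
  (λ {w} p → All.++⁺ (step Sign.+ a D w p) (step Sign.- a D w p))
  (arrangements-elim P base step D)))

insertions-length : ∀ (x : Sign × α) w → All (λ v → length v ≡ suc (length w)) (insertions x w)
insertions-length x []      = refl ∷ []
insertions-length x (y ∷ w) = refl ∷ All.map⁺ (All.map (cong suc) (insertions-length x w))

arrangements-length : ∀ (D : List α) → All (λ w → length w ≡ length D) (arrangements D)
arrangements-length = arrangements-elim (λ D w → length w ≡ length D) refl
  λ s a D w p → All.map (λ q → trans q (cong suc p)) (insertions-length (s , a) w)

-- Inserting a letter and then cutting amounts to cutting and then inserting the letter into one of the two parts.
∑-cuts-insertions : ∀ (x : Sign × α) w F → ∑ (insertions x w) (λ v → ∑ (cuts v) F) ≡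
  ∑ (cuts w) (λ (ρ , τ) → ∑ (insertions x ρ) (λ ρ′ → F (ρ′ , τ)) + ∑ (insertions x τ) (λ τ′ → F (ρ , τ′)))
∑-cuts-insertions x [] F = eq (F ([] , x ∷ [])) (F (x ∷ [] , []))
  where
  eq : ∀ a b → a + (b + 0ℚ) + 0ℚ ≡ b + 0ℚ + (a + 0ℚ) + 0ℚ
  eq = solve-∀ ℚ-ring
∑-cuts-insertions x (y ∷ w) F = begin
  ∑ (insertions x (y ∷ w)) (λ v → ∑ (cuts v) F)
    ≡⟨ ∑-insertions x y w (λ v → ∑ (cuts v) F) ⟩
  ∑ (cuts (x ∷ y ∷ w)) F + ∑ (insertions x w) (λ v → ∑ (cuts (y ∷ v)) F)
    ≡⟨ cong₂ _+_
         (trans (∑-cuts x (y ∷ w) F) (cong (F ([] , x ∷ y ∷ w) +_) (∑-cuts y w (λ (ρ , τ) → F (x ∷ ρ , τ)))))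
         (trans (∑-cong (insertions x w) λ v → ∑-cuts y v F) (∑-+ (insertions x w))) ⟩
  (F ([] , x ∷ y ∷ w) + (F (x ∷ [] , y ∷ w) + S₁)) +
  (S₂ + ∑ (insertions x w) (λ v → ∑ (cuts v) (λ (ρ , τ) → F (y ∷ ρ , τ))))
    ≡⟨ cong (λ z → (F ([] , x ∷ y ∷ w) + (F (x ∷ [] , y ∷ w) + S₁)) + (S₂ + z))
         (trans (∑-cuts-insertions x w _) (∑-+ (cuts w))) ⟩
  (F ([] , x ∷ y ∷ w) + (F (x ∷ [] , y ∷ w) + S₁)) + (S₂ + (S₃ + S₄))
    ≡⟨ eq (F ([] , x ∷ y ∷ w)) (F (x ∷ [] , y ∷ w)) S₁ S₂ S₃ S₄ ⟩
  (F (x ∷ [] , y ∷ w) + 0ℚ) + (F ([] , x ∷ y ∷ w) + S₂) + ((S₁ + S₃) + S₄)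
    ≡⟨ cong₂ (λ u v → (F (x ∷ [] , y ∷ w) + 0ℚ) + u + v)
         (∑-insertions x y w (λ τ′ → F ([] , τ′)))
         (trans (∑-+ (cuts w)) (cong (_+ S₄) (∑-+ (cuts w)))) ⟨
  G ([] , y ∷ w) + ∑ (cuts w) (λ (ρ , τ) → (F (x ∷ y ∷ ρ , τ) + ∑ (insertions x ρ) (λ ρ′ → F (y ∷ ρ′ , τ)))
    + ∑ (insertions x τ) (λ τ′ → F (y ∷ ρ , τ′)))
    ≡⟨ cong (G ([] , y ∷ w) +_) (∑-cong (cuts w) λ (ρ , τ) →
         cong (_+ ∑ (insertions x τ) (λ τ′ → F (y ∷ ρ , τ′))) (∑-insertions x y ρ (λ ρ′ → F (ρ′ , τ)))) ⟨
  G ([] , y ∷ w) + ∑ (cuts w) (λ (ρ , τ) → G (y ∷ ρ , τ))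
    ≡⟨ ∑-cuts y w G ⟨
  ∑ (cuts (y ∷ w)) G ∎
  where
  open ≡-Reasoning
  G = λ (ρ , τ) → ∑ (insertions x ρ) (λ ρ′ → F (ρ′ , τ)) + ∑ (insertions x τ) (λ τ′ → F (ρ , τ′))
  S₁ = ∑ (cuts w) (λ (ρ , τ) → F (x ∷ y ∷ ρ , τ))
  S₂ = ∑ (insertions x w) (λ v → F ([] , y ∷ v))
  S₃ = ∑ (cuts w) (λ (ρ , τ) → ∑ (insertions x ρ) (λ ρ′ → F (y ∷ ρ′ , τ)))
  S₄ = ∑ (cuts w) (λ (ρ , τ) → ∑ (insertions x τ) (λ τ′ → F (y ∷ ρ , τ′)))
  eq : ∀ a b s₁ s₂ s₃ s₄ → (a + (b + s₁)) + (s₂ + (s₃ + s₄)) ≡ (b + 0ℚ) + (a + s₂) + ((s₁ + s₃) + s₄)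
  eq = solve-∀ ℚ-ring

-- Independence of past and future: to arrange the letters and cut is to choose the letters of the
-- prefix and then to arrange both parts separately. The cuts range over all lengths, so that no
-- binomial factors arise.
∑-cuts-arrangements : ∀ (D : List α) F → ∑ (arrangements D) (λ w → ∑ (cuts w) F) ≡
  ∑ (splits D) (λ (B , C) → ∑ (arrangements B) (λ ρ → ∑ (arrangements C) (λ τ → F (ρ , τ))))
∑-cuts-arrangements []      F = cong (_+ 0ℚ) (sym (+-identityʳ (F ([] , []) + 0ℚ)))
∑-cuts-arrangements (a ∷ D) F = begin
  ∑ (arrangements (a ∷ D)) (λ w → ∑ (cuts w) F)
    ≡⟨ ∑-arrangements a D _ ⟩
  ∑ (arrangements D) (λ w → ∑ (insertions a⁺ w) (λ v → ∑ (cuts v) F) + ∑ (insertions a⁻ w) (λ v → ∑ (cuts v) F))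
    ≡⟨ ∑-cong (arrangements D) (λ w → trans
         (cong₂ _+_ (∑-cuts-insertions a⁺ w F) (∑-cuts-insertions a⁻ w F))
         (sym (∑-+ (cuts w)))) ⟩
  ∑ (arrangements D) (λ w → ∑ (cuts w) (λ (ρ , τ) → (L a⁺ ρ τ + R a⁺ ρ τ) + (L a⁻ ρ τ + R a⁻ ρ τ)))
    ≡⟨ ∑-cuts-arrangements D _ ⟩
  ∑ (splits D) (λ (B , C) → ∑ (arrangements B) (λ ρ → ∑ (arrangements C) (λ τ →
    (L a⁺ ρ τ + R a⁺ ρ τ) + (L a⁻ ρ τ + R a⁻ ρ τ))))
    ≡⟨ ∑-cong (splits D) (λ (B , C) → regroup B C) ⟩
  ∑ (splits D) (λ (B , C) → G (a ∷ B) C + G B (a ∷ C))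
    ≡⟨ ∑-splits a D (λ (B , C) → G B C) ⟨
  ∑ (splits (a ∷ D)) (λ (B , C) → G B C) ∎
  where
  open ≡-Reasoning
  a⁺ = Sign.+ , a
  a⁻ = Sign.- , a
  G = λ B C → ∑ (arrangements B) (λ ρ → ∑ (arrangements C) (λ τ → F (ρ , τ)))
  L = λ x ρ τ → ∑ (insertions x ρ) (λ ρ′ → F (ρ′ , τ))
  R = λ x ρ τ → ∑ (insertions x τ) (λ τ′ → F (ρ , τ′))
  eq : ∀ a b c d → (a + b) + (c + d) ≡ (a + c) + (b + d)
  eq = solve-∀ ℚ-ring
  regroup : ∀ B C → _ ≡ _
  regroup B C = begin
    ∑ (arrangements B) (λ ρ → ∑ (arrangements C) (λ τ → (L a⁺ ρ τ + R a⁺ ρ τ) + (L a⁻ ρ τ + R a⁻ ρ τ)))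
      ≡⟨ ∑-cong (arrangements B) (λ ρ → trans (∑-cong (arrangements C) λ τ →
           eq (L a⁺ ρ τ) (R a⁺ ρ τ) (L a⁻ ρ τ) (R a⁻ ρ τ)) (∑-+ (arrangements C))) ⟩
    ∑ (arrangements B) (λ ρ → ∑ (arrangements C) (λ τ → L a⁺ ρ τ + L a⁻ ρ τ)
      + ∑ (arrangements C) (λ τ → R a⁺ ρ τ + R a⁻ ρ τ))
      ≡⟨ ∑-cong (arrangements B) (λ ρ → cong₂ _+_
           (trans (∑-+ (arrangements C)) (cong₂ _+_
             (∑-swap (arrangements C) (insertions a⁺ ρ)) (∑-swap (arrangements C) (insertions a⁻ ρ))))
           (sym (∑-arrangements a C _))) ⟩
    ∑ (arrangements B) (λ ρ → (∑ (insertions a⁺ ρ) (λ ρ′ → ∑ (arrangements C) (λ τ → F (ρ′ , τ)))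
      + ∑ (insertions a⁻ ρ) (λ ρ′ → ∑ (arrangements C) (λ τ → F (ρ′ , τ))))
      + ∑ (arrangements (a ∷ C)) (λ τ → F (ρ , τ)))
      ≡⟨ ∑-+ (arrangements B) ⟩
    ∑ (arrangements B) (λ ρ → ∑ (insertions a⁺ ρ) (λ ρ′ → ∑ (arrangements C) (λ τ → F (ρ′ , τ)))
      + ∑ (insertions a⁻ ρ) (λ ρ′ → ∑ (arrangements C) (λ τ → F (ρ′ , τ)))) + G B (a ∷ C)
      ≡⟨ cong (_+ G B (a ∷ C)) (∑-arrangements a B _) ⟨
    G (a ∷ B) C + G B (a ∷ C) ∎

∑-insertions-snoc : ∀ (x : Sign × α) w y F → ∑ (insertions x (w ++ y ∷ [])) F ≡
  ∑ (insertions x w) (λ v → F (v ++ y ∷ [])) + F (w ++ y ∷ x ∷ [])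
∑-insertions-snoc x []      y F = eq (F (x ∷ y ∷ [])) (F (y ∷ x ∷ []))
  where
  eq : ∀ a b → a + (b + 0ℚ) ≡ a + 0ℚ + b
  eq = solve-∀ ℚ-ring
∑-insertions-snoc x (z ∷ w) y F = begin
  ∑ (insertions x (z ∷ w ++ y ∷ [])) F
    ≡⟨ ∑-insertions x z (w ++ y ∷ []) F ⟩
  F (x ∷ z ∷ w ++ y ∷ []) + ∑ (insertions x (w ++ y ∷ [])) (λ v → F (z ∷ v))
    ≡⟨ cong (F (x ∷ z ∷ w ++ y ∷ []) +_) (∑-insertions-snoc x w y _) ⟩
  F (x ∷ z ∷ w ++ y ∷ []) + (∑ (insertions x w) (λ v → F (z ∷ v ++ y ∷ [])) + F (z ∷ w ++ y ∷ x ∷ []))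
    ≡⟨ +-assoc (F (x ∷ z ∷ w ++ y ∷ [])) _ _ ⟨
  F (x ∷ z ∷ w ++ y ∷ []) + ∑ (insertions x w) (λ v → F (z ∷ v ++ y ∷ [])) + F (z ∷ w ++ y ∷ x ∷ [])
    ≡⟨ cong (_+ F (z ∷ w ++ y ∷ x ∷ [])) (∑-insertions x z w (λ v → F (v ++ y ∷ []))) ⟨
  ∑ (insertions x (z ∷ w)) (λ v → F (v ++ y ∷ [])) + F (z ∷ w ++ y ∷ x ∷ []) ∎
  where open ≡-Reasoning

∑-insertions-reflect : ∀ (x : Sign × α) w F →
  ∑ (insertions x w) (λ v → F (reflect v)) ≡ ∑ (insertions (flip x) (reflect w)) F
∑-insertions-reflect x []      F = refl
∑-insertions-reflect x (y ∷ w) F = begin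
  ∑ (insertions x (y ∷ w)) (λ v → F (reflect v))
    ≡⟨ ∑-insertions x y w (λ v → F (reflect v)) ⟩
  F ((reflect w ++ flip y ∷ []) ++ flip x ∷ []) + ∑ (insertions x w) (λ v → F (reflect v ++ flip y ∷ []))
    ≡⟨ cong₂ _+_ (cong F (++-assoc (reflect w) _ _)) (∑-insertions-reflect x w _) ⟩
  F (reflect w ++ flip y ∷ flip x ∷ []) + ∑ (insertions (flip x) (reflect w)) (λ v → F (v ++ flip y ∷ []))
    ≡⟨ +-comm (F (reflect w ++ flip y ∷ flip x ∷ [])) _ ⟩
  ∑ (insertions (flip x) (reflect w)) (λ v → F (v ++ flip y ∷ [])) + F (reflect w ++ flip y ∷ flip x ∷ [])
    ≡⟨ ∑-insertions-snoc (flip x) (reflect w) (flip y) F ⟨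
  ∑ (insertions (flip x) (reflect (y ∷ w))) F ∎
  where
  open ≡-Reasoning

-- Reversal exchanges the places for an insertion, and the flip exchanges the two signs of the
-- inserted letter.
∑-arrangements-reflect : ∀ (D : List α) F → ∑ (arrangements D) (λ w → F (reflect w)) ≡ ∑ (arrangements D) F
∑-arrangements-reflect []      F = refl
∑-arrangements-reflect (a ∷ D) F = begin
  ∑ (arrangements (a ∷ D)) (λ w → F (reflect w))
    ≡⟨ ∑-arrangements a D _ ⟩
  ∑ (arrangements D) (λ w → ∑ (insertions (Sign.+ , a) w) (λ v → F (reflect v)) + ∑ (insertions (Sign.- , a) w) (λ v → F (reflect v)))
    ≡⟨ ∑-cong (arrangements D) (λ w → trans
         (cong₂ _+_ (∑-insertions-reflect (Sign.+ , a) w F) (∑-insertions-reflect (Sign.- , a) w F))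
         (+-comm (∑ (insertions (Sign.- , a) (reflect w)) F) _)) ⟩
  ∑ (arrangements D) (λ w → G (reflect w))
    ≡⟨ ∑-arrangements-reflect D G ⟩
  ∑ (arrangements D) G
    ≡⟨ ∑-arrangements a D F ⟨
  ∑ (arrangements (a ∷ D)) F ∎
  where
  open ≡-Reasoning
  G = λ w → ∑ (insertions (Sign.+ , a) w) F + ∑ (insertions (Sign.- , a) w) F

-- Partial sums of a signed word and its lowest point

module _ {A : Set} (weight : A → ℤ) where

  signed : Sign × A → ℤ
  signed (Sign.+ , a) = weight a
  signed (Sign.- , a) = ℤ.- weight a

  total : Word A → ℤ
  total []      = 0ℤ
  total (x ∷ w) = signed x ℤ.+ total w

  lowest : Word A → ℤ
  lowest []      = 0ℤ
  lowest (x ∷ w) = 0ℤ ℤ.⊓ (signed x ℤ.+ lowest w)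

  ascends : ℤ → Word A → Bool
  ascends c []      = true
  ascends c (x ∷ w) = does (0ℤ ℤ.<? c ℤ.+ signed x) ∧ ascends (c ℤ.+ signed x) w

  -- The suffixes, not the prefixes, have negative sums: the walk stays above its final value until
  -- it ends. Read backwards with all signs changed, this is `ascends`.
  descends : Word A → Bool
  descends []      = true
  descends (x ∷ w) = does (total (x ∷ w) ℤ.<? 0ℤ) ∧ descends w

  data Subsum : Word A → ℤ → Set where
    []   : Subsum [] 0ℤ
    skip : ∀ {x w t} → Subsum w t → Subsum (x ∷ w) t
    take : ∀ {x w t} → Subsum w t → Subsum (x ∷ w) (signed x ℤ.+ t)

  data SignedSum : List A → ℤ → Set where
    []   : SignedSum [] 0ℤ
    skip : ∀ {a D t} → SignedSum D t → SignedSum (a ∷ D) t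
    take : ∀ s {a D t} → SignedSum D t → SignedSum (a ∷ D) (signed (s , a) ℤ.+ t)

  -- Only sums of consecutive letters occur in the walk. Excluding all vanishing subsums makes the
  -- condition follow from `Generic`, which concerns the letters and not their order.
  NonVanishing : Word A → Set
  NonVanishing []      = ⊤
  NonVanishing (x ∷ w) = (∀ t → Subsum w t → signed x ℤ.+ t ≢ 0ℤ) × NonVanishing w

  Generic : List A → Set
  Generic []      = ⊤
  Generic (a ∷ D) = (∀ s t → SignedSum D t → signed (s , a) ℤ.+ t ≢ 0ℤ) × Generic D

  zeros : ∀ w → Subsum w 0ℤ
  zeros []      = []
  zeros (x ∷ w) = skip (zeros w)

  lowest-subsum : ∀ w → Subsum w (lowest w)
  lowest-subsum []      = []
  lowest-subsum (x ∷ w) with ℤ.⊓-sel 0ℤ (signed x ℤ.+ lowest w)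
  ... | inj₁ e = subst (Subsum (x ∷ w)) (sym e) (zeros (x ∷ w))
  ... | inj₂ e = subst (Subsum (x ∷ w)) (sym e) (take (lowest-subsum w))

  swap-sum : ∀ a b c → a ℤ.+ (b ℤ.+ c) ≡ b ℤ.+ (a ℤ.+ c)
  swap-sum = ℤ-Solver.solve-∀

  Inserted : Sign × A → Word A → Word A → Set
  Inserted x w v = ∀ t → Subsum v t → Subsum w t ⊎ ∃ λ t′ → Subsum w t′ × t ≡ signed x ℤ.+ t′

  insertions-subsum : ∀ x w → All (Inserted x w) (insertions x w)
  insertions-subsum x []      = (λ { _ (skip p) → inj₁ p ; _ (take p) → inj₂ (_ , p , refl) }) ∷ []
  insertions-subsum x (y ∷ w) = (λ { _ (skip p) → inj₁ p ; _ (take p) → inj₂ (_ , p , refl) })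
    ∷ All.map⁺ (All.map cons (insertions-subsum x w))
    where
    cons : ∀ {v} → Inserted x w v → Inserted x (y ∷ w) (y ∷ v)
    cons ins _ (skip p) with ins _ p
    ... | inj₁ q            = inj₁ (skip q)
    ... | inj₂ (t , q , e) = inj₂ (t , skip q , e)
    cons ins _ (take p) with ins _ p
    ... | inj₁ q            = inj₁ (take q)
    ... | inj₂ (t , q , e) = inj₂ (signed y ℤ.+ t , take q ,
      trans (cong (ℤ._+_ (signed y)) e) (swap-sum (signed y) (signed x) t))

  insertions-nonVanishing : ∀ x w → (∀ t → Subsum w t → signed x ℤ.+ t ≢ 0ℤ) → NonVanishing w →
    All NonVanishing (insertions x w)
  insertions-nonVanishing x []      x∉ nz       = (x∉ , tt) ∷ []
  insertions-nonVanishing x (y ∷ w) x∉ (y∉ , nz) = (x∉ , y∉ , nz) ∷ All.map⁺ (All.zipWith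
    (λ (ins , nz′) → (λ t p → y∉′ (ins t p)) , nz′)
    (insertions-subsum x w , insertions-nonVanishing x w (λ t p → x∉ t (skip p)) nz))
    where
    y∉′ : ∀ {t} → Subsum w t ⊎ (∃ λ t′ → Subsum w t′ × t ≡ signed x ℤ.+ t′) → signed y ℤ.+ t ≢ 0ℤ
    y∉′ (inj₁ q) e = y∉ _ q e
    y∉′ (inj₂ (t , q , refl)) e = x∉ _ (take q) (trans (swap-sum (signed x) (signed y) t) e)

  arrangements-subsum : ∀ D → All (λ w → ∀ t → Subsum w t → SignedSum D t) (arrangements D)
  arrangements-subsum = arrangements-elim (λ D w → ∀ t → Subsum w t → SignedSum D t) (λ { _ [] → [] })
    λ s a D w ih → All.map (λ ins t p → extend s a D w ih (ins t p)) (insertions-subsum (s , a) w)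
    where
    extend : ∀ s a D w → (∀ t → Subsum w t → SignedSum D t) → ∀ {t} →
      Subsum w t ⊎ (∃ λ t′ → Subsum w t′ × t ≡ signed (s , a) ℤ.+ t′) → SignedSum (a ∷ D) t
    extend s a D w ih (inj₁ p)              = skip (ih _ p)
    extend s a D w ih (inj₂ (t , p , refl)) = take s (ih t p)

  arrangements-nonVanishing : ∀ D → Generic D → All NonVanishing (arrangements D)
  arrangements-nonVanishing []      gen        = tt ∷ []
  arrangements-nonVanishing (a ∷ D) (a∉ , gen) = All.concat⁺ (All.map⁺ (All.zipWith
    (λ (sub , nz) → All.++⁺ (inserted Sign.+ sub nz) (inserted Sign.- sub nz))
    (arrangements-subsum D , arrangements-nonVanishing D gen)))
    where
    inserted : ∀ s {w} → (∀ t → Subsum w t → SignedSum D t) → NonVanishing w → All NonVanishing (insertions (s , a) w)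
    inserted s {w} sub nz = insertions-nonVanishing (s , a) w (λ t p → a∉ s t (sub t p)) nz

  -- `signed x` plus the lowest partial sum of w is the minimum over the nonempty prefixes, so that
  -- one comparison tests them all.
  ascends-lowest : ∀ c x w → ascends c (x ∷ w) ≡ does (0ℤ ℤ.<? c ℤ.+ (signed x ℤ.+ lowest w))
  ascends-lowest c x []      = trans (∧-identityʳ _)
    (cong (λ z → does (0ℤ ℤ.<? c ℤ.+ z)) (sym (ℤ.+-identityʳ (signed x))))
  ascends-lowest c x (y ∷ w) = begin
    does (0ℤ ℤ.<? c ℤ.+ signed x) ∧ ascends (c ℤ.+ signed x) (y ∷ w)
      ≡⟨ cong (does (0ℤ ℤ.<? c ℤ.+ signed x) ∧_) (ascends-lowest (c ℤ.+ signed x) y w) ⟩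
    does (0ℤ ℤ.<? c ℤ.+ signed x) ∧ does (0ℤ ℤ.<? c ℤ.+ signed x ℤ.+ (signed y ℤ.+ lowest w))
      ≡⟨ positive-⊓ (c ℤ.+ signed x) (signed y ℤ.+ lowest w) ⟩
    does (0ℤ ℤ.<? c ℤ.+ signed x ℤ.+ lowest (y ∷ w))
      ≡⟨ cong (λ z → does (0ℤ ℤ.<? z)) (ℤ.+-assoc c (signed x) _) ⟩
    does (0ℤ ℤ.<? c ℤ.+ (signed x ℤ.+ lowest (y ∷ w))) ∎
    where
    open ≡-Reasoning
    positive-⊓ : ∀ e z → does (0ℤ ℤ.<? e) ∧ does (0ℤ ℤ.<? e ℤ.+ z) ≡ does (0ℤ ℤ.<? e ℤ.+ (0ℤ ℤ.⊓ z))
    positive-⊓ e z with ℤ.≤-total 0ℤ z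
    ... | inj₁ 0≤z rewrite ℤ.i≤j⇒i⊓j≡i 0≤z | ℤ.+-identityʳ e with 0ℤ ℤ.<? e
    ...   | yes 0<e = dec-true (0ℤ ℤ.<? e ℤ.+ z) (ℤ.+-mono-<-≤ 0<e 0≤z)
    ...   | no  _   = refl
    positive-⊓ e z | inj₂ z≤0 rewrite ℤ.i≥j⇒i⊓j≡j z≤0 with 0ℤ ℤ.<? e ℤ.+ z
    ... | yes 0<e+z = trans (∧-identityʳ _) (dec-true (0ℤ ℤ.<? e)
            (ℤ.<-≤-trans 0<e+z (ℤ.≤-trans (ℤ.+-monoʳ-≤ e z≤0) (ℤ.≤-reflexive (ℤ.+-identityʳ e)))))
    ... | no  _     = ∧-comm _ false

  -- The cut at the lowest partial sum is the only one from which the word ascends in both directions.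
  ∑-cuts-lowest : ∀ w → NonVanishing w → (G : ℤ → ℚ) →
    ∑ (cuts w) (λ (ρ , τ) → 𝟙 (descends ρ) * 𝟙 (ascends 0ℤ τ) * G (total ρ)) ≡ G (lowest w)
  ∑-cuts-lowest [] nz G = eq (G 0ℤ)
    where
    eq : ∀ g → 1ℚ * 1ℚ * g + 0ℚ ≡ g
    eq = solve-∀ ℚ-ring
  ∑-cuts-lowest (x ∷ w) (x∉ , nz) G = begin
    ∑ (cuts (x ∷ w)) (λ (ρ , τ) → 𝟙 (descends ρ) * 𝟙 (ascends 0ℤ τ) * G (total ρ))
      ≡⟨ ∑-cuts x w (λ (ρ , τ) → 𝟙 (descends ρ) * 𝟙 (ascends 0ℤ τ) * G (total ρ)) ⟩
    1ℚ * 𝟙 (ascends 0ℤ (x ∷ w)) * G 0ℤ +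
    ∑ (cuts w) (λ (ρ , τ) → 𝟙 (descends (x ∷ ρ)) * 𝟙 (ascends 0ℤ τ) * G (signed x ℤ.+ total ρ))
      ≡⟨ cong₂ _+_
           (cong (λ b → 1ℚ * 𝟙 b * G 0ℤ) (trans (ascends-lowest 0ℤ x w)
             (cong (λ z → does (0ℤ ℤ.<? z)) (ℤ.+-identityˡ (signed x ℤ.+ lowest w)))))
           (∑-cong (cuts w) λ (ρ , τ) → trans
             (cong (λ z → z * 𝟙 (ascends 0ℤ τ) * G (signed x ℤ.+ total ρ)) (𝟙-∧ (does (total (x ∷ ρ) ℤ.<? 0ℤ)) (descends ρ)))
             (eq (𝟙 (does (total (x ∷ ρ) ℤ.<? 0ℤ))) (𝟙 (descends ρ)) (𝟙 (ascends 0ℤ τ)) (G (signed x ℤ.+ total ρ)))) ⟩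
    1ℚ * 𝟙 (does (0ℤ ℤ.<? m)) * G 0ℤ +
    ∑ (cuts w) (λ (ρ , τ) → 𝟙 (descends ρ) * 𝟙 (ascends 0ℤ τ) * G′ (total ρ))
      ≡⟨ cong (1ℚ * 𝟙 (does (0ℤ ℤ.<? m)) * G 0ℤ +_) (∑-cuts-lowest w nz G′) ⟩
    1ℚ * 𝟙 (does (0ℤ ℤ.<? m)) * G 0ℤ + 𝟙 (does (m ℤ.<? 0ℤ)) * G m
      ≡⟨ cases m (x∉ _ (lowest-subsum w)) ⟩
    G (0ℤ ℤ.⊓ m) ∎
    where
    open ≡-Reasoning
    m = signed x ℤ.+ lowest w
    G′ = λ t → 𝟙 (does (signed x ℤ.+ t ℤ.<? 0ℤ)) * G (signed x ℤ.+ t)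
    eq : ∀ a b c d → a * b * c * d ≡ b * c * (a * d)
    eq = solve-∀ ℚ-ring
    eq₁ : ∀ a b → 1ℚ * 1ℚ * a + 0ℚ * b ≡ a
    eq₁ = solve-∀ ℚ-ring
    eq₂ : ∀ a b → 1ℚ * 0ℚ * a + 1ℚ * b ≡ b
    eq₂ = solve-∀ ℚ-ring
    cases : ∀ m → m ≢ 0ℤ → 1ℚ * 𝟙 (does (0ℤ ℤ.<? m)) * G 0ℤ + 𝟙 (does (m ℤ.<? 0ℤ)) * G m ≡ G (0ℤ ℤ.⊓ m)
    cases m m≢0 with ℤ.<-cmp 0ℤ m
    ... | tri≈ _ e _ = ⊥-elim (m≢0 (sym e))
    ... | tri< 0<m _ m≮0 rewrite dec-true (0ℤ ℤ.<? m) 0<m | dec-false (m ℤ.<? 0ℤ) m≮0 | ℤ.i≤j⇒i⊓j≡i (ℤ.<⇒≤ 0<m) = eq₁ (G 0ℤ) (G m)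
    ... | tri> 0≮m _ m<0 rewrite dec-true (m ℤ.<? 0ℤ) m<0 | dec-false (0ℤ ℤ.<? m) 0≮m | ℤ.i≥j⇒i⊓j≡j (ℤ.<⇒≤ m<0) = eq₂ (G 0ℤ) (G m)

  total-snoc : ∀ w y → total (w ++ y ∷ []) ≡ total w ℤ.+ signed y
  total-snoc []      y = trans (ℤ.+-identityʳ (signed y)) (sym (ℤ.+-identityˡ (signed y)))
  total-snoc (x ∷ w) y = trans (cong (ℤ._+_ (signed x)) (total-snoc w y)) (sym (ℤ.+-assoc (signed x) (total w) (signed y)))

  signed-flip : ∀ x → signed (flip x) ≡ ℤ.- signed x
  signed-flip (Sign.+ , a) = refl
  signed-flip (Sign.- , a) = sym (ℤ.neg-involutive (weight a))

  total-reflect : ∀ w → total (reflect w) ≡ ℤ.- total w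
  total-reflect []      = refl
  total-reflect (x ∷ w) = trans (total-snoc (reflect w) (flip x))
    (trans (cong₂ ℤ._+_ (total-reflect w) (signed-flip x)) (eq (signed x) (total w)))
    where
    eq : ∀ a b → ℤ.- b ℤ.+ ℤ.- a ≡ ℤ.- (a ℤ.+ b)
    eq = ℤ-Solver.solve-∀

  ascends-snoc : ∀ c w y → ascends c (w ++ y ∷ []) ≡ ascends c w ∧ does (0ℤ ℤ.<? c ℤ.+ (total w ℤ.+ signed y))
  ascends-snoc c []      y = trans (∧-identityʳ _) (cong (λ z → does (0ℤ ℤ.<? c ℤ.+ z)) (sym (ℤ.+-identityˡ (signed y))))
  ascends-snoc c (x ∷ w) y = trans
    (cong (does (0ℤ ℤ.<? c ℤ.+ signed x) ∧_) (trans (ascends-snoc (c ℤ.+ signed x) w y)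
      (cong (λ z → ascends (c ℤ.+ signed x) w ∧ does (0ℤ ℤ.<? z)) (eq c (signed x) (total w) (signed y)))))
    (sym (∧-assoc (does (0ℤ ℤ.<? c ℤ.+ signed x)) _ _))
    where
    eq : ∀ c x w y → c ℤ.+ x ℤ.+ (w ℤ.+ y) ≡ c ℤ.+ (x ℤ.+ w ℤ.+ y)
    eq = ℤ-Solver.solve-∀

  ascends-reflect : ∀ w → ascends 0ℤ (reflect w) ≡ descends w
  ascends-reflect []      = refl
  ascends-reflect (x ∷ w) = begin
    ascends 0ℤ (reflect w ++ flip x ∷ [])
      ≡⟨ ascends-snoc 0ℤ (reflect w) (flip x) ⟩
    ascends 0ℤ (reflect w) ∧ does (0ℤ ℤ.<? 0ℤ ℤ.+ (total (reflect w) ℤ.+ signed (flip x)))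
      ≡⟨ cong₂ _∧_ (ascends-reflect w) (cong (λ z → does (0ℤ ℤ.<? z))
           (trans (cong₂ (λ u v → 0ℤ ℤ.+ (u ℤ.+ v)) (total-reflect w) (signed-flip x)) (eq (signed x) (total w)))) ⟩
    descends w ∧ does (0ℤ ℤ.<? ℤ.- total (x ∷ w))
      ≡⟨ ∧-comm (descends w) _ ⟩
    does (0ℤ ℤ.<? ℤ.- total (x ∷ w)) ∧ descends w
      ≡⟨ cong (_∧ descends w) (negative (total (x ∷ w))) ⟩
    descends (x ∷ w) ∎
    where
    open ≡-Reasoning
    eq : ∀ a b → 0ℤ ℤ.+ (ℤ.- b ℤ.+ ℤ.- a) ≡ ℤ.- (a ℤ.+ b)
    eq = ℤ-Solver.solve-∀
    negative : ∀ z → does (0ℤ ℤ.<? ℤ.- z) ≡ does (z ℤ.<? 0ℤ)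
    negative (ℤ.+ zero) = refl
    negative (ℤ.+ suc n) = refl
    negative (ℤ.-[1+ n ]) = refl

-- Integers as rationals, and the central binomial probabilities

fromℤ : ℤ.ℤ → ℚ
fromℤ z = z ℚ./ 1

private
  toℚᵘ-fromℤ : ∀ z → ℚ.toℚᵘ (fromℤ z) ℚᵘ.≃ ℚᵘ.mkℚᵘ z 0
  toℚᵘ-fromℤ z = toℚᵘ-fromℚᵘ (ℚᵘ.mkℚᵘ z 0)

fromℤ-+ : ∀ a b → fromℤ (a ℤ.+ b) ≡ fromℤ a + fromℤ b
fromℤ-+ a b = toℚᵘ-injective (begin
  ℚ.toℚᵘ (fromℤ (a ℤ.+ b))                   ≈⟨ toℚᵘ-fromℤ (a ℤ.+ b) ⟩
  ℚᵘ.mkℚᵘ (a ℤ.+ b) 0                        ≡⟨ cong₂ (λ x y → ℚᵘ.mkℚᵘ (x ℤ.+ y) 0) (ℤ.*-identityʳ a) (ℤ.*-identityʳ b) ⟨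
  ℚᵘ.mkℚᵘ a 0 ℚᵘ.+ ℚᵘ.mkℚᵘ b 0               ≈⟨ ℚᵘ.+-cong (toℚᵘ-fromℤ a) (toℚᵘ-fromℤ b) ⟨
  ℚ.toℚᵘ (fromℤ a) ℚᵘ.+ ℚ.toℚᵘ (fromℤ b)     ≈⟨ toℚᵘ-homo-+ (fromℤ a) (fromℤ b) ⟨
  ℚ.toℚᵘ (fromℤ a + fromℤ b)                 ∎)
  where open ℚᵘ.≃-Reasoning

fromℤ-* : ∀ a b → fromℤ (a ℤ.* b) ≡ fromℤ a * fromℤ b
fromℤ-* a b = toℚᵘ-injective (begin
  ℚ.toℚᵘ (fromℤ (a ℤ.* b))                   ≈⟨ toℚᵘ-fromℤ (a ℤ.* b) ⟩
  ℚᵘ.mkℚᵘ a 0 ℚᵘ.* ℚᵘ.mkℚᵘ b 0               ≈⟨ ℚᵘ.*-cong (toℚᵘ-fromℤ a) (toℚᵘ-fromℤ b) ⟨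
  ℚ.toℚᵘ (fromℤ a) ℚᵘ.* ℚ.toℚᵘ (fromℤ b)     ≈⟨ toℚᵘ-homo-* (fromℤ a) (fromℤ b) ⟨
  ℚ.toℚᵘ (fromℤ a * fromℤ b)                 ∎)
  where open ℚᵘ.≃-Reasoning

fromℤ-mono-≤ : ∀ {a b} → a ℤ.≤ b → fromℤ a ≤ fromℤ b
fromℤ-mono-≤ {a} {b} a≤b = toℚᵘ-cancel-≤ (begin
  ℚ.toℚᵘ (fromℤ a) ≃⟨ toℚᵘ-fromℤ a ⟩
  ℚᵘ.mkℚᵘ a 0      ≤⟨ ℚᵘ.*≤* (ℤ.*-monoʳ-≤-nonNeg (ℤ.+ 1) a≤b) ⟩
  ℚᵘ.mkℚᵘ b 0      ≃⟨ toℚᵘ-fromℤ b ⟨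
  ℚ.toℚᵘ (fromℤ b) ∎)
  where open ℚᵘ.≤-Reasoning

fromℕ-suc : ∀ n → fromℕ (suc n) ≡ 1ℚ + fromℕ n
fromℕ-suc n = fromℤ-+ (ℤ.+ 1) (ℤ.+ n)

fromℕ-+ : ∀ m n → fromℕ (m ℕ.+ n) ≡ fromℕ m + fromℕ n
fromℕ-+ m n = fromℤ-+ (ℤ.+ m) (ℤ.+ n)

fromℕ-* : ∀ m n → fromℕ (m ℕ.* n) ≡ fromℕ m * fromℕ n
fromℕ-* m n = trans (cong fromℤ (ℤ.pos-* m n)) (fromℤ-* (ℤ.+ m) (ℤ.+ n))

fromℕ-mono-≤ : ∀ {m n} → m ℕ.≤ n → fromℕ m ≤ fromℕ n
fromℕ-mono-≤ m≤n = fromℤ-mono-≤ (ℤ.+≤+ m≤n)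

0≤fromℕ : ∀ n → 0ℚ ≤ fromℕ n
0≤fromℕ n = fromℕ-mono-≤ {0} {n} ℕ.z≤n

0<fromℕ-suc : ∀ n → 0ℚ < fromℕ (suc n)
0<fromℕ-suc n = <-≤-trans (positive⁻¹ 1ℚ) (fromℕ-mono-≤ {1} {suc n} (ℕ.s≤s ℕ.z≤n))

fromℕ-suc-nonZero : ∀ n → NonZero (fromℕ (suc n))
fromℕ-suc-nonZero n = pos⇒nonZero (fromℕ (suc n)) {{positive (0<fromℕ-suc n)}}

-- The probability that the first r partial sums of a symmetric exchangeable walk without ties are positive.
central : ℕ → ℚ
central zero    = 1ℚ
central (suc r) = (fromℕ r + ½) * ((1/ fromℕ (suc r)) {{fromℕ-suc-nonZero r}} * central r)

-- `central r` is the central binomial coefficient C(2 r, r) divided by 4^r, and (r + ½) / (r + 1)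
-- is the ratio of successive terms. The recursion is used in this form, cleared of the denominator.
central-suc : ∀ r → fromℕ (suc r) * central (suc r) ≡ (fromℕ r + ½) * central r
central-suc r = begin
  n * ((fromℕ r + ½) * (n⁻¹ * central r)) ≡⟨ eq n (fromℕ r + ½) n⁻¹ (central r) ⟩
  (n * n⁻¹) * ((fromℕ r + ½) * central r) ≡⟨ cong (_* ((fromℕ r + ½) * central r)) (*-inverseʳ n {{fromℕ-suc-nonZero r}}) ⟩
  1ℚ * ((fromℕ r + ½) * central r)        ≡⟨ *-identityˡ _ ⟩
  (fromℕ r + ½) * central r               ∎
  where
  open ≡-Reasoning
  n = fromℕ (suc r)
  n⁻¹ = (1/ fromℕ (suc r)) {{fromℕ-suc-nonZero r}}
  eq : ∀ a b c d → a * (b * (c * d)) ≡ (a * c) * (b * d)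
  eq = solve-∀ ℚ-ring

0≤central : ∀ r → 0ℚ ≤ central r
0≤central zero    = 0≤1
0≤central (suc r) = *-cancelˡ-≤-pos (fromℕ (suc r)) {{positive (0<fromℕ-suc r)}} (begin
  fromℕ (suc r) * 0ℚ            ≡⟨ *-zeroʳ (fromℕ (suc r)) ⟩
  0ℚ                            ≤⟨ 0≤* (0≤+ (0≤fromℕ r) (nonNegative⁻¹ ½)) (0≤central r) ⟩
  (fromℕ r + ½) * central r     ≡⟨ central-suc r ⟨
  fromℕ (suc r) * central (suc r) ∎)
  where open ≤-Reasoning

central-antitone-suc : ∀ r → central (suc r) ≤ central r
central-antitone-suc r = *-cancelˡ-≤-pos (fromℕ (suc r)) {{positive (0<fromℕ-suc r)}} (begin
  fromℕ (suc r) * central (suc r) ≡⟨ central-suc r ⟩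
  (fromℕ r + ½) * central r       ≤⟨ *-monoʳ-≤ (0≤central r) (+-monoʳ-≤ (fromℕ r) ½≤1) ⟩
  (fromℕ r + 1ℚ) * central r      ≡⟨ cong (_* central r) (trans (+-comm (fromℕ r) 1ℚ) (sym (fromℕ-suc r))) ⟩
  fromℕ (suc r) * central r       ∎)
  where
  open ≤-Reasoning
  ½≤1 : ½ ≤ 1ℚ
  ½≤1 = 0≤q-p⇒p≤q (nonNegative⁻¹ ½)

central-antitone : ∀ {m n} → m ℕ.≤ n → central n ≤ central m
central-antitone m≤n = go (ℕ.≤⇒≤′ m≤n)
  where
  go : ∀ {m n} → m ℕ.≤′ n → central n ≤ central m
  go ℕ.≤′-refl         = ≤-refl
  go (ℕ.≤′-step {n} m≤n) = ≤-trans (central-antitone-suc n) (go m≤n)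

antidiagonal : ℕ → (ℕ → ℕ → ℚ) → ℚ
antidiagonal zero    G = G 0 0
antidiagonal (suc m) G = G 0 (suc m) + antidiagonal m (λ i j → G (suc i) j)

antidiagonal-cong : ∀ m {G H} → (∀ i j → G i j ≡ H i j) → antidiagonal m G ≡ antidiagonal m H
antidiagonal-cong zero    e = e 0 0
antidiagonal-cong (suc m) e = cong₂ _+_ (e 0 (suc m)) (antidiagonal-cong m (λ i j → e (suc i) j))

antidiagonal-+ : ∀ m G H → antidiagonal m (λ i j → G i j + H i j) ≡ antidiagonal m G + antidiagonal m H
antidiagonal-+ zero    G H = refl
antidiagonal-+ (suc m) G H = trans (cong (G 0 (suc m) + H 0 (suc m) +_) (antidiagonal-+ m (λ i j → G (suc i) j) (λ i j → H (suc i) j)))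
  (eq (G 0 (suc m)) (H 0 (suc m)) _ _)
  where
  eq : ∀ a b c d → (a + b) + (c + d) ≡ (a + c) + (b + d)
  eq = solve-∀ ℚ-ring

antidiagonal-* : ∀ m c G → antidiagonal m (λ i j → c * G i j) ≡ c * antidiagonal m G
antidiagonal-* zero    c G = refl
antidiagonal-* (suc m) c G = trans (cong (c * G 0 (suc m) +_) (antidiagonal-* m c _)) (sym (*-distribˡ-+ c _ _))

antidiagonal-snoc : ∀ m G → antidiagonal (suc m) G ≡ antidiagonal m (λ i j → G i (suc j)) + G (suc m) 0
antidiagonal-snoc zero    G = refl
antidiagonal-snoc (suc m) G = trans (cong (G 0 (2 ℕ.+ m) +_) (antidiagonal-snoc m (λ i j → G (suc i) j)))
  (sym (+-assoc (G 0 (2 ℕ.+ m)) _ _))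

antidiagonal-flip : ∀ m G → antidiagonal m G ≡ antidiagonal m (λ i j → G j i)
antidiagonal-flip zero    G = refl
antidiagonal-flip (suc m) G = begin
  G 0 (suc m) + antidiagonal m (λ i j → G (suc i) j)  ≡⟨ cong (G 0 (suc m) +_) (antidiagonal-flip m _) ⟩
  G 0 (suc m) + antidiagonal m (λ i j → G (suc j) i)  ≡⟨ +-comm (G 0 (suc m)) _ ⟩
  antidiagonal m (λ i j → G (suc j) i) + G 0 (suc m)  ≡⟨ antidiagonal-snoc m (λ i j → G j i) ⟨
  antidiagonal (suc m) (λ i j → G j i)                ∎
  where open ≡-Reasoning

antidiagonal-total : ∀ m G → antidiagonal m (λ i j → fromℕ i * G i j) + antidiagonal m (λ i j → fromℕ j * G i j)
  ≡ fromℕ m * antidiagonal m G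
antidiagonal-total m G = trans (trans (sym (antidiagonal-+ m _ _))
  (antidiagonal-cong m (λ i j → sym (*-distribʳ-+ (G i j) (fromℕ i) (fromℕ j))))) (go 0 m G)
  where
  -- The offset k keeps track of the first index, which the recursion of `antidiagonal` shifts into
  -- G.
  go : ∀ k m G → antidiagonal m (λ i j → (fromℕ (k ℕ.+ i) + fromℕ j) * G i j) ≡ fromℕ (k ℕ.+ m) * antidiagonal m G
  go k zero G = cong (_* G 0 0) (+-identityʳ (fromℕ (k ℕ.+ 0)))
  go k (suc m) G = begin
    (fromℕ (k ℕ.+ 0) + fromℕ (suc m)) * G 0 (suc m) + antidiagonal m (λ i j → (fromℕ (k ℕ.+ suc i) + fromℕ j) * G (suc i) j)
      ≡⟨ cong₂ _+_ (cong (_* G 0 (suc m)) (trans (sym (fromℕ-+ (k ℕ.+ 0) (suc m))) (cong (λ z → fromℕ (z ℕ.+ suc m)) (ℕ.+-identityʳ k))))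
           (antidiagonal-cong m (λ i j → cong (λ z → (fromℕ z + fromℕ j) * G (suc i) j) (ℕ.+-suc k i))) ⟩
    fromℕ (k ℕ.+ suc m) * G 0 (suc m) + antidiagonal m (λ i j → (fromℕ (suc k ℕ.+ i) + fromℕ j) * G (suc i) j)
      ≡⟨ cong (fromℕ (k ℕ.+ suc m) * G 0 (suc m) +_) (trans (go (suc k) m (λ i j → G (suc i) j)) 
           (cong (λ z → fromℕ z * antidiagonal m (λ i j → G (suc i) j)) (sym (ℕ.+-suc k m)))) ⟩
    fromℕ (k ℕ.+ suc m) * G 0 (suc m) + fromℕ (k ℕ.+ suc m) * antidiagonal m (λ i j → G (suc i) j)
      ≡⟨ *-distribˡ-+ (fromℕ (k ℕ.+ suc m)) _ _ ⟨
    fromℕ (k ℕ.+ suc m) * antidiagonal (suc m) G ∎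
    where open ≡-Reasoning

-- Both m C m and (m + 1) C (m + 1), for the convolution C, equal the sum of (2 i + 1) central i central j over i + j = m.
central-convolution : ∀ m → antidiagonal m (λ i j → central i * central j) ≡ 1ℚ
central-convolution zero    = *-identityˡ 1ℚ
central-convolution (suc m) = *-cancelˡ (fromℕ (suc m)) {{fromℕ-suc-nonZero m}} (begin
  fromℕ (suc m) * conv (suc m)
    ≡⟨ half (suc m) ⟩
  moment (suc m) + moment (suc m)
    ≡⟨ cong (λ z → z + z) shift ⟩
  (moment m + ½ * conv m) + (moment m + ½ * conv m)
    ≡⟨ eq (moment m) (conv m) ⟩
  (moment m + moment m) + conv m
    ≡⟨ cong₂ _+_ (sym (half m)) (sym (*-identityˡ (conv m))) ⟩
  fromℕ m * conv m + 1ℚ * conv m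
    ≡⟨ *-distribʳ-+ (conv m) (fromℕ m) 1ℚ ⟨
  (fromℕ m + 1ℚ) * conv m
    ≡⟨ cong₂ _*_ (trans (+-comm (fromℕ m) 1ℚ) (sym (fromℕ-suc m))) (central-convolution m) ⟩
  fromℕ (suc m) * 1ℚ ∎)
  where
  open ≡-Reasoning
  *-cancelˡ : ∀ r {{_ : NonZero r}} {p q} → r * p ≡ r * q → p ≡ q
  *-cancelˡ r {p} {q} e = begin
    p                   ≡⟨ *-identityˡ p ⟨
    1ℚ * p              ≡⟨ cong (_* p) (*-inverseˡ r) ⟨
    ((1/ r) * r) * p    ≡⟨ *-assoc (1/ r) r p ⟩
    (1/ r) * (r * p)    ≡⟨ cong ((1/ r) *_) e ⟩
    (1/ r) * (r * q)    ≡⟨ *-assoc (1/ r) r q ⟨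
    ((1/ r) * r) * q    ≡⟨ cong (_* q) (*-inverseˡ r) ⟩
    1ℚ * q              ≡⟨ *-identityˡ q ⟩
    q                   ∎
  conv moment : ℕ → ℚ
  conv m = antidiagonal m (λ i j → central i * central j)
  moment m = antidiagonal m (λ i j → fromℕ i * (central i * central j))
  half : ∀ m → fromℕ m * conv m ≡ moment m + moment m
  half m = trans (sym (antidiagonal-total m (λ i j → central i * central j))) (cong (moment m +_)
    (trans (antidiagonal-flip m _) (antidiagonal-cong m λ i j → cong (fromℕ i *_) (*-comm (central j) (central i)))))
  shift : moment (suc m) ≡ moment m + ½ * conv m
  shift = begin
    fromℕ 0 * (central 0 * central (suc m)) + antidiagonal m (λ i j → fromℕ (suc i) * (central (suc i) * central j))
      ≡⟨ cong₂ _+_ (*-zeroˡ (central 0 * central (suc m))) (antidiagonal-cong m λ i j →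
           trans (sym (*-assoc (fromℕ (suc i)) (central (suc i)) (central j)))
           (trans (cong (_* central j) (central-suc i)) (eq′ (fromℕ i) (central i) (central j)))) ⟩
    0ℚ + antidiagonal m (λ i j → fromℕ i * (central i * central j) + ½ * (central i * central j))
      ≡⟨ +-identityˡ _ ⟩
    antidiagonal m (λ i j → fromℕ i * (central i * central j) + ½ * (central i * central j))
      ≡⟨ trans (antidiagonal-+ m _ _) (cong (moment m +_) (antidiagonal-* m ½ _)) ⟩
    moment m + ½ * conv m ∎
    where
    eq′ : ∀ a b c → ((a + ½) * b) * c ≡ a * (b * c) + ½ * (b * c)
    eq′ = solve-∀ ℚ-ring
  eq : ∀ a b → (a + ½ * b) + (a + ½ * b) ≡ (a + a) + b
  eq = solve-∀ ℚ-ring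

4ℚ : ℚ
4ℚ = 2ℚ * 2ℚ

-- Inductively 4 (r + 1) c² ≥ 1, since (2 r + 1)² ≥ 4 r (r + 1).
central-lower : ∀ r → 1ℚ ≤ 4ℚ * fromℕ (suc r) * (central (suc r) * central (suc r))
central-lower zero    = ≤-refl
central-lower (suc r) = *-cancelˡ-≤-pos s {{positive (0<fromℕ-suc (suc r))}} (begin
  s * 1ℚ
    ≡⟨ *-identityʳ s ⟩
  s
    ≡⟨ *-identityʳ s ⟨
  s * 1ℚ
    ≤⟨ *-monoˡ-≤ (0≤fromℕ (2 ℕ.+ r)) (central-lower r) ⟩
  s * (4ℚ * n * (c * c))
    ≡⟨ cong (λ z → z * (4ℚ * n * (c * c))) (fromℕ-suc (suc r)) ⟩
  (1ℚ + n) * (4ℚ * n * (c * c))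
    ≤⟨ 0≤q-p⇒p≤q (≤-trans (0≤p² c) (≤-reflexive (eq₁ n c))) ⟩
  4ℚ * ((n + ½) * c) * ((n + ½) * c)
    ≡⟨ cong (λ z → 4ℚ * z * z) (central-suc (suc r)) ⟨
  4ℚ * (s * c′) * (s * c′)
    ≡⟨ eq₂ s c′ ⟩
  s * (4ℚ * s * (c′ * c′)) ∎)
  where
  open ≤-Reasoning
  s = fromℕ (2 ℕ.+ r)
  n = fromℕ (suc r)
  c = central (suc r)
  c′ = central (2 ℕ.+ r)
  eq₁ : ∀ n c → c * c ≡ 4ℚ * ((n + ½) * c) * ((n + ½) * c) - (1ℚ + n) * (4ℚ * n * (c * c))
  eq₁ = solve-∀ ℚ-ring
  eq₂ : ∀ s c → 4ℚ * (s * c) * (s * c) ≡ s * (4ℚ * s * (c * c))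
  eq₂ = solve-∀ ℚ-ring

-- Sparre Andersen's theorem

∑-product : ∀ (xs : List α) (ys : List β) f g → ∑ xs (λ x → ∑ ys (λ y → f x * g y)) ≡ ∑ xs f * ∑ ys g
∑-product xs ys f g = trans (∑-cong xs λ x → ∑-*ˡ ys (f x)) (∑-*ʳ xs (∑ ys g))

orderings : List α → ℚ
orderings D = ∑ (arrangements D) (λ _ → 1ℚ)

splits-length : ∀ (D : List α) → All (λ (B , C) → length B ℕ.+ length C ≡ length D) (splits D)
splits-length []      = refl ∷ []
splits-length (a ∷ D) = All.++⁺ (All.map⁺ (All.map (cong suc) (splits-length D)))
  (All.map⁺ (All.map (λ {(B , C)} e → trans (ℕ.+-suc (length B) (length C)) (cong suc e)) (splits-length D)))

module _ {α : Set} (weight : α → ℤ) where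

  splits-signedSum : ∀ D → All (λ (B , C) → (∀ t → SignedSum weight B t → SignedSum weight D t)
                                          × (∀ t → SignedSum weight C t → SignedSum weight D t)) (splits D)
  splits-signedSum []      = ((λ _ p → p) , (λ _ p → p)) ∷ []
  splits-signedSum (a ∷ D) = All.++⁺
    (All.map⁺ (All.map (λ (f , g) → extend f , λ t p → skip (g t p)) (splits-signedSum D)))
    (All.map⁺ (All.map (λ (f , g) → (λ t p → skip (f t p)) , extend g) (splits-signedSum D)))
    where
    extend : ∀ {B} → (∀ t → SignedSum weight B t → SignedSum weight D t) →
      ∀ t → SignedSum weight (a ∷ B) t → SignedSum weight (a ∷ D) t
    extend f _ (skip p)   = skip (f _ p)
    extend f _ (take s p) = take s (f _ p)

  splits-generic : ∀ D → Generic weight D → All (λ (B , C) → Generic weight B × Generic weight C) (splits D)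
  splits-generic []      gen        = (tt , tt) ∷ []
  splits-generic (a ∷ D) (a∉ , gen) = All.++⁺
    (All.map⁺ (All.zipWith (λ ((f , _) , (b , c)) → ((λ s t p → a∉ s t (f t p)) , b) , c) both))
    (All.map⁺ (All.zipWith (λ ((_ , g) , (b , c)) → b , (λ s t p → a∉ s t (g t p)) , c) both))
    where both = splits-signedSum D , splits-generic D gen

-- Taking off the splits with an empty left or right part isolates the only terms of the recursion
-- that involve the full list of letters.
offˡ offʳ : (List α × List α → ℚ) → List α × List α → ℚ
offˡ G ([] , C)    = 0ℚ
offˡ G (b ∷ B , C) = G (b ∷ B , C)
offʳ G (B , [])    = 0ℚ
offʳ G (B , c ∷ C) = G (B , c ∷ C)

∑-splits-offˡ : ∀ (D : List α) G → ∑ (splits D) G ≡ G ([] , D) + ∑ (splits D) (offˡ G)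
∑-splits-offˡ []      G = refl
∑-splits-offˡ (a ∷ D) G = begin
  ∑ (splits (a ∷ D)) G
    ≡⟨ trans (∑-splits a D G) (∑-+ (splits D)) ⟩
  S + ∑ (splits D) G′
    ≡⟨ cong (S +_) (∑-splits-offˡ D G′) ⟩
  S + (G ([] , a ∷ D) + ∑ (splits D) (offˡ G′))
    ≡⟨ eq S (G ([] , a ∷ D)) _ ⟩
  G ([] , a ∷ D) + (S + ∑ (splits D) (offˡ G′))
    ≡⟨ cong (λ z → G ([] , a ∷ D) + (S + z)) (∑-cong (splits D) λ { ([] , C) → refl ; (b ∷ B , C) → refl }) ⟩
  G ([] , a ∷ D) + (S + ∑ (splits D) (λ (B , C) → offˡ G (B , a ∷ C)))
    ≡⟨ cong (G ([] , a ∷ D) +_) (trans (∑-splits a D (offˡ G)) (∑-+ (splits D))) ⟨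
  G ([] , a ∷ D) + ∑ (splits (a ∷ D)) (offˡ G) ∎
  where
  open ≡-Reasoning
  S = ∑ (splits D) (λ (B , C) → G (a ∷ B , C))
  G′ = λ (B , C) → G (B , a ∷ C)
  eq : ∀ x y z → x + (y + z) ≡ y + (x + z)
  eq = solve-∀ ℚ-ring

∑-splits-offʳ : ∀ (D : List α) G → ∑ (splits D) G ≡ G (D , []) + ∑ (splits D) (offʳ G)
∑-splits-offʳ []      G = refl
∑-splits-offʳ (a ∷ D) G = begin
  ∑ (splits (a ∷ D)) G
    ≡⟨ trans (∑-splits a D G) (∑-+ (splits D)) ⟩
  ∑ (splits D) G′ + S
    ≡⟨ cong (_+ S) (∑-splits-offʳ D G′) ⟩
  G (a ∷ D , []) + ∑ (splits D) (offʳ G′) + S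
    ≡⟨ +-assoc (G (a ∷ D , [])) _ S ⟩
  G (a ∷ D , []) + (∑ (splits D) (offʳ G′) + S)
    ≡⟨ cong (λ z → G (a ∷ D , []) + (z + S)) (∑-cong (splits D) λ { (B , []) → refl ; (B , c ∷ C) → refl }) ⟩
  G (a ∷ D , []) + (∑ (splits D) (λ (B , C) → offʳ G (a ∷ B , C)) + S)
    ≡⟨ cong (G (a ∷ D , []) +_) (trans (∑-splits a D (offʳ G)) (∑-+ (splits D))) ⟨
  G (a ∷ D , []) + ∑ (splits (a ∷ D)) (offʳ G) ∎
  where
  open ≡-Reasoning
  S = ∑ (splits D) (λ (B , C) → G (B , a ∷ C))
  G′ = λ (B , C) → G (a ∷ B , C)

module _ {α : Set} (weight : α → ℤ) where

  ascending : List α → ℚ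
  ascending D = ∑ (arrangements D) (λ w → 𝟙 (ascends weight 0ℤ w))

  -- Cut each word at its lowest partial sum: the prefix descends to it, the suffix ascends from it,
  -- and no other cut has this property. Reflection replaces descending by ascending arrangements.
  ascending-splits : ∀ D → Generic weight D → ∑ (splits D) (λ (B , C) → ascending B * ascending C) ≡ orderings D
  ascending-splits D gen = begin
    ∑ (splits D) (λ (B , C) → ascending B * ascending C)
      ≡⟨ ∑-cong (splits D) (λ (B , C) → trans (cong (_* ascending C) (descending B))
           (sym (∑-product (arrangements B) (arrangements C) _ _))) ⟩
    ∑ (splits D) (λ (B , C) → ∑ (arrangements B) (λ ρ → ∑ (arrangements C) (λ τ →
      𝟙 (descends weight ρ) * 𝟙 (ascends weight 0ℤ τ))))
      ≡⟨ ∑-cuts-arrangements D _ ⟨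
    ∑ (arrangements D) (λ w → ∑ (cuts w) (λ (ρ , τ) → 𝟙 (descends weight ρ) * 𝟙 (ascends weight 0ℤ τ)))
      ≡⟨ ∑-cong-All (All.map (λ {w} nz → trans (∑-cong (cuts w) (λ (ρ , τ) → sym (*-identityʳ _)))
           (∑-cuts-lowest weight w nz (λ _ → 1ℚ))) (arrangements-nonVanishing weight D gen)) ⟩
    orderings D ∎
    where
    open ≡-Reasoning
    descending : ∀ B → ascending B ≡ ∑ (arrangements B) (λ w → 𝟙 (descends weight w))
    descending B = trans (sym (∑-arrangements-reflect B _))
      (∑-cong (arrangements B) λ w → cong 𝟙 (ascends-reflect weight w))

∑-cuts-antidiagonal : ∀ (w : Word α) G → ∑ (cuts w) (λ (ρ , τ) → G (length ρ) (length τ)) ≡ antidiagonal (length w) G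
∑-cuts-antidiagonal []      G = +-identityʳ (G 0 0)
∑-cuts-antidiagonal (x ∷ w) G = trans (∑-cuts x w (λ (ρ , τ) → G (length ρ) (length τ)))
  (cong (G 0 (suc (length w)) +_) (∑-cuts-antidiagonal w (λ i j → G (suc i) j)))

-- The claimed values satisfy the same recursion, since the sum over the cuts of a single word is
-- the convolution of `central` with itself, which is 1.
central-splits : ∀ (D : List α) →
  ∑ (splits D) (λ (B , C) → (central (length B) * orderings B) * (central (length C) * orderings C)) ≡ orderings D
central-splits D = begin
  ∑ (splits D) (λ (B , C) → (central (length B) * orderings B) * (central (length C) * orderings C))
    ≡⟨ ∑-cong (splits D) (λ (B , C) → trans (cong₂ _*_ (const B) (const C))
         (sym (∑-product (arrangements B) (arrangements C) _ _))) ⟩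
  ∑ (splits D) (λ (B , C) → ∑ (arrangements B) (λ ρ → ∑ (arrangements C) (λ τ →
    central (length ρ) * central (length τ))))
    ≡⟨ ∑-cuts-arrangements D _ ⟨
  ∑ (arrangements D) (λ w → ∑ (cuts w) (λ (ρ , τ) → central (length ρ) * central (length τ)))
    ≡⟨ ∑-cong (arrangements D) (λ w → trans
         (∑-cuts-antidiagonal w (λ i j → central i * central j)) (central-convolution (length w))) ⟩
  orderings D ∎
  where
  open ≡-Reasoning
  const : ∀ B → central (length B) * orderings B ≡ ∑ (arrangements B) (λ w → central (length w))
  const B = trans (sym (∑-*ˡ (arrangements B) (central (length B))))
    (∑-cong-All (All.map (λ e → trans (*-identityʳ (central (length B))) (cong central (sym e))) (arrangements-length B)))

-- Sparre Andersen: both sides satisfy the recursion obtained by cutting a word at its lowest partial sum.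
sparreAndersen : ∀ (weight : α → ℤ) D → Generic weight D → ascending weight D ≡ central (length D) * orderings D
sparreAndersen weight D = go (length D) D ℕ.≤-refl
  where
  open ≡-Reasoning
  go : ∀ N D → length D ℕ.≤ N → Generic weight D → ascending weight D ≡ central (length D) * orderings D
  go N       []      _         gen = refl
  -- The two recursions are subtracted. By induction the splits into two nonempty parts cancel, and
  -- each of the two others contributes p - q.
  go (suc N) (a ∷ D) (s≤s D≤N) gen = halve _ _ (begin
    (p + p) - (q + q)
      ≡⟨ eq p q ⟩
    (G ([] , aD) + 0ℚ) + G (aD , [])
      ≡⟨ cong (λ z → (G ([] , aD) + z) + G (aD , [])) (trans (∑-cong-All vanish) (∑-0 (splits aD))) ⟨
    (G ([] , aD) + ∑ (splits aD) (offʳ (offˡ G))) + G (aD , [])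
      ≡⟨ eq′ (G ([] , aD)) _ (G (aD , [])) ⟩
    G ([] , aD) + (G (aD , []) + ∑ (splits aD) (offʳ (offˡ G)))
      ≡⟨ trans (∑-splits-offˡ aD G) (cong (G ([] , aD) +_) (∑-splits-offʳ aD (offˡ G))) ⟨
    ∑ (splits aD) G
      ≡⟨ trans (∑-+ (splits aD)) (cong (∑ (splits aD) P +_)
           (trans (∑-cong (splits aD) λ BC → neg-as-* (Q BC)) (∑-*ˡ (splits aD) (- 1ℚ)))) ⟩
    ∑ (splits aD) P + - 1ℚ * ∑ (splits aD) Q
      ≡⟨ cong₂ (λ x y → x + - 1ℚ * y) (ascending-splits weight aD gen) (central-splits aD) ⟩
    orderings aD + - 1ℚ * orderings aD
      ≡⟨ cancel (orderings aD) ⟩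
    0ℚ ∎)
    where
    aD = a ∷ D
    p = ascending weight aD
    q = central (length aD) * orderings aD
    P Q G : List _ × List _ → ℚ
    P (B , C) = ascending weight B * ascending weight C
    Q (B , C) = (central (length B) * orderings B) * (central (length C) * orderings C)
    G BC = P BC - Q BC
    eq : ∀ p q → (p + p) - (q + q) ≡ (((1ℚ + 0ℚ) * p - (1ℚ * (1ℚ + 0ℚ)) * q) + 0ℚ) + (p * (1ℚ + 0ℚ) - q * (1ℚ * (1ℚ + 0ℚ)))
    eq = solve-∀ ℚ-ring
    eq′ : ∀ x y z → (x + y) + z ≡ x + (z + y)
    eq′ = solve-∀ ℚ-ring
    neg-as-* : ∀ x → - x ≡ - 1ℚ * x
    neg-as-* = solve-∀ ℚ-ring
    cancel : ∀ x → x + - 1ℚ * x ≡ 0ℚ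
    cancel = solve-∀ ℚ-ring
    halve : ∀ p q → (p + p) - (q + q) ≡ 0ℚ → p ≡ q
    halve p q e = trans (e₁ p q) (trans (cong (λ z → ½ * z + q) e) (e₂ q))
      where
      e₁ : ∀ p q → p ≡ ½ * ((p + p) - (q + q)) + q
      e₁ = solve-∀ ℚ-ring
      e₂ : ∀ q → ½ * 0ℚ + q ≡ q
      e₂ = solve-∀ ℚ-ring
    vanish : All (λ BC → offʳ (offˡ G) BC ≡ 0ℚ) (splits aD)
    vanish = All.zipWith (λ {BC} (e , gens) → proper BC e gens) (splits-length aD , splits-generic weight aD gen)
      where
      proper : ∀ BC → length (proj₁ BC) ℕ.+ length (proj₂ BC) ≡ suc (length D) →
        Generic weight (proj₁ BC) × Generic weight (proj₂ BC) → offʳ (offˡ G) BC ≡ 0ℚ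
      proper ([] , [])    e gens = refl
      proper ([] , _ ∷ _) e gens = refl
      proper (_ ∷ _ , []) e gens = refl
      proper (b ∷ B , c ∷ C) e (genB , genC) = trans
        (cong₂ (λ x y → x * y - Q (b ∷ B , c ∷ C)) (go N (b ∷ B) B≤N genB) (go N (c ∷ C) C≤N genC))
        (+-inverseʳ (Q (b ∷ B , c ∷ C)))
        where
        e′ : length B ℕ.+ suc (length C) ≡ length D
        e′ = ℕ.suc-injective e
        B≤N : suc (length B) ℕ.≤ N
        B≤N = ℕ.≤-trans (ℕ.≤-trans (s≤s (ℕ.m≤m+n (length B) (length C)))
          (ℕ.≤-reflexive (trans (sym (ℕ.+-suc (length B) (length C))) e′))) D≤N
        C≤N : suc (length C) ℕ.≤ N
        C≤N = ℕ.≤-trans (ℕ.≤-trans (ℕ.m≤n+m (suc (length C)) (length B)) (ℕ.≤-reflexive e′)) D≤N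

-- Breaking ties between partial sums

range : ℕ → ℕ → List ℕ
range k zero    = []
range k (suc r) = k ∷ range (suc k) r

2^_ : ℕ → ℤ
2^ zero  = 1ℤ
2^ suc k = 2^ k ℤ.+ 2^ k

0<2^ : ∀ k → 0ℤ ℤ.< 2^ k
0<2^ zero    = ℤ.+<+ (s≤s z≤n)
0<2^ (suc k) = ℤ.+-mono-< (0<2^ k) (0<2^ k)

2^-split : ∀ k j → 2^ (k ℕ.+ j) ≡ 2^ k ℤ.* 2^ j
2^-split zero    j = sym (ℤ.*-identityˡ (2^ j))
2^-split (suc k) j = trans (cong (λ z → z ℤ.+ z) (2^-split k j)) (sym (ℤ.*-distribʳ-+ (2^ j) (2^ k) (2^ k)))

odd≢0 : ∀ z → (z ℤ.+ z) ℤ.+ 1ℤ ≢ 0ℤ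
odd≢0 z e with ℤ.<-cmp z 0ℤ
... | tri≈ _ refl _ = case e of λ ()
... | tri> _ _ 0<z = ℤ.<-irrefl (sym e) (ℤ.<-≤-trans {j = 1ℤ} (ℤ.+<+ (s≤s z≤n)) (ℤ.+-monoˡ-≤ 1ℤ (ℤ.<⇒≤ (ℤ.+-mono-< 0<z 0<z))))
... | tri< z<0 _ _ = ℤ.<-irrefl e (ℤ.≤-<-trans (ℤ.≤-reflexive (eq z)) (ℤ.+-mono-≤-< (suc≤ z<0) z<0))
  where
  eq : ∀ z → (z ℤ.+ z) ℤ.+ 1ℤ ≡ (1ℤ ℤ.+ z) ℤ.+ z
  eq = ℤ-Solver.solve-∀
  suc≤ : ∀ {z} → z ℤ.< 0ℤ → 1ℤ ℤ.+ z ℤ.≤ 0ℤ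
  suc≤ = ℤ.i<j⇒suc[i]≤j

-- Ties are broken by adding distinct powers of 2, which an even larger power of 2 outweighs.
perturb : ℕ → (ℕ → ℤ) → ℕ → ℤ
perturb M u i = 2^ M ℤ.* u i ℤ.+ 2^ i

-- As k < M, the main term is divisible by 2^(k + 1), so that 2^k is the exact power of 2 in the
-- weight. In a signed sum the least letter decides the power of 2, and the sum cannot vanish.
perturb-odd : ∀ M u k j → suc (k ℕ.+ j) ≡ M →
  perturb M u k ≡ 2^ k ℤ.* ((2^ j ℤ.* u k ℤ.+ 2^ j ℤ.* u k) ℤ.+ 1ℤ)
perturb-odd .(suc (k ℕ.+ j)) u k j refl =
  trans (cong (λ z → (z ℤ.+ z) ℤ.* u k ℤ.+ 2^ k) (2^-split k j)) (eq (2^ k) (2^ j) (u k))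
  where
  eq : ∀ a b u → (a ℤ.* b ℤ.+ a ℤ.* b) ℤ.* u ℤ.+ a ≡ a ℤ.* ((b ℤ.* u ℤ.+ b ℤ.* u) ℤ.+ 1ℤ)
  eq = ℤ-Solver.solve-∀

perturb-divisible : ∀ M u k r → k ℕ.+ r ≡ M → ∀ {t} → SignedSum (perturb M u) (range k r) t → ∃ λ q → t ≡ 2^ k ℤ.* q
perturb-divisible M u k zero    e []       = 0ℤ , sym (ℤ.*-zeroʳ (2^ k))
perturb-divisible M u k (suc r) e p        with trans (sym (ℕ.+-suc k r)) e
perturb-divisible M u k (suc r) e (skip p)          | e′ with perturb-divisible M u (suc k) r e′ p
... | q , refl = q ℤ.+ q , eq (2^ k) q
  where
  eq : ∀ a q → (a ℤ.+ a) ℤ.* q ≡ a ℤ.* (q ℤ.+ q)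
  eq = ℤ-Solver.solve-∀
perturb-divisible M u k (suc r) e (take s p)        | e′ with perturb-divisible M u (suc k) r e′ p
perturb-divisible M u k (suc r) e (take Sign.+ p)   | e′ | q , refl =
  _ , trans (cong (ℤ._+ ((2^ k ℤ.+ 2^ k) ℤ.* q)) (perturb-odd M u k r e′)) (eq (2^ k) _ q)
  where
  eq : ∀ a b q → a ℤ.* b ℤ.+ (a ℤ.+ a) ℤ.* q ≡ a ℤ.* (b ℤ.+ (q ℤ.+ q))
  eq = ℤ-Solver.solve-∀
perturb-divisible M u k (suc r) e (take Sign.- p)   | e′ | q , refl =
  _ , trans (cong (λ z → ℤ.- z ℤ.+ ((2^ k ℤ.+ 2^ k) ℤ.* q)) (perturb-odd M u k r e′)) (eq (2^ k) _ q)
  where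
  eq : ∀ a b q → ℤ.- (a ℤ.* b) ℤ.+ (a ℤ.+ a) ℤ.* q ≡ a ℤ.* (ℤ.- b ℤ.+ (q ℤ.+ q))
  eq = ℤ-Solver.solve-∀

perturb-generic : ∀ M u k r → k ℕ.+ r ≡ M → Generic (perturb M u) (range k r)
perturb-generic M u k zero    e = tt
perturb-generic M u k (suc r) e = head , perturb-generic M u (suc k) r e′
  where
  e′ = trans (sym (ℕ.+-suc k r)) e
  v = 2^ r ℤ.* u k
  eq₊ : ∀ a v q → a ℤ.* ((v ℤ.+ v) ℤ.+ 1ℤ) ℤ.+ (a ℤ.+ a) ℤ.* q ≡ a ℤ.* (((v ℤ.+ q) ℤ.+ (v ℤ.+ q)) ℤ.+ 1ℤ)
  eq₊ = ℤ-Solver.solve-∀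
  eq₋ : ∀ a v q → ℤ.- (a ℤ.* ((v ℤ.+ v) ℤ.+ 1ℤ)) ℤ.+ (a ℤ.+ a) ℤ.* q ≡ a ℤ.* (((q ℤ.- v ℤ.- 1ℤ) ℤ.+ (q ℤ.- v ℤ.- 1ℤ)) ℤ.+ 1ℤ)
  eq₋ = ℤ-Solver.solve-∀
  2^k≢0 : ∀ z → 2^ k ℤ.* z ≡ 0ℤ → z ≡ 0ℤ
  2^k≢0 z e with ℤ.i*j≡0⇒i≡0∨j≡0 (2^ k) e
  ... | inj₁ 2^k≡0 = ⊥-elim (ℤ.<-irrefl (sym 2^k≡0) (0<2^ k))
  ... | inj₂ z≡0   = z≡0
  head : ∀ s t → SignedSum (perturb M u) (range (suc k) r) t → signed (perturb M u) (s , k) ℤ.+ t ≢ 0ℤ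
  head s t p with perturb-divisible M u (suc k) r e′ p
  head Sign.+ t p | q , refl = λ z → odd≢0 (v ℤ.+ q) (2^k≢0 _ (trans (sym (eq₊ (2^ k) v q))
    (trans (cong (ℤ._+ ((2^ k ℤ.+ 2^ k) ℤ.* q)) (sym (perturb-odd M u k r e′))) z)))
  head Sign.- t p | q , refl = λ z → odd≢0 (q ℤ.- v ℤ.- 1ℤ) (2^k≢0 _ (trans (sym (eq₋ (2^ k) v q))
    (trans (cong (λ x → ℤ.- x ℤ.+ ((2^ k ℤ.+ 2^ k) ℤ.* q)) (sym (perturb-odd M u k r e′))) z)))

-- A geometric series: the powers with exponents from k to k + r - 1 add up to 2^(k + r) - 2^k, and
-- minus signs or omissions only lower the sum.
powers-bound : ∀ k r {t} → SignedSum 2^_ (range k r) t → t ℤ.+ 2^ k ℤ.≤ 2^ (k ℕ.+ r)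
powers-bound k zero    []         = ℤ.≤-reflexive (trans (ℤ.+-identityˡ (2^ k)) (cong 2^_ (sym (ℕ.+-identityʳ k))))
powers-bound k (suc r) {t} (skip p) = ℤ.≤-trans (ℤ.+-monoʳ-≤ t (ℤ.≤-trans (ℤ.≤-reflexive (sym (ℤ.+-identityʳ (2^ k)))) (ℤ.+-monoʳ-≤ (2^ k) (ℤ.<⇒≤ (0<2^ k)))))
  (subst (λ z → t ℤ.+ 2^ (suc k) ℤ.≤ 2^ z) (sym (ℕ.+-suc k r)) (powers-bound (suc k) r p))
powers-bound k (suc r) (take s {t = t} p) = ℤ.≤-trans (step s)
  (subst (λ z → t ℤ.+ 2^ (suc k) ℤ.≤ 2^ z) (sym (ℕ.+-suc k r)) (powers-bound (suc k) r p))
  where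
  eq₊ : ∀ a t → (a ℤ.+ t) ℤ.+ a ≡ t ℤ.+ (a ℤ.+ a)
  eq₊ = ℤ-Solver.solve-∀
  eq₋ : ∀ a t → (ℤ.- a ℤ.+ t) ℤ.+ a ≡ t ℤ.+ (0ℤ ℤ.+ 0ℤ)
  eq₋ = ℤ-Solver.solve-∀
  step : ∀ s → (signed 2^_ (s , k) ℤ.+ t) ℤ.+ 2^ k ℤ.≤ t ℤ.+ (2^ k ℤ.+ 2^ k)
  step Sign.+ = ℤ.≤-reflexive (eq₊ (2^ k) t)
  step Sign.- = ℤ.≤-trans (ℤ.≤-reflexive (eq₋ (2^ k) t)) (ℤ.+-monoʳ-≤ t (ℤ.+-mono-≤ (ℤ.<⇒≤ (0<2^ k)) (ℤ.<⇒≤ (0<2^ k))))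

total-perturb : ∀ M u w → total (perturb M u) w ≡ 2^ M ℤ.* total u w ℤ.+ total 2^_ w
total-perturb M u []      = sym (trans (ℤ.+-identityʳ _) (ℤ.*-zeroʳ (2^ M)))
total-perturb M u ((s , i) ∷ w) = trans (cong₂ ℤ._+_ (sign s) (total-perturb M u w)) (eq (2^ M) _ _ _ _)
  where
  eq : ∀ m a b c d → (m ℤ.* a ℤ.+ b) ℤ.+ (m ℤ.* c ℤ.+ d) ≡ m ℤ.* (a ℤ.+ c) ℤ.+ (b ℤ.+ d)
  eq = ℤ-Solver.solve-∀
  neg : ∀ m a b → ℤ.- (m ℤ.* a ℤ.+ b) ≡ m ℤ.* (ℤ.- a) ℤ.+ ℤ.- b
  neg = ℤ-Solver.solve-∀
  sign : ∀ s → signed (perturb M u) (s , i) ≡ 2^ M ℤ.* signed u (s , i) ℤ.+ signed 2^_ (s , i)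
  sign Sign.+ = refl
  sign Sign.- = neg (2^ M) (u i) (2^ i)

-- A negative integer is at most -1, which contributes at most -2^M, while the added powers of 2
-- stay below 2^M. Hence the perturbed functional still separates.
perturb-negative : ∀ M u w → SignedSum 2^_ (range 0 M) (total 2^_ w) → total u w ℤ.< 0ℤ → total (perturb M u) w ℤ.< 0ℤ
perturb-negative M u w p u<0 = ℤ.≤-<-trans (ℤ.≤-reflexive (total-perturb M u w)) (begin-strict
  2^ M ℤ.* total u w ℤ.+ t          ≤⟨ ℤ.+-monoˡ-≤ t (ℤ.*-monoˡ-≤-nonNeg (2^ M) {{ℤ.nonNegative (ℤ.<⇒≤ (0<2^ M))}} (ℤ.i<j⇒i≤pred[j] u<0)) ⟩
  2^ M ℤ.* ℤ.- 1ℤ ℤ.+ t             ≡⟨ eq (2^ M) t ⟩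
  (t ℤ.+ 1ℤ) ℤ.- 2^ M ℤ.- 1ℤ        ≤⟨ ℤ.+-monoˡ-≤ (ℤ.- 1ℤ) (ℤ.i≤j⇒i-j≤0 (powers-bound 0 M p)) ⟩
  0ℤ ℤ.- 1ℤ                         <⟨ ℤ.-<+ ⟩
  0ℤ                                ∎)
  where
  open ℤ.≤-Reasoning
  t = total 2^_ w
  eq : ∀ m t → m ℤ.* ℤ.- 1ℤ ℤ.+ t ≡ (t ℤ.+ 1ℤ) ℤ.- m ℤ.- 1ℤ
  eq = ℤ-Solver.solve-∀

-- Exits from a separated set along a random word

exits changes : (Word α → Bool) → Word α → ℚ
exits F []        = 0ℚ
exits F (x ∷ w)   = 𝟙 (F [] ∧ not (F (x ∷ []))) + exits (λ v → F (x ∷ v)) w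
changes F []      = 0ℚ
changes F (x ∷ w) = 𝟙 (F [] xor F (x ∷ [])) + changes (λ v → F (x ∷ v)) w

exitsLast : (Word α → Bool) → Word α → ℚ
exitsLast F []          = 0ℚ
exitsLast F (x ∷ [])    = 𝟙 (F [] ∧ not (F (x ∷ [])))
exitsLast F (x ∷ y ∷ w) = exitsLast (λ v → F (x ∷ v)) (y ∷ w)

avoids : (Word α → Bool) → Word α → Bool
avoids F []      = not (F [])
avoids F (x ∷ w) = not (F []) ∧ avoids (λ v → F (x ∷ v)) w

-- Entrances and exits alternate, so there is at most one more entrance than exits, and only if the
-- walk starts outside.
changes≤exits : ∀ (F : Word α → Bool) w → changes F w ≤ 2ℚ * exits F w + 𝟙 (not (F []))
changes≤exits F [] = ≤-trans (0≤𝟙 (not (F []))) (≤-reflexive (eq (𝟙 (not (F [])))))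
  where
  eq : ∀ x → x ≡ 2ℚ * 0ℚ + x
  eq = solve-∀ ℚ-ring
changes≤exits F (x ∷ w) = ≤-trans (+-monoʳ-≤ (𝟙 (F [] xor F (x ∷ []))) (changes≤exits (λ v → F (x ∷ v)) w))
  (step (F []) (F (x ∷ [])) (exits (λ v → F (x ∷ v)) w))
  where
  eq₁ : ∀ e → 1ℚ + (2ℚ * e + 1ℚ) ≡ 2ℚ * (1ℚ + e) + 0ℚ
  eq₁ = solve-∀ ℚ-ring
  eq₂ : ∀ e → 1ℚ + (2ℚ * e + 0ℚ) ≡ 2ℚ * (0ℚ + e) + 1ℚ
  eq₂ = solve-∀ ℚ-ring
  eq₃ : ∀ e z → 0ℚ + (2ℚ * e + z) ≡ 2ℚ * (0ℚ + e) + z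
  eq₃ = solve-∀ ℚ-ring
  step : ∀ a b e → 𝟙 (a xor b) + (2ℚ * e + 𝟙 (not b)) ≤ 2ℚ * (𝟙 (a ∧ not b) + e) + 𝟙 (not a)
  step true  true  e = ≤-reflexive (eq₃ e 0ℚ)
  step true  false e = ≤-reflexive (eq₁ e)
  step false true  e = ≤-reflexive (eq₂ e)
  step false false e = ≤-reflexive (eq₃ e 1ℚ)

∑-cuts-null : ∀ (w : Word α) (G : Word α → ℚ) → ∑ (cuts w) (λ (ρ , τ) → 𝟙 (null ρ) * G τ) ≡ G w
∑-cuts-null []      G = trans (+-identityʳ _) (*-identityˡ (G []))
∑-cuts-null (x ∷ w) G = trans (∑-cuts x w (λ (ρ , τ) → 𝟙 (null ρ) * G τ)) (trans
  (cong₂ _+_ (*-identityˡ (G (x ∷ w))) (trans (∑-cong (cuts w) λ (_ , τ) → *-zeroˡ (G τ)) (∑-0 (cuts w))))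
  (+-identityʳ (G (x ∷ w))))

exitsLast-∷ : ∀ (F : Word α → Bool) x ρ →
  exitsLast F (x ∷ ρ) ≡ 𝟙 (null ρ) * 𝟙 (F [] ∧ not (F (x ∷ []))) + exitsLast (λ v → F (x ∷ v)) ρ
exitsLast-∷ F x []      = sym (trans (+-identityʳ _) (*-identityˡ _))
exitsLast-∷ F x (y ∷ ρ) = sym (trans (cong (_+ e) (*-zeroˡ (𝟙 (F [] ∧ not (F (x ∷ [])))))) (+-identityˡ e))
  where e = exitsLast (λ v → F (x ∷ v)) (y ∷ ρ)

∑-exitsLast : ∀ (F : Word α → Bool) w → ∑ (cuts w) (λ (ρ , τ) → exitsLast F ρ) ≡ exits F w
∑-exitsLast F []      = refl
∑-exitsLast F (x ∷ w) = begin
  ∑ (cuts (x ∷ w)) (λ (ρ , τ) → exitsLast F ρ)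
    ≡⟨ trans (∑-cuts x w (λ (ρ , τ) → exitsLast F ρ)) (+-identityˡ _) ⟩
  ∑ (cuts w) (λ (ρ , τ) → exitsLast F (x ∷ ρ))
    ≡⟨ trans (∑-cong (cuts w) λ (ρ , τ) → exitsLast-∷ F x ρ) (∑-+ (cuts w)) ⟩
  ∑ (cuts w) (λ (ρ , τ) → 𝟙 (null ρ) * 𝟙 (F [] ∧ not (F (x ∷ [])))) + ∑ (cuts w) (λ (ρ , τ) → exitsLast (λ v → F (x ∷ v)) ρ)
    ≡⟨ cong₂ _+_ (∑-cuts-null w (λ _ → 𝟙 (F [] ∧ not (F (x ∷ []))))) (∑-exitsLast (λ v → F (x ∷ v)) w) ⟩
  exits F (x ∷ w) ∎
  where open ≡-Reasoning

-- A walk has at most one exit after which it never returns. A walk that avoids the set altogether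
-- has none, and the term for this event lets the induction go through.
∑-lastExit : ∀ (F : Word α → Bool) w →
  ∑ (cuts w) (λ (ρ , τ) → exitsLast F ρ * 𝟙 (avoids (λ v → F (ρ ++ v)) τ)) + 𝟙 (avoids F w) ≤ 1ℚ
∑-lastExit F [] = ≤-trans (≤-reflexive (eq (𝟙 (not (F []))))) (𝟙≤1 (not (F [])))
  where
  eq : ∀ x → 0ℚ * x + 0ℚ + x ≡ x
  eq = solve-∀ ℚ-ring
∑-lastExit F (x ∷ w) = begin
  ∑ (cuts (x ∷ w)) H + 𝟙 (not (F []) ∧ avoids F′ w)
    ≡⟨ cong (_+ 𝟙 (not (F []) ∧ avoids F′ w)) (begin-equality
         ∑ (cuts (x ∷ w)) H
           ≡⟨ trans (∑-cuts x w H) (trans (cong (_+ S) (*-zeroˡ (𝟙 (avoids F (x ∷ w))))) (+-identityˡ S)) ⟩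
         S
           ≡⟨ trans (∑-cong (cuts w) (λ (ρ , τ) → expand ρ τ)) (∑-+ (cuts w)) ⟩
         ∑ (cuts w) (λ (ρ , τ) → 𝟙 (null ρ) * (e * 𝟙 (avoids F′ τ))) + S′
           ≡⟨ cong (_+ S′) (∑-cuts-null w (λ τ → e * 𝟙 (avoids F′ τ))) ⟩
         e * 𝟙 (avoids F′ w) + S′ ∎) ⟩
  e * 𝟙 (avoids F′ w) + S′ + 𝟙 (not (F []) ∧ avoids F′ w)
    ≤⟨ step (F []) (F (x ∷ [])) (avoids F′ w) S′ ⟩
  S′ + 𝟙 (avoids F′ w)
    ≤⟨ ∑-lastExit F′ w ⟩
  1ℚ ∎
  where
  open ≤-Reasoning
  F′ = λ v → F (x ∷ v)
  e = 𝟙 (F [] ∧ not (F (x ∷ [])))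
  H H′ : Word _ × Word _ → ℚ
  H (ρ , τ) = exitsLast F ρ * 𝟙 (avoids (λ v → F (ρ ++ v)) τ)
  H′ (ρ , τ) = exitsLast F′ ρ * 𝟙 (avoids (λ v → F′ (ρ ++ v)) τ)
  S S′ : ℚ
  S = ∑ (cuts w) (λ (ρ , τ) → H (x ∷ ρ , τ))
  S′ = ∑ (cuts w) H′
  eq : ∀ n e l a → (n * e + l) * a ≡ n * (e * a) + l * a
  eq = solve-∀ ℚ-ring
  expand : ∀ ρ τ → H (x ∷ ρ , τ) ≡ 𝟙 (null ρ) * (e * 𝟙 (avoids F′ τ)) + H′ (ρ , τ)
  expand []      τ = trans (cong (_* 𝟙 (avoids F′ τ)) (exitsLast-∷ F x [])) (eq 1ℚ e 0ℚ (𝟙 (avoids F′ τ)))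
  expand (y ∷ ρ) τ = eq₀ e (𝟙 (avoids F′ τ)) (H′ (y ∷ ρ , τ))
    where
    eq₀ : ∀ e a t → t ≡ 0ℚ * (e * a) + t
    eq₀ = solve-∀ ℚ-ring
  eq₁ : ∀ s a → 1ℚ * a + s + 0ℚ ≡ s + a
  eq₁ = solve-∀ ℚ-ring
  eq₂ : ∀ s a z → 0ℚ * a + s + z ≡ s + z
  eq₂ = solve-∀ ℚ-ring
  step : ∀ a b c s → 𝟙 (a ∧ not b) * 𝟙 c + s + 𝟙 (not a ∧ c) ≤ s + 𝟙 c
  step true  true  c s = ≤-trans (≤-reflexive (eq₂ s (𝟙 c) 0ℚ)) (+-monoʳ-≤ s (0≤𝟙 c))
  step true  false c s = ≤-reflexive (eq₁ s (𝟙 c))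
  step false b     c s = ≤-reflexive (eq₂ s (𝟙 c) (𝟙 c))

-- A visit to the set after τ₁ would bring the level c + total τ₁ down to 0 or below, which an
-- ascending walk never reaches again.
ascends⇒avoids : ∀ (weight : α → ℤ) c (F : Word α → Bool) τ → F [] ≡ false →
  (∀ τ₁ τ₂ → τ ≡ τ₁ ++ τ₂ → F τ₁ ≡ true → c ℤ.+ total weight τ₁ ℤ.≤ 0ℤ) →
  𝟙 (ascends weight c τ) ≤ 𝟙 (avoids F τ)
ascends⇒avoids weight c F []      F[] F≤0 rewrite F[] = ≤-refl
ascends⇒avoids weight c F (x ∷ τ) F[] F≤0 with 0ℤ ℤ.<? c ℤ.+ signed weight x
... | no _ = 0≤𝟙 (avoids F (x ∷ τ))
... | yes 0<c+x rewrite F[] = ascends⇒avoids weight (c ℤ.+ signed weight x) (λ v → F (x ∷ v)) τ Fx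
    λ τ₁ τ₂ e F⊤ → ℤ.≤-trans (ℤ.≤-reflexive (ℤ.+-assoc c (signed weight x) (total weight τ₁)))
      (F≤0 (x ∷ τ₁) τ₂ (cong (x ∷_) e) F⊤)
  where
  Fx : F (x ∷ []) ≡ false
  Fx with F (x ∷ []) in F⊤
  ... | false = refl
  ... | true  = ⊥-elim (ℤ.<⇒≱ 0<c+x (ℤ.≤-trans
    (ℤ.≤-reflexive (cong (ℤ._+_ c) (sym (ℤ.+-identityʳ (signed weight x))))) (F≤0 (x ∷ []) τ refl F⊤)))

subsum-prefix : ∀ (weight : α → ℤ) τ₁ τ₂ → Subsum weight (τ₁ ++ τ₂) (total weight τ₁)
subsum-prefix weight []       τ₂ = zeros weight τ₂
subsum-prefix weight (x ∷ τ₁) τ₂ = take (subsum-prefix weight τ₁ τ₂)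

-- F ρ tells whether the walk lies in the set after the prefix ρ. The functional may depend on ρ but
-- not on the continuation τ, which has to remain uniformly random once u is fixed; u i is the
-- change of the functional in step i.
Separated : (Word ℕ → Bool) → Set
Separated F = ∀ ρ → F ρ ≡ false → ∃ λ (u : ℕ → ℤ) → ∀ τ → F (ρ ++ τ) ≡ true → total u τ ℤ.< 0ℤ

length-range : ∀ k r → length (range k r) ≡ r
length-range k zero    = refl
length-range k (suc r) = cong suc (length-range (suc k) r)

exitsLast≢0 : ∀ (F : Word α → Bool) ρ → F ρ ≡ true → exitsLast F ρ ≡ 0ℚ
exitsLast≢0 F []          Fρ = refl
exitsLast≢0 F (x ∷ [])    Fρ rewrite Fρ with F []
... | true  = refl
... | false = refl
exitsLast≢0 F (x ∷ y ∷ ρ) Fρ = exitsLast≢0 (λ v → F (x ∷ v)) (y ∷ ρ) Fρ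

0≤exitsLast : ∀ (F : Word α → Bool) ρ → 0ℚ ≤ exitsLast F ρ
0≤exitsLast F []          = ≤-refl
0≤exitsLast F (x ∷ [])    = 0≤𝟙 (F [] ∧ not (F (x ∷ [])))
0≤exitsLast F (x ∷ y ∷ ρ) = 0≤exitsLast (λ v → F (x ∷ v)) (y ∷ ρ)

-- After an exit the walk ascends along the separating functional with probability at least
-- central M, and then this exit is the last one.
∑-exits : ∀ M F → Separated F → central M * ∑ (arrangements (range 0 M)) (exits F) ≤ orderings (range 0 M)
∑-exits M F sep = begin
  central M * ∑ (arrangements D) (exits F)
    ≡⟨ cong (central M *_) (trans
         (∑-cong (arrangements D) λ w → sym (∑-exitsLast F w))
         (∑-cuts-arrangements D (λ (ρ , τ) → exitsLast F ρ))) ⟩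
  central M * ∑ (splits D) (λ (B , C) → ∑ (arrangements B) (λ ρ → ∑ (arrangements C) (λ τ → exitsLast F ρ)))
    ≡⟨ ∑-*ˡ (splits D) (central M) ⟨
  ∑ (splits D) (λ (B , C) → central M * ∑ (arrangements B) (λ ρ → ∑ (arrangements C) (λ τ → exitsLast F ρ)))
    ≡⟨ ∑-cong (splits D) (λ (B , C) → trans (sym (∑-*ˡ (arrangements B) (central M)))
         (∑-cong (arrangements B) λ ρ → trans (cong (central M *_)
           (trans (∑-cong (arrangements C) λ τ → sym (*-identityʳ (exitsLast F ρ))) (∑-*ˡ (arrangements C) (exitsLast F ρ))))
           (eq (central M) (exitsLast F ρ) (orderings C)))) ⟩
  ∑ (splits D) (λ (B , C) → ∑ (arrangements B) (λ ρ → exitsLast F ρ * (central M * orderings C)))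
    ≤⟨ ∑-mono-All (All.zipWith (λ {(B , C)} (len , (gen , sub)) → ∑-mono (arrangements B) λ ρ →
         stays ρ C (C≤M B C len) gen sub) (splits-length D , suffixes)) ⟩
  ∑ (splits D) (λ (B , C) → ∑ (arrangements B) (λ ρ → ∑ (arrangements C) (λ τ →
    exitsLast F ρ * 𝟙 (avoids (λ v → F (ρ ++ v)) τ))))
    ≡⟨ ∑-cuts-arrangements D (λ (ρ , τ) → exitsLast F ρ * 𝟙 (avoids (λ v → F (ρ ++ v)) τ)) ⟨
  ∑ (arrangements D) (λ w → ∑ (cuts w) (λ (ρ , τ) → exitsLast F ρ * 𝟙 (avoids (λ v → F (ρ ++ v)) τ)))
    ≤⟨ ∑-mono (arrangements D) (λ w → p+q≤r⇒p≤r (0≤𝟙 (avoids F w)) (∑-lastExit F w)) ⟩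
  orderings D ∎
  where
  open ≤-Reasoning
  D = range 0 M
  p+q≤r⇒p≤r : ∀ {p q r} → 0ℚ ≤ q → p + q ≤ r → p ≤ r
  p+q≤r⇒p≤r {p} 0≤q p+q≤r = ≤-trans (≤-trans (≤-reflexive (sym (+-identityʳ p))) (+-monoʳ-≤ p 0≤q)) p+q≤r
  eq : ∀ c e s → c * (e * s) ≡ e * (c * s)
  eq = solve-∀ ℚ-ring
  Suffix : List ℕ → Set
  Suffix C = (∀ u → Generic (perturb M u) C) × (∀ t → SignedSum 2^_ C t → SignedSum 2^_ D t)
  suffixes : All (λ (B , C) → Suffix C) (splits D)
  suffixes = All.zipWith (λ {(B , C)} (gen , (_ , sub)) → gen , sub)
    (All.tabulate (λ BC∈ u → proj₂ (All.lookup (splits-generic (perturb M u) D (perturb-generic M u 0 M refl)) BC∈)) ,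
     splits-signedSum 2^_ D)
  C≤M : ∀ B C → length B ℕ.+ length C ≡ length D → length C ℕ.≤ M
  C≤M B C len = ℕ.≤-trans (ℕ.m≤n+m (length C) (length B)) (ℕ.≤-reflexive (trans len (length-range 0 M)))
  0≤orderings : ∀ C → 0ℚ ≤ orderings C
  0≤orderings C = 0≤∑ (arrangements C) (λ _ → 0≤1)
  -- Given ρ, the functional is fixed, while τ runs over all arrangements of the remaining letters
  -- C. If the walk is inside after ρ, there is no exit at ρ and both sides vanish.
  stays : ∀ ρ C → length C ℕ.≤ M → (∀ u → Generic (perturb M u) C) → (∀ t → SignedSum 2^_ C t → SignedSum 2^_ D t) →
    exitsLast F ρ * (central M * orderings C) ≤ ∑ (arrangements C) (λ τ → exitsLast F ρ * 𝟙 (avoids (λ v → F (ρ ++ v)) τ))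
  stays ρ C C≤M gen sub = ≤-trans (bound (F ρ) refl) (≤-reflexive (sym (∑-*ˡ (arrangements C) (exitsLast F ρ))))
    where
    bound : ∀ b → F ρ ≡ b → exitsLast F ρ * (central M * orderings C) ≤
      exitsLast F ρ * ∑ (arrangements C) (λ τ → 𝟙 (avoids (λ v → F (ρ ++ v)) τ))
    bound true  Fρ rewrite exitsLast≢0 F ρ Fρ = ≤-reflexive (trans (*-zeroˡ (central M * orderings C))
      (sym (*-zeroˡ (∑ (arrangements C) (λ τ → 𝟙 (avoids (λ v → F (ρ ++ v)) τ))))))
    bound false Fρ with sep ρ Fρ
    ... | u , u<0 = *-monoˡ-≤ (0≤exitsLast F ρ) (begin
      central M * orderings C
        ≤⟨ *-monoʳ-≤ (0≤orderings C) (central-antitone C≤M) ⟩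
      central (length C) * orderings C
        ≡⟨ sparreAndersen (perturb M u) C (gen u) ⟨
      ∑ (arrangements C) (λ τ → 𝟙 (ascends (perturb M u) 0ℤ τ))
        ≤⟨ ∑-mono-All (All.map (λ {τ} τ-sums → ascends⇒avoids (perturb M u) 0ℤ (λ v → F (ρ ++ v)) τ
             (trans (cong F (++-identityʳ ρ)) Fρ)
             λ { τ₁ τ₂ refl F⊤ → ℤ.≤-trans (ℤ.≤-reflexive (ℤ.+-identityˡ _)) (ℤ.<⇒≤ (perturb-negative M u τ₁
               (sub _ (τ-sums _ (subsum-prefix 2^_ τ₁ τ₂))) (u<0 τ₁ F⊤))) })
             (arrangements-subsum 2^_ C)) ⟩
      ∑ (arrangements C) (λ τ → 𝟙 (avoids (λ v → F (ρ ++ v)) τ)) ∎)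

-- Gordan's alternative

infixl 6 _⊕_
infixr 7 _•_

_⊕_ : ∀ {n} → Vec ℤ n → Vec ℤ n → Vec ℤ n
[]       ⊕ []       = []
(a ∷ as) ⊕ (b ∷ bs) = a ℤ.+ b ∷ as ⊕ bs

_•_ : ∀ {n} → ℤ → Vec ℤ n → Vec ℤ n
k • []       = []
k • (a ∷ as) = k ℤ.* a ∷ k • as

𝟘 : ∀ {n} → Vec ℤ n
𝟘 = Vec.replicate _ 0ℤ

dot : ∀ {n} → Vec ℤ n → Vec ℤ n → ℤ
dot []       []       = 0ℤ
dot (a ∷ as) (b ∷ bs) = a ℤ.* b ℤ.+ dot as bs

dot-⊕ˡ : ∀ {n} (u v w : Vec ℤ n) → dot (u ⊕ v) w ≡ dot u w ℤ.+ dot v w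
dot-⊕ˡ []      []      []      = refl
dot-⊕ˡ (a ∷ u) (b ∷ v) (c ∷ w) = trans (cong (ℤ._+_ ((a ℤ.+ b) ℤ.* c)) (dot-⊕ˡ u v w)) (eq a b c _ _)
  where
  eq : ∀ a b c x y → (a ℤ.+ b) ℤ.* c ℤ.+ (x ℤ.+ y) ≡ (a ℤ.* c ℤ.+ x) ℤ.+ (b ℤ.* c ℤ.+ y)
  eq = ℤ-Solver.solve-∀

dot-•ˡ : ∀ {n} k (u w : Vec ℤ n) → dot (k • u) w ≡ k ℤ.* dot u w
dot-•ˡ k []      []      = sym (ℤ.*-zeroʳ k)
dot-•ˡ k (a ∷ u) (c ∷ w) = trans (cong (ℤ._+_ (k ℤ.* a ℤ.* c)) (dot-•ˡ k u w)) (eq k a c _)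
  where
  eq : ∀ k a c x → k ℤ.* a ℤ.* c ℤ.+ k ℤ.* x ≡ k ℤ.* (a ℤ.* c ℤ.+ x)
  eq = ℤ-Solver.solve-∀

dot-comm : ∀ {n} (u w : Vec ℤ n) → dot u w ≡ dot w u
dot-comm []      []      = refl
dot-comm (a ∷ u) (c ∷ w) = cong₂ ℤ._+_ (ℤ.*-comm a c) (dot-comm u w)

dot-⊕ʳ : ∀ {n} (u v w : Vec ℤ n) → dot u (v ⊕ w) ≡ dot u v ℤ.+ dot u w
dot-⊕ʳ u v w = trans (dot-comm u (v ⊕ w)) (trans (dot-⊕ˡ v w u) (cong₂ ℤ._+_ (dot-comm v u) (dot-comm w u)))

dot-•ʳ : ∀ {n} k (u w : Vec ℤ n) → dot u (k • w) ≡ k ℤ.* dot u w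
dot-•ʳ k u w = trans (dot-comm u (k • w)) (trans (dot-•ˡ k w u) (cong (ℤ._*_ k) (dot-comm w u)))

0≤square : ∀ z → 0ℤ ℤ.≤ z ℤ.* z
0≤square (ℤ.+ n)      = ℤ.≤-trans (ℤ.+≤+ z≤n) (ℤ.≤-reflexive (ℤ.pos-* n n))
0≤square ℤ.-[1+ n ] = ℤ.+≤+ z≤n

0≤dot : ∀ {n} (u : Vec ℤ n) → 0ℤ ℤ.≤ dot u u
0≤dot []      = ℤ.≤-refl
0≤dot (a ∷ u) = ℤ.+-mono-≤ (0≤square a) (0≤dot u)

dot≡0⇒≡𝟘 : ∀ {n} (u : Vec ℤ n) → dot u u ≡ 0ℤ → u ≡ 𝟘
dot≡0⇒≡𝟘 []      e = refl
dot≡0⇒≡𝟘 (a ∷ u) e = cong₂ _∷_ (root a (ℤ.≤-antisym (≤0 (0≤dot u) e) (0≤square a)))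
  (dot≡0⇒≡𝟘 u (ℤ.≤-antisym (≤0 (0≤square a) (trans (ℤ.+-comm (dot u u) (a ℤ.* a)) e)) (0≤dot u)))
  where
  root : ∀ a → a ℤ.* a ≡ 0ℤ → a ≡ 0ℤ
  root a e with ℤ.i*j≡0⇒i≡0∨j≡0 a e
  ... | inj₁ a≡0 = a≡0
  ... | inj₂ a≡0 = a≡0
  ≤0 : ∀ {p q} → 0ℤ ℤ.≤ q → p ℤ.+ q ≡ 0ℤ → p ℤ.≤ 0ℤ
  ≤0 {p} 0≤q e = ℤ.≤-trans (ℤ.≤-trans (ℤ.≤-reflexive (sym (ℤ.+-identityʳ p))) (ℤ.+-monoʳ-≤ p 0≤q)) (ℤ.≤-reflexive e)

-- Nonempty sums of generators, with repetitions. The empty sum is left out, as otherwise 𝟘 would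
-- always belong to the cone.
data Cone {n} (L : List (Vec ℤ n)) : Vec ℤ n → Set where
  generator : ∀ {v} → v ∈ₗ L → Cone L v
  _⊞_       : ∀ {v w} → Cone L v → Cone L w → Cone L (v ⊕ w)

cone-bind : ∀ {n} {L M : List (Vec ℤ n)} → (∀ {v} → v ∈ₗ L → Cone M v) → ∀ {v} → Cone L v → Cone M v
cone-bind f (generator v∈L) = f v∈L
cone-bind f (c ⊞ d)         = cone-bind f c ⊞ cone-bind f d

one• : ∀ {n} (v : Vec ℤ n) → 1ℤ • v ≡ v
one• []      = refl
one• (a ∷ v) = cong₂ _∷_ (ℤ.*-identityˡ a) (one• v)

suc• : ∀ {n} k (v : Vec ℤ n) → v ⊕ k • v ≡ (1ℤ ℤ.+ k) • v
suc• k []      = refl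
suc• k (a ∷ v) = cong₂ _∷_ (eq k a) (suc• k v)
  where
  eq : ∀ k a → a ℤ.+ k ℤ.* a ≡ (1ℤ ℤ.+ k) ℤ.* a
  eq = ℤ-Solver.solve-∀

cone-• : ∀ {n} {L : List (Vec ℤ n)} {v} k → 0ℤ ℤ.< k → Cone L v → Cone L (k • v)
cone-• {L = L} {v} (ℤ.+ suc k) _ c = go k
  where
  go : ∀ k → Cone L ((ℤ.+ suc k) • v)
  go zero    = subst (Cone L) (sym (one• v)) c
  go (suc k) = subst (Cone L) (suc• (ℤ.+ suc k) v) (c ⊞ go k)
cone-• (ℤ.+ zero) (ℤ.+<+ ()) c

⊕-zero• : ∀ {n} (v w : Vec ℤ n) → v ≡ v ⊕ 0ℤ • w
⊕-zero• []      []      = refl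
⊕-zero• (a ∷ v) (b ∷ w) = cong₂ _∷_ (sym (ℤ.+-identityʳ a)) (⊕-zero• v w)

absSum : List ℤ → ℤ
absSum []       = 0ℤ
absSum (a ∷ as) = ℤ.+ ℤ.∣ a ∣ ℤ.+ absSum as

0≤absSum : ∀ as → 0ℤ ℤ.≤ absSum as
0≤absSum []       = ℤ.≤-refl
0≤absSum (a ∷ as) = ℤ.+-mono-≤ (ℤ.+≤+ z≤n) (0≤absSum as)

-∣a∣≤a : ∀ a → ℤ.- (ℤ.+ ℤ.∣ a ∣) ℤ.≤ a
-∣a∣≤a (ℤ.+ n)    = ℤ.≤-trans (ℤ.neg-≤-pos {n} {n}) ℤ.≤-refl
-∣a∣≤a ℤ.-[1+ n ] = ℤ.≤-refl

absSum-lower : ∀ as → All (λ a → 0ℤ ℤ.≤ absSum as ℤ.+ a) as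
absSum-lower []       = []
absSum-lower (a ∷ as) =
  ℤ.≤-trans (ℤ.≤-reflexive (sym (ℤ.+-inverseʳ (ℤ.+ ℤ.∣ a ∣)))) (ℤ.+-mono-≤
    (ℤ.≤-trans (ℤ.≤-reflexive (sym (ℤ.+-identityʳ (ℤ.+ ℤ.∣ a ∣)))) (ℤ.+-monoʳ-≤ (ℤ.+ ℤ.∣ a ∣) (0≤absSum as))) (-∣a∣≤a a)) ∷
  All.map (λ {b} 0≤ → ℤ.≤-trans 0≤ (ℤ.+-monoˡ-≤ b (ℤ.≤-trans (ℤ.≤-reflexive (sym (ℤ.+-identityˡ (absSum as))))
    (ℤ.+-monoˡ-≤ (absSum as) (ℤ.+≤+ z≤n))))) (absSum-lower as)

PositiveOn : ∀ {n} → List (Vec ℤ n) → Vec ℤ n → Set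
PositiveOn L u = All (λ b → 0ℤ ℤ.< dot u b) L

-- If u is positive on L but not on b, replace each a in L by (u · a) b - (u · b) a, on which u vanishes.
gordan : ∀ {n} (L : List (Vec ℤ n)) → (∃ λ u → PositiveOn L u) ⊎ Cone L 𝟘
gordan L = go (length L) L refl
  where
  go : ∀ N {n} (L : List (Vec ℤ n)) → length L ≡ N → (∃ λ u → PositiveOn L u) ⊎ Cone L 𝟘
  go N       []      e = inj₁ (𝟘 , [])
  go (suc N) (b ∷ L) e with go N L (ℕ.suc-injective e)
  ... | inj₂ c = inj₂ (cone-bind (generator ∘ there) c)
  ... | inj₁ (u , u>0) with 0ℤ ℤ.<? dot u b
  ...   | yes ub>0 = inj₁ (u , ub>0 ∷ u>0)
  ...   | no  ub≯0 with go N (List.map (λ a → dot u a • b ⊕ (ℤ.- dot u b) • a) L)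
                        (trans (List.length-map _ L) (ℕ.suc-injective e))
  ...     | inj₂ c = inj₂ (cone-bind lift c)
    where
    -- The coefficient 0 is treated apart, because `Cone` admits positive multiples only.
    combine : ∀ {a} k → 0ℤ ℤ.≤ k → a ∈ₗ L → 0ℤ ℤ.< dot u a → Cone (b ∷ L) (dot u a • b ⊕ k • a)
    combine (ℤ.+ zero)  _ a∈L ua>0 = subst (Cone (b ∷ L)) (⊕-zero• _ _) (cone-• (dot u _) ua>0 (generator (here refl)))
    combine (ℤ.+ suc k) _ a∈L ua>0 = cone-• (dot u _) ua>0 (generator (here refl))
      ⊞ cone-• (ℤ.+ suc k) (ℤ.+<+ (s≤s z≤n)) (generator (there a∈L))
    lift : ∀ {v} → v ∈ₗ List.map (λ a → dot u a • b ⊕ (ℤ.- dot u b) • a) L → Cone (b ∷ L) v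
    lift v∈ with ∈-map⁻ _ v∈
    ... | a , a∈L , refl = combine (ℤ.- dot u b) (ℤ.neg-mono-≤ (ℤ.≮⇒≥ ub≯0)) a∈L (All.lookup u>0 a∈L)
  ...     | inj₁ (v , v>0) with dot b b ℤ.≟ 0ℤ
  ...       | yes bb≡0 = inj₂ (subst (Cone (b ∷ L)) (dot≡0⇒≡𝟘 b bb≡0) (generator (here refl)))
  -- w vanishes on b and is a positive integer on each a in L. Adding b makes the value on b
  -- positive, and K exceeds every |b · a|, so that the values on L stay positive.
  ...       | no  bb≢0 = inj₁ (K • w ⊕ b , b>0 ∷ All.zipWith (λ (p , q) → rest p q) (All.map⁻ v>0 , All.map⁻ (absSum-lower (List.map (dot b) L))))
    where
    w = dot v b • u ⊕ (ℤ.- dot u b) • v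
    S = absSum (List.map (dot b) L)
    K = 1ℤ ℤ.+ S
    dot-w : ∀ a → dot w a ≡ dot v b ℤ.* dot u a ℤ.+ (ℤ.- dot u b) ℤ.* dot v a
    dot-w a = trans (dot-⊕ˡ (dot v b • u) _ a) (cong₂ ℤ._+_ (dot-•ˡ (dot v b) u a) (dot-•ˡ (ℤ.- dot u b) v a))
    dot-Kw : ∀ a → dot (K • w ⊕ b) a ≡ K ℤ.* dot w a ℤ.+ dot b a
    dot-Kw a = trans (dot-⊕ˡ (K • w) b a) (cong (ℤ._+ dot b a) (dot-•ˡ K w a))
    b>0 : 0ℤ ℤ.< dot (K • w ⊕ b) b
    b>0 = ℤ.<-≤-trans (ℤ.≤∧≢⇒< (0≤dot b) (bb≢0 ∘ sym)) (ℤ.≤-reflexive (sym (trans (dot-Kw b)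
      (trans (cong (λ z → K ℤ.* z ℤ.+ dot b b) (dot-w b)) (eq K (dot v b) (dot u b) (dot b b))))))
      where
      eq : ∀ k x y z → k ℤ.* (x ℤ.* y ℤ.+ ℤ.- y ℤ.* x) ℤ.+ z ≡ z
      eq = ℤ-Solver.solve-∀
    rest : ∀ {a} → 0ℤ ℤ.< dot v (dot u a • b ⊕ (ℤ.- dot u b) • a) → 0ℤ ℤ.≤ S ℤ.+ dot b a → 0ℤ ℤ.< dot (K • w ⊕ b) a
    rest {a} va>0 0≤ = begin-strict
      0ℤ                          <⟨ ℤ.+<+ (s≤s z≤n) ⟩
      1ℤ                          ≤⟨ ℤ.+-monoʳ-≤ 1ℤ 0≤ ⟩
      1ℤ ℤ.+ (S ℤ.+ dot b a)      ≡⟨ eq S (dot b a) ⟩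
      K ℤ.* 1ℤ ℤ.+ dot b a        ≤⟨ ℤ.+-monoˡ-≤ (dot b a) (ℤ.*-monoˡ-≤-nonNeg K {{ℤ.nonNegative 0≤K}} wa≥1) ⟩
      K ℤ.* dot w a ℤ.+ dot b a   ≡⟨ dot-Kw a ⟨
      dot (K • w ⊕ b) a           ∎
      where
      open ℤ.≤-Reasoning
      eq : ∀ s x → 1ℤ ℤ.+ (s ℤ.+ x) ≡ (1ℤ ℤ.+ s) ℤ.* 1ℤ ℤ.+ x
      eq = ℤ-Solver.solve-∀
      0≤K : 0ℤ ℤ.≤ K
      0≤K = ℤ.+-mono-≤ {0ℤ} {1ℤ} (ℤ.+≤+ z≤n) (0≤absSum (List.map (dot b) L))
      wa≡ : dot v (dot u a • b ⊕ (ℤ.- dot u b) • a) ≡ dot w a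
      wa≡ = trans (dot-⊕ʳ v _ _) (trans (cong₂ ℤ._+_ (trans (dot-•ʳ (dot u a) v b) (ℤ.*-comm (dot u a) (dot v b)))
        (dot-•ʳ (ℤ.- dot u b) v a)) (sym (dot-w a)))
      wa≥1 : 1ℤ ℤ.≤ dot w a
      wa≥1 = ℤ.i<j⇒suc[i]≤j (ℤ.<-≤-trans va>0 (ℤ.≤-reflexive wa≡))

-- Enumerating the points

toList-concatMap : ∀ {A B : Set} (f : A → List⁺ B) as → toList (List⁺.concatMap f as) ≡ concatMap (toList ∘ f) (toList as)
toList-concatMap f (a ∷ as) = cong (λ l → toList (f a) ++ concat l) (sym (List.map-∘ as))

toList-map : ∀ {A B : Set} (f : A → B) as → toList (List⁺.map f as) ≡ List.map f (toList as)
toList-map f (a ∷ as) = refl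

toList-vectors : ∀ {A : Set} (as : List⁺ A) n → toList (vectors as (suc n)) ≡
  concatMap (λ a → List.map (a ∷_) (toList (vectors as n))) (toList as)
toList-vectors as n = trans (toList-concatMap _ as) (List.concatMap-cong (λ a → toList-map (a ∷_) (vectors as n)) (toList as))

∈-points : ∀ {n} (x : Point n) → x ∈ₗ toList (points n)
∈-points []      = here refl
∈-points {suc n} (t ∷ x) = subst ((t ∷ x) ∈ₗ_) (sym (toList-vectors trits n))
  (∈-concatMap⁺ (λ a → List.map (a ∷_) (toList (points n))) (Any.map (λ { refl → ∈-map⁺ (t ∷_) (∈-points x) }) (∈-trits t)))
  where
  trits = -𝟏 ∷ 𝟎 List.∷ +𝟏 List.∷ List.[]
  ∈-trits : ∀ t → t ∈ₗ toList trits
  ∈-trits -𝟏 = here refl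
  ∈-trits 𝟎  = there (here refl)
  ∈-trits +𝟏 = there (there (here refl))

-- The convex hull at integer points

tritℤ : Trit → ℤ
tritℤ -𝟏 = ℤ.-1ℤ
tritℤ 𝟎  = 0ℤ
tritℤ +𝟏 = 1ℤ

intVec : ∀ {n} → Point n → Vec ℤ n
intVec = Vec.map tritℤ

infixl 6 _⊖_
_⊖_ : ∀ {n} → Vec ℤ n → Vec ℤ n → Vec ℤ n
[]       ⊖ []       = []
(a ∷ as) ⊖ (b ∷ bs) = a ℤ.- b ∷ as ⊖ bs

value-tritℤ : ∀ t → value t ≡ fromℤ (tritℤ t)
value-tritℤ -𝟏 = refl
value-tritℤ 𝟎  = refl
value-tritℤ +𝟏 = refl

embed-intVec : ∀ {n} (x : Point n) j → embed x j ≡ fromℤ (lookup (intVec x) j)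
embed-intVec (t ∷ x) zero    = value-tritℤ t
embed-intVec (t ∷ x) (suc j) = embed-intVec x j

sum-∑ : ∀ {A : Set} k (g : Fin k → A) (f : A → ℚ) → sum (λ i → f (g i)) ≡ ∑ (tabulate g) f
sum-∑ zero    g f = refl
sum-∑ (suc k) g f = cong (f (g zero) +_) (sum-∑ k (g ∘ suc) f)

fromℤ-neg : ∀ z → fromℤ (ℤ.- z) ≡ - fromℤ z
fromℤ-neg z = trans (cong fromℤ (sym (ℤ.-1*i≡-i z))) (trans (fromℤ-* ℤ.-1ℤ z) (eq (fromℤ z)))
  where
  eq : ∀ z → - 1ℚ * z ≡ - z
  eq = solve-∀ ℚ-ring

fromℤ-- : ∀ a b → fromℤ (a ℤ.- b) ≡ fromℤ a - fromℤ b
fromℤ-- a b = trans (fromℤ-+ a (ℤ.- b)) (cong (fromℤ a +_) (fromℤ-neg b))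

difference : ∀ {n} → Vec ℤ n → Point n → Vec ℤ n
difference v x = v ⊖ intVec x

∑-lookup : ∀ {A : Set} (ℓ : List A) (f : A → ℚ) → sum (λ i → f (List.lookup ℓ i)) ≡ ∑ ℓ f
∑-lookup ℓ f = trans (sum-∑ (length ℓ) (List.lookup ℓ) f) (cong (λ l → ∑ l f) (List.tabulate-lookup ℓ))

-- The points are listed with their multiplicities, so that the number of summands is at hand: it
-- becomes the common denominator of the convex weights.
cone⇒list : ∀ {n} (v : Vec ℤ n) {L d} → Cone (List.map (difference v) L) d →
  ∃ λ (ℓ : List (Point n)) → ∃ λ m → length ℓ ≡ suc m × All (_∈ₗ L) ℓ ×
    (∀ j → ∑ ℓ (λ x → fromℤ (lookup v j) - embed x j) ≡ fromℤ (lookup d j))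
cone⇒list v (generator d∈) with ∈-map⁻ (difference v) d∈
... | x , x∈L , refl = x ∷ [] , 0 , refl , x∈L ∷ [] , λ j → trans (+-identityʳ _) (coordinate v x j)
  where
  coordinate : ∀ {n} (v : Vec ℤ n) (x : Point n) j → fromℤ (lookup v j) - embed x j ≡ fromℤ (lookup (difference v x) j)
  coordinate (a ∷ v) (t ∷ x) zero    = trans (cong (λ z → fromℤ a - z) (value-tritℤ t)) (sym (fromℤ-- a (tritℤ t)))
  coordinate (a ∷ v) (t ∷ x) (suc j) = coordinate v x j
cone⇒list v (_⊞_ {d} {e} c c′) with cone⇒list v c | cone⇒list v c′
... | x ∷ ℓ , m , refl , ∈L , sums | ℓ′ , m′ , _ , ∈L′ , sums′ =
  x ∷ ℓ ++ ℓ′ , length (ℓ ++ ℓ′) , refl , All.++⁺ ∈L ∈L′ , λ j →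
    trans (∑-++ (x ∷ ℓ) ℓ′ {λ y → fromℤ (lookup v j) - embed y j}) (trans (cong₂ _+_ (sums j) (sums′ j)) (sym (coordinate d e j)))
  where
  coordinate : ∀ {n} (d e : Vec ℤ n) j → fromℤ (lookup (d ⊕ e) j) ≡ fromℤ (lookup d j) + fromℤ (lookup e j)
  coordinate (a ∷ d) (b ∷ e) zero    = fromℤ-+ a b
  coordinate (a ∷ d) (b ∷ e) (suc j) = coordinate d e j

lookup-𝟘 : ∀ {n} (j : Fin n) → lookup 𝟘 j ≡ 0ℤ
lookup-𝟘 zero    = refl
lookup-𝟘 (suc j) = lookup-𝟘 j

members : ∀ {n} → Subset n → List (Point n)
members {n} S = List.filter (T? ∘ S) (toList (points n))

∑-const : ∀ {A : Set} (ℓ : List A) c → ∑ ℓ (λ _ → c) ≡ fromℕ (length ℓ) * c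
∑-const []      c = sym (*-zeroˡ c)
∑-const (x ∷ ℓ) c = trans (cong (c +_) (∑-const ℓ c)) (trans (eq c (fromℕ (length ℓ))) (cong (_* c) (sym (fromℕ-suc (length ℓ)))))
  where
  eq : ∀ c n → c + n * c ≡ (1ℚ + n) * c
  eq = solve-∀ ℚ-ring

-- If a sum of differences v - x vanishes, then v is the average of the points x.
cone⇒conv : ∀ {n} (S : Subset n) v → Cone (List.map (difference v) (members S)) 𝟘 → Conv S (fromℤ ∘ lookup v)
cone⇒conv {n} S v c with cone⇒list v c
... | x ∷ ℓ′ , m , refl , ∈L , sums = record
  { size        = length ℓ
  ; weight      = λ _ → 1/N
  ; point       = List.lookup ℓ
  ; point∈S     = λ i → proj₂ (∈-filter⁻ (T? ∘ S) {xs = toList (points n)} (All.lookup ∈L (∈-lookup i)))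
  ; weight≥0    = λ _ → 0≤1/N
  ; weights≡1   = trans (∑-lookup ℓ (λ _ → 1/N)) (trans (∑-const ℓ 1/N) (*-inverseʳ N {{N≢0}}))
  ; combination = λ j → begin
      sum (λ i → 1/N * embed (List.lookup ℓ i) j)
        ≡⟨ trans (∑-lookup ℓ (λ y → 1/N * embed y j)) (∑-*ˡ ℓ 1/N) ⟩
      1/N * ∑ ℓ (λ y → embed y j)
        ≡⟨ cong (1/N *_) (solve-for (begin
             N * fromℤ (lookup v j) + - 1ℚ * ∑ ℓ (λ y → embed y j)
               ≡⟨ cong₂ _+_ (∑-const ℓ (fromℤ (lookup v j))) (∑-*ˡ ℓ (- 1ℚ) {λ y → embed y j}) ⟨
             ∑ ℓ (λ _ → fromℤ (lookup v j)) + ∑ ℓ (λ y → - 1ℚ * embed y j)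
               ≡⟨ ∑-+ ℓ {λ _ → fromℤ (lookup v j)} {λ y → - 1ℚ * embed y j} ⟨
             ∑ ℓ (λ y → fromℤ (lookup v j) + - 1ℚ * embed y j)
               ≡⟨ ∑-cong ℓ (λ y → eq (fromℤ (lookup v j)) (embed y j)) ⟩
             ∑ ℓ (λ y → fromℤ (lookup v j) - embed y j)
               ≡⟨ trans (sums j) (cong fromℤ (lookup-𝟘 j)) ⟩
             0ℚ ∎)) ⟩
      1/N * (N * fromℤ (lookup v j))
        ≡⟨ *-assoc 1/N N _ ⟨
      (1/N * N) * fromℤ (lookup v j)
        ≡⟨ trans (cong (_* fromℤ (lookup v j)) (*-inverseˡ N {{N≢0}})) (*-identityˡ _) ⟩
      fromℤ (lookup v j) ∎
  }
  where
  open ≡-Reasoning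
  ℓ = x ∷ ℓ′
  N = fromℕ (length ℓ)
  N≢0 = fromℕ-suc-nonZero (length ℓ′)
  1/N = (1/ N) {{N≢0}}
  0≤1/N : 0ℚ ≤ 1/N
  0≤1/N = <⇒≤ (positive⁻¹ 1/N {{1/pos⇒pos N {{ℚ.positive (0<fromℕ-suc (length ℓ′))}}}})
  eq : ∀ a b → a + - 1ℚ * b ≡ a - b
  eq = solve-∀ ℚ-ring
  eq′ : ∀ a b → b ≡ a - (a + - 1ℚ * b)
  eq′ = solve-∀ ℚ-ring
  solve-for : ∀ {a b} → a + - 1ℚ * b ≡ 0ℚ → b ≡ a
  solve-for {a} {b} e = trans (eq′ a b) (trans (cong (λ z → a - z) e) (+-identityʳ a))

-- Linearity of u, by induction on the coordinates; the weights add up to 1, so that v is the same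
-- combination of copies of itself.
separator-conv : ∀ {n k} (u v v′ : Vec ℤ n) (weight : Fin k → ℚ) (point : Fin k → Point n) →
  sum weight ≡ 1ℚ → (∀ j → sum (λ i → weight i * embed (point i) j) ≡ fromℤ (lookup v′ j)) →
  sum (λ i → weight i * fromℤ (dot u (difference v (point i)))) ≡ fromℤ (dot u (v ⊖ v′))
separator-conv {zero} {k} [] [] [] weight point one comb = trans (sum-∑ k id (λ i → weight i * 0ℚ′ (point i)))
  (trans (∑-cong (allFin k) λ i → trans (cong (weight i *_) (0ℚ′≡0 (point i))) (*-zeroʳ (weight i))) (∑-0 (allFin k)))
  where
  0ℚ′ : Point 0 → ℚ
  0ℚ′ x = fromℤ (dot [] (difference [] x))
  0ℚ′≡0 : ∀ x → 0ℚ′ x ≡ 0ℚ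
  0ℚ′≡0 [] = refl
separator-conv {suc n} {k} (a ∷ u) (b ∷ v) (c ∷ v′) weight point one comb = begin
  sum (λ i → weight i * fromℤ (dot (a ∷ u) (difference (b ∷ v) (point i))))
    ≡⟨ sum-∑ k id (λ i → weight i * fromℤ (dot (a ∷ u) (difference (b ∷ v) (point i)))) ⟩
  ∑ is (λ i → weight i * fromℤ (dot (a ∷ u) (difference (b ∷ v) (point i))))
    ≡⟨ ∑-cong is (λ i → step (weight i) (point i)) ⟩
  ∑ is (λ i → ((A * B) * weight i + (- A) * (weight i * embed (point i) zero)) + weight i * fromℤ (dot u (difference v (Vec.tail (point i)))))
    ≡⟨ trans (∑-+ is) (cong (_+ _) (trans (∑-+ is) (cong₂ _+_ (∑-*ˡ is (A * B)) (∑-*ˡ is (- A))))) ⟩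
  ((A * B) * ∑ is weight + (- A) * ∑ is (λ i → weight i * embed (point i) zero)) + ∑ is (λ i → weight i * fromℤ (dot u (difference v (Vec.tail (point i)))))
    ≡⟨ cong₂ (λ x y → ((A * B) * x + (- A) * y) + ∑ is (λ i → weight i * fromℤ (dot u (difference v (Vec.tail (point i))))))
         (trans (sym (sum-∑ k id weight)) one) (trans (sym (sum-∑ k id (λ i → weight i * embed (point i) zero))) (comb zero)) ⟩
  ((A * B) * 1ℚ + (- A) * C) + ∑ is (λ i → weight i * fromℤ (dot u (difference v (Vec.tail (point i)))))
    ≡⟨ cong (((A * B) * 1ℚ + (- A) * C) +_) (trans (sym (sum-∑ k id (λ i → weight i * fromℤ (dot u (difference v (Vec.tail (point i)))))))
         (separator-conv u v v′ weight (Vec.tail ∘ point) one tails)) ⟩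
  ((A * B) * 1ℚ + (- A) * C) + fromℤ (dot u (v ⊖ v′))
    ≡⟨ cong (_+ fromℤ (dot u (v ⊖ v′))) (trans (eq A B C) (trans (cong (A *_) (sym (fromℤ-- b c))) (sym (fromℤ-* a (b ℤ.- c))))) ⟩
  fromℤ (a ℤ.* (b ℤ.- c)) + fromℤ (dot u (v ⊖ v′))
    ≡⟨ fromℤ-+ (a ℤ.* (b ℤ.- c)) _ ⟨
  fromℤ (dot (a ∷ u) ((b ∷ v) ⊖ (c ∷ v′))) ∎
  where
  open ≡-Reasoning
  is = allFin k
  A = fromℤ a
  B = fromℤ b
  C = fromℤ c
  eq : ∀ a b c → (a * b) * 1ℚ + (- a) * c ≡ a * (b - c)
  eq = solve-∀ ℚ-ring
  step : ∀ w (x : Point (suc n)) → w * fromℤ (dot (a ∷ u) (difference (b ∷ v) x)) ≡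
    ((A * B) * w + (- A) * (w * embed x zero)) + w * fromℤ (dot u (difference v (Vec.tail x)))
  step w (t ∷ x) = trans (cong (w *_) (trans (fromℤ-+ (a ℤ.* (b ℤ.- tritℤ t)) _) (cong (_+ D)
    (trans (fromℤ-* a (b ℤ.- tritℤ t)) (cong (A *_) (trans (fromℤ-- b (tritℤ t)) (cong (λ z → B - z) (sym (value-tritℤ t)))))))))
    (eq₁ w A B (value t) D)
    where
    D = fromℤ (dot u (difference v x))
    eq₁ : ∀ w a b t d → w * (a * (b - t) + d) ≡ ((a * b) * w + (- a) * (w * t)) + w * d
    eq₁ = solve-∀ ℚ-ring
  tails : ∀ j → sum (λ i → weight i * embed (Vec.tail (point i)) j) ≡ fromℤ (lookup v′ j)
  tails j = trans (trans (sum-∑ k id (λ i → weight i * embed (Vec.tail (point i)) j))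
    (trans (∑-cong is λ i → cong (weight i *_) (embed-tail (point i))) (sym (sum-∑ k id (λ i → weight i * embed (point i) (suc j))))))
    (comb (suc j))
    where
    embed-tail : ∀ x → embed (Vec.tail x) j ≡ embed x (suc j)
    embed-tail (t ∷ x) = refl

Separates : ∀ {n} → Subset n → Vec ℤ n → Vec ℤ n → Set
Separates S v u = ∀ v′ → Conv S (fromℤ ∘ lookup v′) → 0ℤ ℤ.< dot u (v ⊖ v′)

-- The functional takes positive integer values, hence values of at least 1, on the differences with
-- the points of S, and so does every weighted mean of them.
conv-separated : ∀ {n} (S : Subset n) v u → PositiveOn (List.map (difference v) (members S)) u → Separates S v u
conv-separated {n} S v u u>0 v′ conv = ℤ.≰⇒> λ d≤0 → <-irrefl refl (<-≤-trans (positive⁻¹ 1ℚ) (begin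
  1ℚ
    ≡⟨ trans (sym weights≡1) (sum-∑ size id weight) ⟩
  ∑ is weight
    ≤⟨ ∑-mono is (λ i → ≤-trans (≤-reflexive (sym (*-identityʳ (weight i)))) (*-monoˡ-≤ (weight≥0 i) (far i))) ⟩
  ∑ is (λ i → weight i * fromℤ (dot u (difference v (point i))))
    ≡⟨ trans (sym (sum-∑ size id (λ i → weight i * fromℤ (dot u (difference v (point i)))))) (separator-conv u v v′ weight point weights≡1 combination) ⟩
  fromℤ (dot u (v ⊖ v′))
    ≤⟨ fromℤ-mono-≤ d≤0 ⟩
  0ℚ ∎))
  where
  open Conv conv
  open ≤-Reasoning
  is = allFin size
  far : ∀ i → 1ℚ ≤ fromℤ (dot u (difference v (point i)))
  far i = fromℤ-mono-≤ (ℤ.i<j⇒suc[i]≤j (All.lookup u>0 (∈-map⁺ (difference v) (∈-filter⁺ (T? ∘ S) (∈-points (point i)) (point∈S i)))))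

separation : ∀ {n} (S : Subset n) v → (∃ λ u → Separates S v u) ⊎ Conv S (fromℤ ∘ lookup v)
separation S v with gordan (List.map (difference v) (members S))
... | inj₁ (u , u>0) = inj₁ (u , conv-separated S v u u>0)
... | inj₂ c         = inj₂ (cone⇒conv S v c)

-- Membership is decided at all integer points, because a word with repeated letters may lead the
-- walk out of {0,±1}ⁿ and `Separated` speaks of all words.
hull : ∀ {n} → Subset n → Vec ℤ n → Bool
hull S v with separation S v
... | inj₁ _ = false
... | inj₂ _ = true

hull⇒conv : ∀ {n} (S : Subset n) v → hull S v ≡ true → Conv S (fromℤ ∘ lookup v)
hull⇒conv S v e with separation S v
... | inj₂ conv = conv

hull-separated : ∀ {n} (S : Subset n) v → hull S v ≡ false → ∃ λ u → ∀ v′ → hull S v′ ≡ true → 0ℤ ℤ.< dot u (v ⊖ v′)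
hull-separated S v e with separation S v
... | inj₁ (u , sep) = u , λ v′ e′ → sep v′ (hull⇒conv S v′ e′)

conv-resp : ∀ {n} {S : Subset n} {y z : Fin n → ℚ} → (∀ j → y j ≡ z j) → Conv S y → Conv S z
conv-resp e conv = record { Conv conv ; combination = λ j → trans (Conv.combination conv j) (e j) }

∈⇒conv : ∀ {n} (S : Subset n) x → T (S x) → Conv S (embed x)
∈⇒conv S x x∈S = record
  { size = 1 ; weight = λ _ → 1ℚ ; point = λ _ → x ; point∈S = λ _ → x∈S ; weight≥0 = λ _ → 0≤1 ; weights≡1 = refl
  ; combination = λ j → trans (+-identityʳ (1ℚ * embed x j)) (*-identityˡ (embed x j)) }

hull-convex : ∀ {n} (S : Subset n) → Convex S → ∀ x → hull S (intVec x) ≡ S x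
hull-convex S convex x with separation S (intVec x) | S x in Sx
... | inj₂ _         | true  = refl
... | inj₁ _         | false = refl
... | inj₂ conv      | false = ⊥-elim (subst T Sx (Equivalence.from (convex x) (conv-resp (sym ∘ embed-intVec x) conv)))
... | inj₁ (u , sep) | true  = ⊥-elim (ℤ.<-irrefl (sym (self u (intVec x)))
    (sep (intVec x) (conv-resp (embed-intVec x) (∈⇒conv S x (subst T (sym Sx) _)))))
  where
  self : ∀ {n} (u v : Vec ℤ n) → dot u (v ⊖ v) ≡ 0ℤ
  self []      []      = refl
  self (a ∷ u) (b ∷ v) = cong₂ ℤ._+_ (trans (cong (ℤ._*_ a) (ℤ.+-inverseʳ b)) (ℤ.*-zeroʳ a)) (self u v)

convex? : ∀ {n} (S : Subset n) → Dec (Convex S)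
convex? {n} S = map′
  (λ ok x → mk⇔ (∈⇒conv S x) (λ conv → from (separation S (intVec x)) (All.lookup ok (∈-points x)) (conv-resp (embed-intVec x) conv)))
  (λ convex → All.tabulate (λ {x} _ → to x (separation S (intVec x)) convex))
  (all? (λ x → check x (separation S (intVec x))) (toList (points n)))
  where
  Ok : ∀ x → (∃ λ u → Separates S (intVec x) u) ⊎ Conv S (fromℤ ∘ lookup (intVec x)) → Set
  Ok x (inj₁ _) = Data.Unit.Base.⊤
  Ok x (inj₂ _) = T (S x)
  check : ∀ x s → Dec (Ok x s)
  check x (inj₁ _) = yes _
  check x (inj₂ _) = T? (S x)
  self : ∀ {n} (u v : Vec ℤ n) → dot u (v ⊖ v) ≡ 0ℤ
  self []      []      = refl
  self (a ∷ u) (b ∷ v) = cong₂ ℤ._+_ (trans (cong (ℤ._*_ a) (ℤ.+-inverseʳ b)) (ℤ.*-zeroʳ a)) (self u v)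
  from : ∀ {x} s → Ok x s → Conv S (fromℤ ∘ lookup (intVec x)) → T (S x)
  from {x} (inj₁ (u , sep)) ok conv = ⊥-elim (ℤ.<-irrefl (sym (self u (intVec x))) (sep (intVec x) conv))
  from (inj₂ _) ok conv = ok
  to : ∀ x s → Convex S → Ok x s
  to x (inj₁ _)    convex = _
  to x (inj₂ conv) convex = Equivalence.from (convex x) (conv-resp (sym ∘ embed-intVec x) conv)

-- Expectations under product laws

vecs : List α → ∀ n → List (Vec α n)
vecs L zero    = [] ∷ []
vecs L (suc n) = concatMap (λ a → map (a ∷_) (vecs L n)) L

∏ : ∀ {n} → (α → ℚ) → Vec α n → ℚ
∏ w []      = 1ℚ
∏ w (a ∷ v) = w a * ∏ w v

-- Neither total mass 1 nor nonnegativity of w is built in: identities between laws are algebraic,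
-- and the signs of the weights depend on bounds for η and δ that come later.
𝔼 : List α → (α → ℚ) → (α → ℚ) → ℚ
𝔼 L w F = ∑ L (λ a → w a * F a)

𝔼ⁿ : List α → (α → ℚ) → ∀ n → (Vec α n → ℚ) → ℚ
𝔼ⁿ L w n = 𝔼 (vecs L n) (∏ w)

∑-vecs : ∀ (L : List α) n F → ∑ (vecs L (suc n)) F ≡ ∑ L (λ a → ∑ (vecs L n) (λ v → F (a ∷ v)))
∑-vecs L n F = trans (∑-concatMap _ L) (∑-cong L λ a → ∑-map (a ∷_) (vecs L n))

𝔼ⁿ-suc : ∀ (L : List α) w n F → 𝔼ⁿ L w (suc n) F ≡ 𝔼 L w (λ a → 𝔼ⁿ L w n (λ v → F (a ∷ v)))
𝔼ⁿ-suc L w n F = trans (∑-vecs L n (λ v → ∏ w v * F v)) (∑-cong L λ a →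
  trans (∑-cong (vecs L n) λ v → *-assoc (w a) (∏ w v) (F (a ∷ v))) (∑-*ˡ (vecs L n) (w a)))

𝔼-cong : ∀ (L : List α) w {F G : α → ℚ} → (∀ a → F a ≡ G a) → 𝔼 L w F ≡ 𝔼 L w G
𝔼-cong L w e = ∑-cong L λ a → cong (w a *_) (e a)

𝔼-mono : ∀ (L : List α) {w F G} → (∀ a → 0ℚ ≤ w a) → (∀ a → F a ≤ G a) → 𝔼 L w F ≤ 𝔼 L w G
𝔼-mono L 0≤w F≤G = ∑-mono L λ a → *-monoˡ-≤ (0≤w a) (F≤G a)

0≤𝔼 : ∀ (L : List α) {w F} → (∀ a → 0ℚ ≤ w a) → (∀ a → 0ℚ ≤ F a) → 0ℚ ≤ 𝔼 L w F
0≤𝔼 L 0≤w 0≤F = 0≤∑ L λ a → 0≤* (0≤w a) (0≤F a)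

𝔼-+ : ∀ (L : List α) w F G → 𝔼 L w (λ a → F a + G a) ≡ 𝔼 L w F + 𝔼 L w G
𝔼-+ L w F G = trans (∑-cong L λ a → *-distribˡ-+ (w a) (F a) (G a)) (∑-+ L)

𝔼-* : ∀ (L : List α) w c F → 𝔼 L w (λ a → c * F a) ≡ c * 𝔼 L w F
𝔼-* L w c F = trans (∑-cong L λ a → trans (sym (*-assoc (w a) c (F a)))
  (trans (cong (_* F a) (*-comm (w a) c)) (*-assoc c (w a) (F a)))) (∑-*ˡ L c)

𝔼-swap : ∀ (L : List α) w (M : List β) v (F : α → β → ℚ) →
  𝔼 L w (λ a → 𝔼 M v (F a)) ≡ 𝔼 M v (λ b → 𝔼 L w (λ a → F a b))
𝔼-swap L w M v F = begin
  ∑ L (λ a → w a * ∑ M (λ b → v b * F a b))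
    ≡⟨ ∑-cong L (λ a → sym (∑-*ˡ M (w a))) ⟩
  ∑ L (λ a → ∑ M (λ b → w a * (v b * F a b)))
    ≡⟨ ∑-swap L M ⟩
  ∑ M (λ b → ∑ L (λ a → w a * (v b * F a b)))
    ≡⟨ ∑-cong M (λ b → 𝔼-* L w (v b) (λ a → F a b)) ⟩
  ∑ M (λ b → v b * ∑ L (λ a → w a * F a b)) ∎
  where open ≡-Reasoning

𝔼-∑ : ∀ (L : List α) w (M : List β) (F : α → β → ℚ) → 𝔼 L w (λ a → ∑ M (F a)) ≡ ∑ M (λ b → 𝔼 L w (λ a → F a b))
𝔼-∑ L w M F = trans (∑-cong L λ a → sym (∑-*ˡ M (w a))) (∑-swap L M)

𝔼-const : ∀ (L : List α) w → ∑ L w ≡ 1ℚ → ∀ c → 𝔼 L w (λ _ → c) ≡ c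
𝔼-const L w e c = trans (∑-*ʳ L c) (trans (cong (_* c) e) (*-identityˡ c))

∏-nonneg : ∀ {n} {w : α → ℚ} → (∀ a → 0ℚ ≤ w a) → ∀ (v : Vec α n) → 0ℚ ≤ ∏ w v
∏-nonneg 0≤w []      = 0≤1
∏-nonneg 0≤w (a ∷ v) = 0≤* (0≤w a) (∏-nonneg 0≤w v)

∑-∏ : ∀ (L : List α) w → ∑ L w ≡ 1ℚ → ∀ n → ∑ (vecs L n) (∏ w) ≡ 1ℚ
∑-∏ L w e zero    = refl
∑-∏ L w e (suc n) = trans (∑-vecs L n (∏ w)) (trans
  (∑-cong L λ a → trans (∑-*ˡ (vecs L n) (w a)) (trans (cong (w a *_) (∑-∏ L w e n)) (*-identityʳ (w a)))) e)

-- The coordinates are independent, so only the laws of a single coordinate have to be compared.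
-- This translates labels into moves, and noisy pairs of trits into moves or single trits.
pushforward : ∀ (L : List α) w (h : α → γ) (M : List β) v (g : β → γ) →
  (∀ (φ : γ → ℚ) → 𝔼 L w (λ a → φ (h a)) ≡ 𝔼 M v (λ b → φ (g b))) →
  ∀ n (F : Vec γ n → ℚ) → 𝔼ⁿ L w n (λ x → F (Vec.map h x)) ≡ 𝔼ⁿ M v n (λ y → F (Vec.map g y))
pushforward L w h M v g e zero    F = refl
pushforward L w h M v g e (suc n) F = begin
  𝔼ⁿ L w (suc n) (λ x → F (Vec.map h x))
    ≡⟨ 𝔼ⁿ-suc L w n _ ⟩
  𝔼 L w (λ a → 𝔼ⁿ L w n (λ x → F (h a ∷ Vec.map h x)))
    ≡⟨ 𝔼-cong L w (λ a → pushforward L w h M v g e n (λ y → F (h a ∷ y))) ⟩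
  𝔼 L w (λ a → 𝔼ⁿ M v n (λ y → F (h a ∷ Vec.map g y)))
    ≡⟨ e (λ c → 𝔼ⁿ M v n (λ y → F (c ∷ Vec.map g y))) ⟩
  𝔼 M v (λ b → 𝔼ⁿ M v n (λ y → F (g b ∷ Vec.map g y)))
    ≡⟨ 𝔼ⁿ-suc M v n _ ⟨
  𝔼ⁿ M v (suc n) (λ y → F (Vec.map g y)) ∎
  where open ≡-Reasoning

-- The walk driven by the labels

-- A coordinate labelled jump s i leaves 0 at step i of the walk, towards s or -s according to the sign of that step.
data Label : Set where
  early : Sign → Label
  jump  : Sign → ℕ → Label
  late  : Label

unit : Sign → ℤ
unit Sign.+ = 1ℤ
unit Sign.- = -1ℤ

start : Label → ℤ
start (early s)  = unit s
start (jump s i) = 0ℤ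
start late       = 0ℤ

increment : Label → ℕ → ℤ
increment (early s)  j = 0ℤ
increment (jump s i) j = if does (i ℕ.≟ j) then unit s else 0ℤ
increment late       j = 0ℤ

coordinate : Label → Word ℕ → ℤ
coordinate ℓ ρ = start ℓ ℤ.+ total (increment ℓ) ρ

position : ∀ {n} → Vec Label n → Word ℕ → Vec ℤ n
position ls ρ = Vec.map (λ ℓ → coordinate ℓ ρ) ls

total-++ : ∀ {A : Set} (u : A → ℤ) ρ τ → total u (ρ ++ τ) ≡ total u ρ ℤ.+ total u τ
total-++ u []      τ = sym (ℤ.+-identityˡ _)
total-++ u (x ∷ ρ) τ = trans (cong (ℤ._+_ (signed u x)) (total-++ u ρ τ)) (sym (ℤ.+-assoc (signed u x) (total u ρ) (total u τ)))

-- The change of the functional u in step i with sign +. These are the weights to which Sparre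
-- Andersen's theorem is applied, after perturbation.
direction : ∀ {n} → Vec ℤ n → Vec Label n → ℕ → ℤ
direction u ls i = dot u (Vec.map (λ ℓ → increment ℓ i) ls)

dot-position : ∀ {n} (u : Vec ℤ n) ls ρ τ →
  dot u (position ls ρ ⊖ position ls (ρ ++ τ)) ≡ ℤ.- total (direction u ls) τ
dot-position []      []       ρ τ = sym (trans (cong ℤ.-_ (total-0 τ)) refl)
  where
  total-0 : ∀ τ → total (direction [] []) τ ≡ 0ℤ
  total-0 []               = refl
  total-0 ((Sign.+ , i) ∷ τ) = trans (ℤ.+-identityˡ _) (total-0 τ)
  total-0 ((Sign.- , i) ∷ τ) = trans (ℤ.+-identityˡ _) (total-0 τ)
dot-position (a ∷ u) (ℓ ∷ ls) ρ τ = begin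
  a ℤ.* (coordinate ℓ ρ ℤ.- coordinate ℓ (ρ ++ τ)) ℤ.+ dot u (position ls ρ ⊖ position ls (ρ ++ τ))
    ≡⟨ cong₂ (λ x y → a ℤ.* (coordinate ℓ ρ ℤ.- (start ℓ ℤ.+ x)) ℤ.+ y) (total-++ (increment ℓ) ρ τ) (dot-position u ls ρ τ) ⟩
  a ℤ.* (coordinate ℓ ρ ℤ.- (start ℓ ℤ.+ (total (increment ℓ) ρ ℤ.+ total (increment ℓ) τ))) ℤ.+ ℤ.- total (direction u ls) τ
    ≡⟨ eq a (start ℓ) (total (increment ℓ) ρ) (total (increment ℓ) τ) _ ⟩
  ℤ.- (a ℤ.* total (increment ℓ) τ ℤ.+ total (direction u ls) τ)
    ≡⟨ cong ℤ.-_ (linear τ) ⟨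
  ℤ.- total (direction (a ∷ u) (ℓ ∷ ls)) τ ∎
  where
  open ≡-Reasoning
  eq : ∀ a s x y d → a ℤ.* ((s ℤ.+ x) ℤ.- (s ℤ.+ (x ℤ.+ y))) ℤ.+ ℤ.- d ≡ ℤ.- (a ℤ.* y ℤ.+ d)
  eq = ℤ-Solver.solve-∀
  eq₊ : ∀ a x y d e → (a ℤ.* x ℤ.+ d) ℤ.+ (a ℤ.* y ℤ.+ e) ≡ a ℤ.* (x ℤ.+ y) ℤ.+ (d ℤ.+ e)
  eq₊ = ℤ-Solver.solve-∀
  eq₋ : ∀ a x y d e → ℤ.- (a ℤ.* x ℤ.+ d) ℤ.+ (a ℤ.* y ℤ.+ e) ≡ a ℤ.* (ℤ.- x ℤ.+ y) ℤ.+ (ℤ.- d ℤ.+ e)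
  eq₋ = ℤ-Solver.solve-∀
  linear : ∀ τ → total (direction (a ∷ u) (ℓ ∷ ls)) τ ≡ a ℤ.* total (increment ℓ) τ ℤ.+ total (direction u ls) τ
  linear []               = sym (trans (ℤ.+-identityʳ _) (ℤ.*-zeroʳ a))
  linear ((Sign.+ , i) ∷ τ) = trans (cong (ℤ._+_ (a ℤ.* increment ℓ i ℤ.+ direction u ls i)) (linear τ)) (eq₊ a (increment ℓ i) (total (increment ℓ) τ) _ _)
  linear ((Sign.- , i) ∷ τ) = trans (cong (ℤ._+_ (ℤ.- (a ℤ.* increment ℓ i ℤ.+ direction u ls i))) (linear τ)) (eq₋ a (increment ℓ i) (total (increment ℓ) τ) _ _)

-- A return from outside into the hull lowers the separating functional, and the change along τ is
-- exactly the total of `direction`.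
hull-path-separated : ∀ {n} (S : Subset n) ls → Separated (λ ρ → hull S (position ls ρ))
hull-path-separated S ls ρ out with hull-separated S (position ls ρ) out
... | u , sep = direction u ls , λ τ e → ℤ.neg-cancel-< (ℤ.<-≤-trans (sep _ e) (ℤ.≤-reflexive (dot-position u ls ρ τ)))

-- Arrangements as permutations of the steps

Distinct : Word ℕ → Set
Distinct []      = ⊤
Distinct (x ∷ w) = All (λ y → proj₂ x ≢ proj₂ y) w × Distinct w

insertions-distinct : ∀ x w → All (λ y → proj₂ x ≢ proj₂ y) w → Distinct w → All Distinct (insertions x w)
insertions-distinct x []      x∉       dw        = ([] , tt) ∷ []
insertions-distinct x (y ∷ w) (x≢y ∷ x∉) (y∉ , dw) = ((x≢y ∷ x∉) , y∉ , dw) ∷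
  All.map⁺ (All.zipWith (λ (y∉′ , d) → y∉′ , d) (insertions-All (λ e → x≢y (sym e)) w y∉ , insertions-distinct x w x∉ dw))
  where
  insertions-All : ∀ {P : Sign × ℕ → Set} {x} → P x → ∀ w → All P w → All (All P) (insertions x w)
  insertions-All px []      []        = (px ∷ []) ∷ []
  insertions-All px (y ∷ w) (py ∷ pw) = (px ∷ py ∷ pw) ∷ All.map⁺ (All.map (py ∷_) (insertions-All px w pw))

-- That an arrangement is a permutation is used in this form: a sum over the jump labels may be run
-- along the word.
arrangements-∑ : ∀ {A : Set} (D : List A) → All (λ w → ∀ (K : A → ℚ) → ∑ w (λ (s , i) → K i) ≡ ∑ D K) (arrangements D)
arrangements-∑ = arrangements-elim (λ D w → ∀ K → ∑ w (λ (s , i) → K i) ≡ ∑ D K) (λ K → refl)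
  λ s a D w ih → All.map (λ e K → trans (e (λ (s , i) → K i)) (cong (K a +_) (ih K))) (inserted (s , a) w)
  where
  eq : ∀ a b c → b + (a + c) ≡ a + (b + c)
  eq = solve-∀ ℚ-ring
  inserted : ∀ {A : Set} (x : Sign × A) w → All (λ v → ∀ K → ∑ v K ≡ K x + ∑ w K) (insertions x w)
  inserted x []      = (λ K → refl) ∷ []
  inserted x (y ∷ w) = (λ K → refl) ∷ All.map⁺ (All.map (λ e K → trans (cong (K y +_) (e K)) (eq (K x) (K y) _)) (inserted x w))

arrangements-distinct : ∀ k r → All (λ w → All (λ x → k ℕ.≤ proj₂ x) w × Distinct w) (arrangements (range k r))
arrangements-distinct k zero    = ([] , tt) ∷ []
arrangements-distinct k (suc r) = All.concat⁺ (All.map⁺ (All.map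
  (λ {w} (≥ , d) → All.++⁺ (inserted Sign.+ w ≥ d) (inserted Sign.- w ≥ d)) (arrangements-distinct (suc k) r)))
  where
  insertions-≥ : ∀ s w → All (λ x → suc k ℕ.≤ proj₂ x) w → All (All (λ x → k ℕ.≤ proj₂ x)) (insertions (s , k) w)
  insertions-≥ s []      []        = (ℕ.≤-refl ∷ []) ∷ []
  insertions-≥ s (y ∷ w) (k<y ∷ p) = (ℕ.≤-refl ∷ ℕ.<⇒≤ k<y ∷ All.map ℕ.<⇒≤ p) ∷
    All.map⁺ (All.map (ℕ.<⇒≤ k<y ∷_) (insertions-≥ s w p))
  inserted : ∀ s w → All (λ x → suc k ℕ.≤ proj₂ x) w → Distinct w →
    All (λ v → All (λ x → k ℕ.≤ proj₂ x) v × Distinct v) (insertions (s , k) w)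
  inserted s w ≥ d = All.zip (insertions-≥ s w ≥ , insertions-distinct (s , k) w (All.map (λ k<y e → ℕ.<-irrefl e k<y) ≥) d)

signed-absent : ∀ s i t {j} → i ≢ j → signed (increment (jump s i)) (t , j) ≡ 0ℤ
signed-absent s i t {j} i≢j = by-sign t
  where
  absent : increment (jump s i) j ≡ 0ℤ
  absent = cong (λ b → if b then unit s else 0ℤ) (dec-false (i ℕ.≟ j) i≢j)
  by-sign : ∀ t → signed (increment (jump s i)) (t , j) ≡ 0ℤ
  by-sign Sign.+ = absent
  by-sign Sign.- = cong ℤ.-_ absent

total-absent : ∀ s i w → All (λ y → i ≢ proj₂ y) w → total (increment (jump s i)) w ≡ 0ℤ
total-absent s i []            []         = refl
total-absent s i ((t , j) ∷ w) (i≢j ∷ i∉) = cong₂ ℤ._+_ (signed-absent s i t i≢j) (total-absent s i w i∉)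

signed-present : ∀ s t i → signed (increment (jump s i)) (t , i) ≡ unit (s Sign.* t)
signed-present s t i = trans (present t) (times s t)
  where
  own : increment (jump s i) i ≡ unit s
  own = cong (λ b → if b then unit s else 0ℤ) (dec-true (i ℕ.≟ i) refl)
  apply : Sign → ℤ → ℤ
  apply Sign.+ z = z
  apply Sign.- z = ℤ.- z
  present : ∀ t → signed (increment (jump s i)) (t , i) ≡ apply t (unit s)
  present Sign.+ = own
  present Sign.- = cong ℤ.-_ own
  times : ∀ s t → apply t (unit s) ≡ unit (s Sign.* t)
  times Sign.+ Sign.+ = refl
  times Sign.+ Sign.- = refl
  times Sign.- Sign.+ = refl
  times Sign.- Sign.- = refl

total-present : ∀ w → Distinct w → All (λ (r , i) → ∀ t → total (increment (jump t i)) w ≡ unit (t Sign.* r)) w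
total-present []            distinct        = []
total-present ((r , i) ∷ w) (i∉w , distinct) =
  (λ t → trans (cong₂ ℤ._+_ (signed-present t r i) (total-absent t i w i∉w)) (ℤ.+-identityʳ _)) ∷
  All.zipWith (λ { {r′ , j} (i≢j , present) t → trans
    (cong₂ ℤ._+_ (signed-absent t j r (λ e → i≢j (sym e))) (present t)) (ℤ.+-identityˡ _) })
    (i∉w , total-present w distinct)

distinct-++ : ∀ ρ {τ} → Distinct (ρ ++ τ) →
  Distinct ρ × Distinct τ × All (λ x → All (λ y → proj₂ x ≢ proj₂ y) τ) ρ
distinct-++ []      distinct        = tt , distinct , []
distinct-++ (x ∷ ρ) (x∉ , distinct) with distinct-++ ρ distinct
... | dρ , dτ , apart = (All.++⁻ˡ ρ x∉ , dρ) , dτ , (All.++⁻ʳ ρ x∉ ∷ apart)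

-- The law of a single step

⅓ : ℚ
⅓ = ℤ.+ 1 ℚ./ 3

data Move : Set where
  rest  : Move
  leave : Sign → Move
  stay  : Sign → Move

trit : Sign → Trit
trit Sign.+ = +𝟏
trit Sign.- = -𝟏

before after : Move → Trit
before rest      = 𝟎
before (leave s) = 𝟎
before (stay s)  = trit s
after rest       = 𝟎
after (leave s)  = trit s
after (stay s)   = trit s

moves : List Move
moves = rest ∷ leave Sign.+ ∷ leave Sign.- ∷ stay Sign.+ ∷ stay Sign.- ∷ []

-- The law of a coordinate before and after a step. It is 0 after the step with probability ⅓ + 2 δ.
moveWeight : ℚ → ℚ → Move → ℚ
moveWeight η δ rest      = ⅓ + 2ℚ * δ
moveWeight η δ (leave s) = 2ℚ * η
moveWeight η δ (stay s)  = ⅓ - 2ℚ * η - δ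

changeProbability : ∀ {n} → Subset n → ℚ → ℚ → ℚ
changeProbability {n} S η δ =
  𝔼ⁿ moves (moveWeight η δ) n (λ v → 𝟙 (S (Vec.map before v) xor S (Vec.map after v)))

labels : ℕ → List Label
labels M = early Sign.+ ∷ early Sign.- ∷ late ∷ List.concatMap (λ i → jump Sign.+ i ∷ jump Sign.- i ∷ []) (range 0 M)

-- Here i steps come before and j after the given one. Each step moves a share 4 η of all
-- coordinates away from 0, so the excess of zeros falls linearly; it is zero after the step in the
-- middle.
drift : ℚ → ℕ → ℕ → ℚ
drift η i j = (fromℕ j - fromℕ i) * η

module _ (η : ℚ) (m : ℕ) where

  -- The walk has m + 1 steps. The masses of `early` and `late` are forced by symmetry, total mass 1
  -- and the wish that a step with equally many steps before and after it end in the uniform law.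
  labelWeight : Label → ℚ
  labelWeight (early s)  = ⅓ - 2ℚ * η - fromℕ m * η
  labelWeight (jump s i) = 2ℚ * η
  labelWeight late       = ⅓ - 2ℚ * (fromℕ m * η)

  𝔼-labels : ∀ φ → 𝔼 (labels (suc m)) labelWeight φ ≡
    labelWeight (early Sign.+) * φ (early Sign.+) + labelWeight (early Sign.-) * φ (early Sign.-) + labelWeight late * φ late
    + ∑ (range 0 (suc m)) (λ i → 2ℚ * η * φ (jump Sign.+ i) + 2ℚ * η * φ (jump Sign.- i))
  𝔼-labels φ = trans (cong (λ z → a + (b + (c + z))) (trans (∑-concatMap (λ i → jump Sign.+ i ∷ jump Sign.- i ∷ []) (range 0 (suc m)) {λ ℓ → labelWeight ℓ * φ ℓ})
    (∑-cong (range 0 (suc m)) λ i → cong (2ℚ * η * φ (jump Sign.+ i) +_) (+-identityʳ _)))) (eq a b c _)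
    where
    a = labelWeight (early Sign.+) * φ (early Sign.+)
    b = labelWeight (early Sign.-) * φ (early Sign.-)
    c = labelWeight late * φ late
    eq : ∀ a b c d → a + (b + (c + d)) ≡ a + b + c + d
    eq = solve-∀ ℚ-ring

  ∑-labelWeight : ∑ (labels (suc m)) labelWeight ≡ 1ℚ
  ∑-labelWeight = begin
    ∑ (labels (suc m)) labelWeight
      ≡⟨ ∑-cong (labels (suc m)) (λ ℓ → sym (*-identityʳ (labelWeight ℓ))) ⟩
    𝔼 (labels (suc m)) labelWeight (λ _ → 1ℚ)
      ≡⟨ 𝔼-labels (λ _ → 1ℚ) ⟩
    a * 1ℚ + a * 1ℚ + b * 1ℚ + ∑ (range 0 (suc m)) (λ i → 2ℚ * η * 1ℚ + 2ℚ * η * 1ℚ)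
      ≡⟨ cong (a * 1ℚ + a * 1ℚ + b * 1ℚ +_) (trans (∑-const (range 0 (suc m)) _)
           (cong (λ z → z * (2ℚ * η * 1ℚ + 2ℚ * η * 1ℚ)) (trans (cong fromℕ (length-range 0 (suc m))) (fromℕ-suc m)))) ⟩
    a * 1ℚ + a * 1ℚ + b * 1ℚ + (1ℚ + fromℕ m) * (2ℚ * η * 1ℚ + 2ℚ * η * 1ℚ)
      ≡⟨ eq η (fromℕ m) ⟩
    1ℚ ∎
    where
    open ≡-Reasoning
    a = ⅓ - 2ℚ * η - fromℕ m * η
    b = ⅓ - 2ℚ * (fromℕ m * η)
    eq : ∀ η m → (⅓ - 2ℚ * η - m * η) * 1ℚ + (⅓ - 2ℚ * η - m * η) * 1ℚ + (⅓ - 2ℚ * (m * η)) * 1ℚ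
      + (1ℚ + m) * (2ℚ * η * 1ℚ + 2ℚ * η * 1ℚ) ≡ 1ℚ
    eq = solve-∀ ℚ-ring

  -- At the step y, labels of steps in ρ behave like `stay`, those of y like `leave`, and those of
  -- steps in τ rest at 0 like `late`. The lengths of ρ and τ count them.
  stepLaw : ∀ ρ y τ → length ρ ℕ.+ length τ ≡ m → Distinct (ρ ++ y ∷ τ) →
    (∀ (K : ℕ → ℚ) → ∑ (ρ ++ y ∷ τ) (λ (s , i) → K i) ≡ ∑ (range 0 (suc m)) K) →
    ∀ (φ : ℤ × ℤ → ℚ) →
    𝔼 (labels (suc m)) labelWeight (λ ℓ → φ (coordinate ℓ ρ , coordinate ℓ (ρ ++ y ∷ []))) ≡
    𝔼 moves (moveWeight η (drift η (length ρ) (length τ))) (λ v → φ (tritℤ (before v) , tritℤ (after v)))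
  stepLaw ρ (s , k) τ len distinct perm φ = begin
    𝔼 (labels (suc m)) labelWeight ψ
      ≡⟨ 𝔼-labels ψ ⟩
    a * ψ (early Sign.+) + a * ψ (early Sign.-) + b * ψ late + ∑ (range 0 (suc m)) K
      ≡⟨ cong₂ _+_ (cong₂ _+_ (cong₂ _+_ (still (early Sign.+) (inert-early Sign.+)) (still (early Sign.-) (inert-early Sign.-)))
           (still late inert-late)) (trans (sym (perm K)) (trans (∑-++ ρ ((s , k) ∷ τ))
           (cong₂ _+_ (trans (∑-cong-All used) (∑-const ρ _)) (cong₂ _+_ current (trans (∑-cong-All unused) (∑-const τ _)))))) ⟩
    a * p + a * q + b * z + (fromℕ (length ρ) * (c * p + c * q) + ((c * φ (0ℤ , 1ℤ) + c * φ (0ℤ , -1ℤ)) + fromℕ (length τ) * (c * z + c * z)))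
      ≡⟨ eq η (fromℕ m) (fromℕ (length ρ)) (fromℕ (length τ)) p q z (φ (0ℤ , 1ℤ)) (φ (0ℤ , -1ℤ)) (trans (cong fromℕ (sym len)) (fromℕ-+ (length ρ) (length τ))) ⟩
    𝔼 moves (moveWeight η (drift η (length ρ) (length τ))) (λ v → φ (tritℤ (before v) , tritℤ (after v))) ∎
    where
    open ≡-Reasoning
    a = ⅓ - 2ℚ * η - fromℕ m * η
    b = ⅓ - 2ℚ * (fromℕ m * η)
    c = 2ℚ * η
    p = φ (1ℤ , 1ℤ)
    q = φ (-1ℤ , -1ℤ)
    z = φ (0ℤ , 0ℤ)
    ψ : Label → ℚ
    ψ ℓ = φ (coordinate ℓ ρ , coordinate ℓ (ρ ++ (s , k) ∷ []))
    K : ℕ → ℚ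
    -- Both labels of step i are lumped together: the sign of its letter merely interchanges them
    -- and drops out.
    K i = c * ψ (jump Sign.+ i) + c * ψ (jump Sign.- i)
    eq′ : ∀ η i j p q z x y →
      (⅓ - 2ℚ * η - (i + j) * η) * p + (⅓ - 2ℚ * η - (i + j) * η) * q + (⅓ - 2ℚ * ((i + j) * η)) * z
      + (i * (2ℚ * η * p + 2ℚ * η * q) + ((2ℚ * η * x + 2ℚ * η * y) + j * (2ℚ * η * z + 2ℚ * η * z)))
      ≡ (⅓ + 2ℚ * ((j - i) * η)) * z + (2ℚ * η * x + (2ℚ * η * y + ((⅓ - 2ℚ * η - (j - i) * η) * p + ((⅓ - 2ℚ * η - (j - i) * η) * q + 0ℚ))))
    eq′ = solve-∀ ℚ-ring
    eq : ∀ η m i j p q z x y → m ≡ i + j →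
      (⅓ - 2ℚ * η - m * η) * p + (⅓ - 2ℚ * η - m * η) * q + (⅓ - 2ℚ * (m * η)) * z
      + (i * (2ℚ * η * p + 2ℚ * η * q) + ((2ℚ * η * x + 2ℚ * η * y) + j * (2ℚ * η * z + 2ℚ * η * z)))
      ≡ (⅓ + 2ℚ * ((j - i) * η)) * z + (2ℚ * η * x + (2ℚ * η * y + ((⅓ - 2ℚ * η - (j - i) * η) * p + ((⅓ - 2ℚ * η - (j - i) * η) * q + 0ℚ))))
    eq η _ i j p q z x y refl = eq′ η i j p q z x y
    inert-early : ∀ t w → total (increment (early t)) w ≡ 0ℤ
    inert-early t []              = refl
    inert-early t ((Sign.+ , _) ∷ w) = trans (ℤ.+-identityˡ _) (inert-early t w)
    inert-early t ((Sign.- , _) ∷ w) = trans (ℤ.+-identityˡ _) (inert-early t w)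
    inert-late : ∀ w → total (increment late) w ≡ 0ℤ
    inert-late []              = refl
    inert-late ((Sign.+ , _) ∷ w) = trans (ℤ.+-identityˡ _) (inert-late w)
    inert-late ((Sign.- , _) ∷ w) = trans (ℤ.+-identityˡ _) (inert-late w)
    still : ∀ ℓ → (∀ w → total (increment ℓ) w ≡ 0ℤ) → labelWeight ℓ * ψ ℓ ≡ labelWeight ℓ * φ (start ℓ , start ℓ)
    still ℓ inert = cong₂ (λ u v → labelWeight ℓ * φ (u , v)) (same ρ) (same (ρ ++ (s , k) ∷ []))
      where
      same : ∀ w → coordinate ℓ w ≡ start ℓ
      same w = trans (cong (ℤ._+_ (start ℓ)) (inert w)) (ℤ.+-identityʳ _)
    coordinates : ∀ t i {x y} → total (increment (jump t i)) ρ ≡ x → total (increment (jump t i)) ((s , k) ∷ []) ≡ y →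
      ψ (jump t i) ≡ φ (x , x ℤ.+ y)
    coordinates t i refl refl = cong₂ (λ u v → φ (u , v)) (ℤ.+-identityˡ _)
      (trans (ℤ.+-identityˡ _) (total-++ (increment (jump t i)) ρ ((s , k) ∷ [])))
    letter : ∀ r → c * φ (unit (Sign.+ Sign.* r) , unit (Sign.+ Sign.* r)) + c * φ (unit (Sign.- Sign.* r) , unit (Sign.- Sign.* r)) ≡ c * p + c * q
    letter Sign.+ = refl
    letter Sign.- = +-comm (c * q) (c * p)
    next : ∀ r → c * φ (0ℤ , unit (Sign.+ Sign.* r)) + c * φ (0ℤ , unit (Sign.- Sign.* r)) ≡ c * φ (0ℤ , 1ℤ) + c * φ (0ℤ , -1ℤ)
    next Sign.+ = refl
    next Sign.- = +-comm (c * φ (0ℤ , -1ℤ)) (c * φ (0ℤ , 1ℤ))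
    parts = distinct-++ ρ distinct
    used : All (λ (r , i) → K i ≡ c * p + c * q) ρ
    used = All.zipWith (λ { {r , i} (seen , away ∷ _) → trans
        (cong₂ (λ u v → c * u + c * v) (moved (seen Sign.+) away) (moved (seen Sign.-) away)) (letter r) })
      (total-present ρ (proj₁ parts) , proj₂ (proj₂ parts))
      where
      moved : ∀ {t i x} → total (increment (jump t i)) ρ ≡ x → i ≢ k → ψ (jump t i) ≡ φ (x , x)
      moved {t} {i} {x} e i≢k = trans (coordinates t i e (total-absent t i ((s , k) ∷ []) (i≢k ∷ [])))
        (cong (λ v → φ (x , v)) (ℤ.+-identityʳ x))
    k∉ρ : All (λ y → k ≢ proj₂ y) ρ
    k∉ρ = All.map (λ { (i≢k ∷ _) e → i≢k (sym e) }) (proj₂ (proj₂ parts))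
    current : K k ≡ c * φ (0ℤ , 1ℤ) + c * φ (0ℤ , -1ℤ)
    current = trans (cong₂ (λ u v → c * u + c * v) (moved Sign.+) (moved Sign.-)) (next s)
      where
      moved : ∀ t → ψ (jump t k) ≡ φ (0ℤ , unit (t Sign.* s))
      moved t = trans (coordinates t k (total-absent t k ρ k∉ρ) (trans (ℤ.+-identityʳ _) (signed-present t s k)))
        (cong (λ v → φ (0ℤ , v)) (ℤ.+-identityˡ _))
    unused : All (λ (r , i) → K i ≡ c * z + c * z) τ
    unused = All.zipWith (λ { {r , i} (k≢i , i∉ρ) → cong₂ (λ u v → c * u + c * v) (unmoved Sign.+ (λ e → k≢i (sym e)) i∉ρ) (unmoved Sign.- (λ e → k≢i (sym e)) i∉ρ) })
      (proj₁ (proj₁ (proj₂ parts)) , All.tabulate (λ {x} x∈τ → All.map (λ { (_ ∷ ∉τ) e → All.lookup ∉τ x∈τ (sym e) }) (proj₂ (proj₂ parts))))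
      where
      unmoved : ∀ t {i} → i ≢ k → All (λ y → i ≢ proj₂ y) ρ → ψ (jump t i) ≡ z
      unmoved t {i} i≢k i∉ρ = coordinates t i (total-absent t i ρ i∉ρ) (total-absent t i ((s , k) ∷ []) (i≢k ∷ []))

-- The expected number of boundary crossings

changes-cong : ∀ {A : Set} {F G : Word A → Bool} w → (∀ v → F v ≡ G v) → changes F w ≡ changes G w
changes-cong []      e = refl
changes-cong (x ∷ w) e = cong₂ _+_ (cong₂ (λ a b → 𝟙 (a xor b)) (e []) (e (x ∷ []))) (changes-cong w (λ v → e (x ∷ v)))

antidiagonal-mono : ∀ m {G H} → (∀ i j → i ℕ.+ j ≡ m → G i j ≤ H i j) → antidiagonal m G ≤ antidiagonal m H
antidiagonal-mono zero    le = le 0 0 refl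
antidiagonal-mono (suc m) le = +-mono-≤ (le 0 (suc m) refl) (antidiagonal-mono m (λ i j e → le (suc i) j (cong suc e)))

antidiagonal-const : ∀ m c → antidiagonal m (λ _ _ → c) ≡ fromℕ (suc m) * c
antidiagonal-const zero    c = sym (*-identityˡ c)
antidiagonal-const (suc m) c = trans (cong (c +_) (antidiagonal-const m c)) (trans (eq c (fromℕ (suc m))) (cong (_* c) (sym (fromℕ-suc (suc m)))))
  where
  eq : ∀ c n → c + n * c ≡ (1ℚ + n) * c
  eq = solve-∀ ℚ-ring

1≤orderings : ∀ {A : Set} (D : List A) → 1ℚ ≤ orderings D
1≤orderings []      = ≤-refl
1≤orderings (a ∷ D) = begin
  1ℚ                                                     ≤⟨ 1≤orderings D ⟩
  orderings D                                                 ≤⟨ ∑-mono (arrangements D) (λ w → 1≤insertions (Sign.+ , a) w) ⟩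
  ∑ (arrangements D) (λ w → ∑ (insertions (Sign.+ , a) w) (λ _ → 1ℚ))
    ≤⟨ ∑-mono (arrangements D) (λ w → grow {∑ (insertions (Sign.+ , a) w) (λ _ → 1ℚ)} (0≤∑ (insertions (Sign.- , a) w) λ _ → 0≤1)) ⟩
  ∑ (arrangements D) (λ w → ∑ (insertions (Sign.+ , a) w) (λ _ → 1ℚ) + ∑ (insertions (Sign.- , a) w) (λ _ → 1ℚ))
    ≡⟨ ∑-arrangements a D (λ _ → 1ℚ) ⟨
  orderings (a ∷ D) ∎
  where
  open ≤-Reasoning
  grow : ∀ {p q} → 0ℚ ≤ q → p ≤ p + q
  grow {p} 0≤q = ≤-trans (≤-reflexive (sym (+-identityʳ p))) (+-monoʳ-≤ p 0≤q)
  1≤insertions : ∀ x w → 1ℚ ≤ ∑ (insertions x w) (λ _ → 1ℚ)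
  1≤insertions x []      = ≤-refl
  1≤insertions x (y ∷ w) = grow (0≤∑ (List.map (y ∷_) (insertions x w)) λ _ → 0≤1)

module _ {n : ℕ} (S : Subset n) (convex : Convex S) (η : ℚ) (m : ℕ) where

  private
    D = range 0 (suc m)
    W = labelWeight η m
    E = 𝔼ⁿ (labels (suc m)) W n
    inside : Vec Label n → Word ℕ → Bool
    inside ls ρ = hull S (position ls ρ)
    G : ℕ → ℕ → ℚ
    G i j = changeProbability S η (drift η i j)

  Valid : Word ℕ → Set
  Valid w = Distinct w × (∀ (K : ℕ → ℚ) → ∑ w (λ (s , i) → K i) ≡ ∑ D K)

  -- For a fixed word the coordinates are independent and each follows the step law. As S is convex,
  -- the hull agrees with S at the points of {0,±1}ⁿ that the step joins.
  expected-change : ∀ ρ y τ → length ρ ℕ.+ length τ ≡ m → Valid (ρ ++ y ∷ τ) →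
    E (λ ls → 𝟙 (inside ls ρ xor inside ls (ρ ++ y ∷ []))) ≡ G (length ρ) (length τ)
  expected-change ρ y τ len (distinct , perm) = begin
    E (λ ls → 𝟙 (inside ls ρ xor inside ls (ρ ++ y ∷ [])))
      ≡⟨ 𝔼-cong (vecs (labels (suc m)) n) (∏ W) (λ ls → cong₂ (λ u v → 𝟙 (hull S u xor hull S v))
           (Vec.map-∘ proj₁ pair ls) (Vec.map-∘ proj₂ pair ls)) ⟩
    E (λ ls → F (Vec.map pair ls))
      ≡⟨ pushforward (labels (suc m)) W pair moves (moveWeight η δ) pair′ (stepLaw η m ρ y τ len distinct perm) n F ⟩
    𝔼ⁿ moves (moveWeight η δ) n (λ v → F (Vec.map pair′ v))
      ≡⟨ 𝔼-cong (vecs moves n) (∏ (moveWeight η δ)) (λ v → cong₂ (λ a b → 𝟙 (a xor b))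
           (trans (cong (hull S) (trans (sym (Vec.map-∘ proj₁ pair′ v)) (Vec.map-∘ tritℤ before v))) (hull-convex S convex (Vec.map before v)))
           (trans (cong (hull S) (trans (sym (Vec.map-∘ proj₂ pair′ v)) (Vec.map-∘ tritℤ after v))) (hull-convex S convex (Vec.map after v)))) ⟩
    G (length ρ) (length τ) ∎
    where
    open ≡-Reasoning
    δ = drift η (length ρ) (length τ)
    pair : Label → ℤ × ℤ
    pair ℓ = coordinate ℓ ρ , coordinate ℓ (ρ ++ y ∷ [])
    pair′ : Move → ℤ × ℤ
    pair′ v = tritℤ (before v) , tritℤ (after v)
    F : Vec (ℤ × ℤ) n → ℚ
    F v = 𝟙 (hull S (Vec.map proj₁ v) xor hull S (Vec.map proj₂ v))

  expected-changes : ∀ ρ y τ → length ρ ℕ.+ length τ ≡ m → Valid (ρ ++ y ∷ τ) →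
    E (λ ls → changes (λ v → inside ls (ρ ++ v)) (y ∷ τ)) ≡ antidiagonal (length τ) (λ i j → G (length ρ ℕ.+ i) j)
  expected-changes ρ y [] len valid = trans
    (𝔼-cong (vecs (labels (suc m)) n) (∏ W) λ ls → trans (+-identityʳ _)
      (cong (λ w → 𝟙 (inside ls w xor inside ls (ρ ++ y ∷ []))) (++-identityʳ ρ)))
    (trans (expected-change ρ y [] len valid) (cong (λ i → G i 0) (sym (ℕ.+-identityʳ (length ρ)))))
  expected-changes ρ y (z ∷ τ) len valid = begin
    E (λ ls → changes (λ v → inside ls (ρ ++ v)) (y ∷ z ∷ τ))
      ≡⟨ 𝔼-cong (vecs (labels (suc m)) n) (∏ W) (λ ls → cong₂ _+_
           (cong (λ w → 𝟙 (inside ls w xor inside ls (ρ ++ y ∷ []))) (++-identityʳ ρ))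
           (changes-cong (z ∷ τ) λ v → cong (inside ls) (sym (++-assoc ρ (y ∷ []) v)))) ⟩
    E (λ ls → 𝟙 (inside ls ρ xor inside ls (ρ ++ y ∷ [])) + changes (λ v → inside ls ((ρ ++ y ∷ []) ++ v)) (z ∷ τ))
      ≡⟨ 𝔼-+ (vecs (labels (suc m)) n) (∏ W) _ _ ⟩
    E (λ ls → 𝟙 (inside ls ρ xor inside ls (ρ ++ y ∷ []))) + E (λ ls → changes (λ v → inside ls ((ρ ++ y ∷ []) ++ v)) (z ∷ τ))
      ≡⟨ cong₂ _+_ (trans (expected-change ρ y (z ∷ τ) len valid) (cong (λ i → G i (suc (length τ))) (sym (ℕ.+-identityʳ (length ρ)))))
           (trans (expected-changes (ρ ++ y ∷ []) z τ len′ (subst Valid (sym (++-assoc ρ (y ∷ []) (z ∷ τ))) valid))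
             (antidiagonal-cong (length τ) λ i j → cong (λ k → G k j) (trans (cong (ℕ._+ i) length-snoc) (sym (ℕ.+-suc (length ρ) i))))) ⟩
    antidiagonal (length (z ∷ τ)) (λ i j → G (length ρ ℕ.+ i) j) ∎
    where
    open ≡-Reasoning
    length-snoc : length (ρ ++ y ∷ []) ≡ suc (length ρ)
    length-snoc = trans (length-++ ρ) (ℕ.+-comm (length ρ) 1)
    len′ : length (ρ ++ y ∷ []) ℕ.+ length τ ≡ m
    len′ = trans (cong (ℕ._+ length τ) length-snoc) (trans (sym (ℕ.+-suc (length ρ) (length τ))) len)

  -- The expectation depends on the arrangement only through its length, so it can be taken out of
  -- the sum over arrangements.
  expected-changes-arrangement : All (λ w → E (λ ls → changes (inside ls) w) ≡ antidiagonal m G) (arrangements D)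
  expected-changes-arrangement = All.zipWith (λ {w} (len , (distinct , perm)) → from-start w len (proj₂ distinct , perm))
    (arrangements-length D , All.zip (arrangements-distinct 0 (suc m) , arrangements-∑ D))
    where
    from-start : ∀ w → length w ≡ length D → Valid w → E (λ ls → changes (inside ls) w) ≡ antidiagonal m G
    from-start (y ∷ τ) len valid = trans (expected-changes [] y τ len′ valid) (cong (λ k → antidiagonal k G) len′)
      where
      len′ : length τ ≡ m
      len′ = ℕ.suc-injective (trans len (length-range 0 (suc m)))

  module _ (0≤η : 0ℚ ≤ η) (η-small : fromℕ 9 * (fromℕ (suc m) * η) ≤ 1ℚ) where

    private
      c = central (suc m)
      x = fromℕ m * η
      0≤x : 0ℚ ≤ x
      0≤x = 0≤* (0≤fromℕ m) 0≤η
      slack : 0ℚ ≤ 1ℚ - fromℕ 9 * (x + η)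
      slack = p≤q⇒0≤q-p (≤-trans (≤-reflexive (cong (fromℕ 9 *_) (sym (trans (cong (_* η) (fromℕ-suc m)) (eq (fromℕ m) η))))) η-small)
        where
        eq : ∀ m η → (1ℚ + m) * η ≡ m * η + η
        eq = solve-∀ ℚ-ring

    labelWeight-nonneg : ∀ ℓ → 0ℚ ≤ W ℓ
    -- The weight is written as a nonnegative combination of known nonnegative terms, which the ring
    -- solver verifies. Many numerical inequalities below are proved in this way.
    labelWeight-nonneg (early s)  = ≤-trans (0≤+ (0≤* {⅓} (nonNegative⁻¹ ⅓) slack) (0≤+ (0≤* (0≤fromℕ 2) 0≤x) 0≤η)) (≤-reflexive (eq η x))
      where
      eq : ∀ η x → ⅓ * (1ℚ - fromℕ 9 * (x + η)) + (fromℕ 2 * x + η) ≡ ⅓ - 2ℚ * η - x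
      eq = solve-∀ ℚ-ring
    labelWeight-nonneg (jump s i) = 0≤* (0≤fromℕ 2) 0≤η
    labelWeight-nonneg late       = ≤-trans (0≤+ (0≤* {⅓} (nonNegative⁻¹ ⅓) slack) (0≤+ 0≤x (0≤* (0≤fromℕ 3) 0≤η))) (≤-reflexive (eq η x))
      where
      eq : ∀ η x → ⅓ * (1ℚ - fromℕ 9 * (x + η)) + (x + fromℕ 3 * η) ≡ ⅓ - 2ℚ * x
      eq = solve-∀ ℚ-ring

    -- For fixed labels `∑-exits` bounds the exits summed over arrangements, and for a fixed
    -- arrangement the mean number of changes over the labels is the antidiagonal sum. The two
    -- expectations are exchanged; 2 + c comes from at most twice the exits plus one.
    average-change : c * antidiagonal m G ≤ 2ℚ + c
    average-change = *-cancelˡ-≤-pos (orderings D) {{positive (<-≤-trans (positive⁻¹ 1ℚ) (1≤orderings D))}} (begin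
      orderings D * (c * antidiagonal m G)
        ≡⟨ eq (orderings D) c (antidiagonal m G) ⟩
      c * (orderings D * antidiagonal m G)
        ≡⟨ cong (c *_) (trans (sym (∑-*ʳ (arrangements D) (antidiagonal m G)))
             (∑-cong-All (All.map (λ e → trans (*-identityˡ _) (sym e)) expected-changes-arrangement))) ⟩
      c * ∑ (arrangements D) (λ w → E (λ ls → changes (inside ls) w))
        ≡⟨ cong (c *_) (𝔼-∑ (vecs (labels (suc m)) n) (∏ W) (arrangements D) (λ ls w → changes (inside ls) w)) ⟨
      c * E (λ ls → ∑ (arrangements D) (changes (inside ls)))
        ≡⟨ 𝔼-* (vecs (labels (suc m)) n) (∏ W) c _ ⟨
      E (λ ls → c * ∑ (arrangements D) (changes (inside ls)))
        ≤⟨ 𝔼-mono (vecs (labels (suc m)) n) (∏-nonneg labelWeight-nonneg) bound ⟩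
      E (λ ls → orderings D * (2ℚ + c))
        ≡⟨ 𝔼-const (vecs (labels (suc m)) n) (∏ W) (∑-∏ (labels (suc m)) W (∑-labelWeight η m) n) (orderings D * (2ℚ + c)) ⟩
      orderings D * (2ℚ + c) ∎)
      where
      open ≤-Reasoning
      eq : ∀ s c a → s * (c * a) ≡ c * (s * a)
      eq = solve-∀ ℚ-ring
      eq′ : ∀ c x s → c * (2ℚ * x + s) ≡ 2ℚ * (c * x) + c * s
      eq′ = solve-∀ ℚ-ring
      eq″ : ∀ c s → 2ℚ * s + c * s ≡ s * (2ℚ + c)
      eq″ = solve-∀ ℚ-ring
      bound : ∀ ls → c * ∑ (arrangements D) (changes (inside ls)) ≤ orderings D * (2ℚ + c)
      bound ls = begin
        c * ∑ (arrangements D) (changes (inside ls))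
          ≤⟨ *-monoˡ-≤ (0≤central (suc m)) (∑-mono (arrangements D) λ w →
               ≤-trans (changes≤exits (inside ls) w) (+-monoʳ-≤ (2ℚ * exits (inside ls) w) (𝟙≤1 (not (inside ls []))))) ⟩
        c * ∑ (arrangements D) (λ w → 2ℚ * exits (inside ls) w + 1ℚ)
          ≡⟨ cong (c *_) (trans (∑-+ (arrangements D)) (cong (_+ orderings D) (∑-*ˡ (arrangements D) 2ℚ))) ⟩
        c * (2ℚ * ∑ (arrangements D) (exits (inside ls)) + orderings D)
          ≡⟨ eq′ c _ (orderings D) ⟩
        2ℚ * (c * ∑ (arrangements D) (exits (inside ls))) + c * orderings D
          ≤⟨ +-monoˡ-≤ (c * orderings D) (*-monoˡ-≤ (nonNegative⁻¹ 2ℚ) (∑-exits (suc m) (inside ls) (hull-path-separated S ls))) ⟩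
        2ℚ * orderings D + c * orderings D
          ≡⟨ eq″ c (orderings D) ⟩
        orderings D * (2ℚ + c) ∎

-- Comparing opposite drifts with no drift

bernoulli : ∀ x n → 0ℚ ≤ x → x ≤ 1ℚ → 1ℚ - fromℕ n * x ≤ (1ℚ - x) ^ n
bernoulli x zero    0≤x x≤1 = ≤-reflexive (eq x)
  where
  eq : ∀ x → 1ℚ - 0ℚ * x ≡ 1ℚ
  eq = solve-∀ ℚ-ring
bernoulli x (suc n) 0≤x x≤1 = begin
  1ℚ - fromℕ (suc n) * x
    ≤⟨ 0≤q-p⇒p≤q (≤-trans (0≤* (0≤fromℕ n) (0≤p² x)) (≤-reflexive (trans (eq (fromℕ n) x) (cong (λ z → (1ℚ - x) * (1ℚ - fromℕ n * x) - (1ℚ - z * x)) (sym (fromℕ-suc n)))))) ⟩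
  (1ℚ - x) * (1ℚ - fromℕ n * x)
    ≤⟨ *-monoˡ-≤ (p≤q⇒0≤q-p x≤1) (bernoulli x n 0≤x x≤1) ⟩
  (1ℚ - x) * (1ℚ - x) ^ n ∎
  where
  open ≤-Reasoning
  eq : ∀ n x → n * (x * x) ≡ (1ℚ - x) * (1ℚ - n * x) - (1ℚ - (1ℚ + n) * x)
  eq = solve-∀ ℚ-ring

-- By the inequality of arithmetic and geometric means.
geometric⇒sum : ∀ {x y w} → 0ℚ ≤ x → 0ℚ ≤ y → w * w ≤ 4ℚ * (x * y) → w ≤ x + y
geometric⇒sum {x} {y} {w} 0≤x 0≤y w²≤4xy = ≮⇒≥ λ x+y<w → <-irrefl refl (begin-strict
  w * w                                ≤⟨ w²≤4xy ⟩
  4ℚ * (x * y)                         ≤⟨ 0≤q-p⇒p≤q (≤-trans (0≤p² (x - y)) (≤-reflexive (eq x y))) ⟩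
  (x + y) * (x + y)                    ≤⟨ *-monoˡ-≤ (0≤+ 0≤x 0≤y) (<⇒≤ x+y<w) ⟩
  (x + y) * w                          <⟨ *-monoˡ-<-pos w {{positive (≤-<-trans (0≤+ 0≤x 0≤y) x+y<w)}} x+y<w ⟩
  w * w                                ∎)
  where
  open ≤-Reasoning
  eq : ∀ x y → (x - y) * (x - y) ≡ (x + y) * (x + y) - 4ℚ * (x * y)
  eq = solve-∀ ℚ-ring

module _ (η δ : ℚ) (0≤η : 0ℚ ≤ η) (12η≤1 : fromℕ 12 * η ≤ 1ℚ) (9δ≤1 : fromℕ 9 * δ ≤ 1ℚ) (-9δ≤1 : fromℕ 9 * (- δ) ≤ 1ℚ) where

  moveWeight-nonneg : ∀ v → 0ℚ ≤ moveWeight η δ v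
  moveWeight-nonneg rest      = ≤-trans (0≤+ (0≤* {ℤ.+ 2 ℚ./ 9} (nonNegative⁻¹ _) (p≤q⇒0≤q-p -9δ≤1)) (nonNegative⁻¹ (ℤ.+ 1 ℚ./ 9))) (≤-reflexive (eq δ))
    where
    eq : ∀ δ → (ℤ.+ 2 ℚ./ 9) * (1ℚ - fromℕ 9 * (- δ)) + (ℤ.+ 1 ℚ./ 9) ≡ ⅓ + 2ℚ * δ
    eq = solve-∀ ℚ-ring
  moveWeight-nonneg (leave s) = 0≤* (nonNegative⁻¹ 2ℚ) 0≤η
  moveWeight-nonneg (stay s)  = ≤-trans (0≤+ (0≤+ (0≤* {ℤ.+ 1 ℚ./ 6} (nonNegative⁻¹ _) (p≤q⇒0≤q-p 12η≤1)) (0≤* {ℤ.+ 1 ℚ./ 9} (nonNegative⁻¹ _) (p≤q⇒0≤q-p 9δ≤1))) (nonNegative⁻¹ (ℤ.+ 1 ℚ./ 18))) (≤-reflexive (eq η δ))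
    where
    eq : ∀ η δ → (ℤ.+ 1 ℚ./ 6) * (1ℚ - fromℕ 12 * η) + (ℤ.+ 1 ℚ./ 9) * (1ℚ - fromℕ 9 * δ) + (ℤ.+ 1 ℚ./ 18) ≡ ⅓ - 2ℚ * η - δ
    eq = solve-∀ ℚ-ring

module _ (η δ : ℚ) (0≤η : 0ℚ ≤ η) (12η≤1 : fromℕ 12 * η ≤ 1ℚ) (9δ≤1 : fromℕ 9 * δ ≤ 1ℚ) (-9δ≤1 : fromℕ 9 * (- δ) ≤ 1ℚ)
  (n : ℕ) (δ²-small : fromℕ n * (fromℕ 48 * (δ * δ)) ≤ 1ℚ) where

  private
    9--δ≤1 : fromℕ 9 * (- (- δ)) ≤ 1ℚ
    9--δ≤1 = ≤-trans (≤-reflexive (eq δ)) 9δ≤1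
      where
      eq : ∀ δ → fromℕ 9 * (- (- δ)) ≡ fromℕ 9 * δ
      eq = solve-∀ ℚ-ring
    x = fromℕ 36 * (δ * δ)
    0≤x : 0ℚ ≤ x
    0≤x = 0≤* (0≤fromℕ 36) (0≤p² δ)
    x≤1 : x ≤ 1ℚ
    x≤1 = 0≤q-p⇒p≤q (≤-trans (0≤+ (0≤* {ℤ.+ 4 ℚ./ 9} (nonNegative⁻¹ _) (0≤* (p≤q⇒0≤q-p 9δ≤1) (p≤q⇒0≤q-p -9δ≤1))) (nonNegative⁻¹ (ℤ.+ 5 ℚ./ 9))) (≤-reflexive (eq δ)))
      where
      eq : ∀ δ → (ℤ.+ 4 ℚ./ 9) * ((1ℚ - fromℕ 9 * δ) * (1ℚ - fromℕ 9 * (- δ))) + (ℤ.+ 5 ℚ./ 9) ≡ 1ℚ - fromℕ 36 * (δ * δ)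
      eq = solve-∀ ℚ-ring
    w₀ w₊ w₋ : Move → ℚ
    w₀ = moveWeight η 0ℚ
    w₊ = moveWeight η δ
    w₋ = moveWeight η (- δ)
    0≤w₊ = moveWeight-nonneg η δ 0≤η 12η≤1 9δ≤1 -9δ≤1
    0≤w₋ = moveWeight-nonneg η (- δ) 0≤η 12η≤1 -9δ≤1 9--δ≤1

  -- The terms linear in δ cancel. The relative loss 36 δ² is attained at `rest`, where (⅓ + 2 δ) (⅓
  -- - 2 δ) is (1 - 36 δ²) / 9; at `stay` it suffices because 12 η ≤ 1 gives ⅓ - 2 η ≥ 1/6.
  moveWeight-pair : ∀ v → (1ℚ - x) * (w₀ v * w₀ v) ≤ w₊ v * w₋ v
  moveWeight-pair rest      = ≤-reflexive (eq δ)
    where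
    eq : ∀ δ → (1ℚ - fromℕ 36 * (δ * δ)) * ((⅓ + 2ℚ * 0ℚ) * (⅓ + 2ℚ * 0ℚ)) ≡ (⅓ + 2ℚ * δ) * (⅓ + 2ℚ * (- δ))
    eq = solve-∀ ℚ-ring
  moveWeight-pair (leave s) = 0≤q-p⇒p≤q (≤-trans (0≤* 0≤x (0≤p² (2ℚ * η))) (≤-reflexive (eq x (2ℚ * η))))
    where
    eq : ∀ x y → x * (y * y) ≡ y * y - (1ℚ - x) * (y * y)
    eq = solve-∀ ℚ-ring
  moveWeight-pair (stay s)  = 0≤q-p⇒p≤q (≤-trans
    (0≤* (0≤p² δ) (0≤* (p≤q⇒0≤q-p 12η≤1) (0≤+ (p≤q⇒0≤q-p 12η≤1) (0≤fromℕ 2)))) (≤-reflexive (eq η δ)))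
    where
    eq : ∀ η δ → (δ * δ) * ((1ℚ - fromℕ 12 * η) * ((1ℚ - fromℕ 12 * η) + fromℕ 2)) ≡
      (⅓ - 2ℚ * η - δ) * (⅓ - 2ℚ * η - (- δ)) - (1ℚ - fromℕ 36 * (δ * δ)) * ((⅓ - 2ℚ * η - 0ℚ) * (⅓ - 2ℚ * η - 0ℚ))
    eq = solve-∀ ℚ-ring

  ∏-pair : ∀ {k} (v : Vec Move k) → (1ℚ - x) ^ k * (∏ w₀ v * ∏ w₀ v) ≤ ∏ w₊ v * ∏ w₋ v
  ∏-pair []                = ≤-refl
  ∏-pair {suc k} (a ∷ v) = begin
    (1ℚ - x) * (1ℚ - x) ^ k * ((w₀ a * ∏ w₀ v) * (w₀ a * ∏ w₀ v))
      ≡⟨ eq (1ℚ - x) ((1ℚ - x) ^ k) (w₀ a) (∏ w₀ v) ⟩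
    ((1ℚ - x) * (w₀ a * w₀ a)) * ((1ℚ - x) ^ k * (∏ w₀ v * ∏ w₀ v))
      ≤⟨ *-mono-≤-nonNeg (0≤* (p≤q⇒0≤q-p x≤1) (0≤p² (w₀ a))) (0≤* (∏-nonneg 0≤w₊ v) (∏-nonneg 0≤w₋ v)) (moveWeight-pair a) (∏-pair v) ⟩
    (w₊ a * w₋ a) * (∏ w₊ v * ∏ w₋ v)
      ≡⟨ eq′ (w₊ a) (w₋ a) (∏ w₊ v) (∏ w₋ v) ⟩
    (w₊ a * ∏ w₊ v) * (w₋ a * ∏ w₋ v) ∎
    where
    open ≤-Reasoning
    eq : ∀ t T a b → t * T * ((a * b) * (a * b)) ≡ (t * (a * a)) * (T * (b * b))
    eq = solve-∀ ℚ-ring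
    eq′ : ∀ a b c d → (a * b) * (c * d) ≡ (a * c) * (b * d)
    eq′ = solve-∀ ℚ-ring

  -- Over n coordinates the loss is the factor (1 - 36 δ²)ⁿ. By assumption n · 36 δ² ≤ ¾, so
  -- Bernoulli's inequality keeps it above ¼, and w₀² ≤ 4 w₊ w₋ yields w₀ ≤ w₊ + w₋.
  changeProbability-pair : ∀ (S : Subset n) → changeProbability S η 0ℚ ≤ changeProbability S η δ + changeProbability S η (- δ)
  changeProbability-pair S = ≤-trans (∑-mono (vecs moves n) λ v → ≤-trans
      (*-monoʳ-≤ {∏ w₀ v} (0≤𝟙 (change v)) (geometric⇒sum (∏-nonneg 0≤w₊ v) (∏-nonneg 0≤w₋ v) (quarter v)))
      (≤-reflexive (*-distribʳ-+ (𝟙 (change v)) (∏ w₊ v) (∏ w₋ v))))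
    (≤-reflexive (∑-+ (vecs moves n)))
    where
    open ≤-Reasoning
    change : Vec Move n → Bool
    change v = S (Vec.map before v) xor S (Vec.map after v)
    eq : ∀ n y → fromℕ 3 + 4ℚ * (- (fromℕ 3 * ½ * ½ * (n * (fromℕ 48 * y)))) ≡ 4ℚ * (1ℚ - n * (fromℕ 36 * y)) - 1ℚ
    eq = solve-∀ ℚ-ring
    eq′ : ∀ y → fromℕ 3 - fromℕ 3 * y ≡ fromℕ 3 + 4ℚ * (- (fromℕ 3 * ½ * ½ * y))
    eq′ = solve-∀ ℚ-ring
    1≤4tⁿ : 1ℚ ≤ 4ℚ * (1ℚ - x) ^ n
    1≤4tⁿ = ≤-trans (0≤q-p⇒p≤q (≤-trans (p≤q⇒0≤q-p (*-monoˡ-≤ (0≤fromℕ 3) δ²-small)) (≤-reflexive (trans (eq′ (fromℕ n * (fromℕ 48 * (δ * δ)))) (eq (fromℕ n) (δ * δ))))))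
      (*-monoˡ-≤ (nonNegative⁻¹ 4ℚ) (bernoulli x n 0≤x x≤1))
    quarter : ∀ v → ∏ w₀ v * ∏ w₀ v ≤ 4ℚ * (∏ w₊ v * ∏ w₋ v)
    quarter v = begin
      ∏ w₀ v * ∏ w₀ v                                 ≡⟨ *-identityˡ _ ⟨
      1ℚ * (∏ w₀ v * ∏ w₀ v)                          ≤⟨ *-monoʳ-≤ (0≤p² (∏ w₀ v)) 1≤4tⁿ ⟩
      4ℚ * (1ℚ - x) ^ n * (∏ w₀ v * ∏ w₀ v)           ≡⟨ *-assoc 4ℚ ((1ℚ - x) ^ n) _ ⟩
      4ℚ * ((1ℚ - x) ^ n * (∏ w₀ v * ∏ w₀ v))         ≤⟨ *-monoˡ-≤ (nonNegative⁻¹ 4ℚ) (∏-pair v) ⟩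
      4ℚ * (∏ w₊ v * ∏ w₋ v)                          ∎

-- The steps (i , j) and (j , i) have opposite drifts, so together they dominate a step without
-- drift. Summation over the walk meets the average twice.
changeProbability-bound : ∀ {n} (S : Subset n) → Convex S → ∀ η m → 0ℚ ≤ η → fromℕ 12 * η ≤ 1ℚ →
  fromℕ 9 * (fromℕ (suc m) * η) ≤ 1ℚ → fromℕ n * (fromℕ 48 * ((fromℕ m * η) * (fromℕ m * η))) ≤ 1ℚ →
  central (suc m) * (fromℕ (suc m) * changeProbability S η 0ℚ) ≤ fromℕ 6
changeProbability-bound {n} S convex η m 0≤η 12η≤1 9Mη≤1 small = begin
  c * (fromℕ (suc m) * changeProbability S η 0ℚ)
    ≡⟨ cong (c *_) (antidiagonal-const m (changeProbability S η 0ℚ)) ⟨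
  c * antidiagonal m (λ _ _ → changeProbability S η 0ℚ)
    ≤⟨ *-monoˡ-≤ (0≤central (suc m)) (antidiagonal-mono m pair) ⟩
  c * antidiagonal m (λ i j → G i j + G j i)
    ≡⟨ cong (c *_) (trans (antidiagonal-+ m G (λ i j → G j i)) (cong (antidiagonal m G +_) (sym (antidiagonal-flip m G)))) ⟩
  c * (antidiagonal m G + antidiagonal m G)
    ≡⟨ *-distribˡ-+ c (antidiagonal m G) (antidiagonal m G) ⟩
  c * antidiagonal m G + c * antidiagonal m G
    ≤⟨ +-mono-≤ A≤3 A≤3 ⟩
  fromℕ 6 ∎
  where
  open ≤-Reasoning
  c = central (suc m)
  G : ℕ → ℕ → ℚ
  G i j = changeProbability S η (drift η i j)
  -- `central` decreases from `central 0`, which is 1.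
  A≤3 : c * antidiagonal m G ≤ fromℕ 3
  A≤3 = ≤-trans (average-change S convex η m 0≤η 9Mη≤1) (+-monoʳ-≤ 2ℚ (central-antitone {0} {suc m} ℕ.z≤n))
  9drift≤1 : ∀ i j → i ℕ.+ j ℕ.≤ m → fromℕ 9 * drift η i j ≤ 1ℚ
  9drift≤1 i j i+j≤m = ≤-trans (*-monoˡ-≤ (0≤fromℕ 9) (*-monoʳ-≤ 0≤η (≤-trans
      (+-monoʳ-≤ (fromℕ j) (neg-antimono-≤ (0≤fromℕ i))) (≤-trans (≤-reflexive (+-identityʳ (fromℕ j)))
        (fromℕ-mono-≤ (ℕ.≤-trans (ℕ.m≤n+m j i) (ℕ.≤-trans i+j≤m (ℕ.n≤1+n m)))))))) 9Mη≤1
  neg-drift : ∀ i j → drift η j i ≡ - drift η i j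
  neg-drift i j = eq (fromℕ i) (fromℕ j) η
    where
    eq : ∀ i j η → (i - j) * η ≡ - ((j - i) * η)
    eq = solve-∀ ℚ-ring
  pair : ∀ i j → i ℕ.+ j ≡ m → changeProbability S η 0ℚ ≤ G i j + G j i
  pair i j e = ≤-trans (changeProbability-pair η (drift η i j) 0≤η 12η≤1 (9drift≤1 i j (ℕ.≤-reflexive e))
      (≤-trans (≤-reflexive (cong (fromℕ 9 *_) (sym (neg-drift i j)))) (9drift≤1 j i (ℕ.≤-reflexive (trans (ℕ.+-comm j i) e))))
      n (≤-trans (*-monoˡ-≤ (0≤fromℕ n) (*-monoˡ-≤ (0≤fromℕ 48) square)) small) S)
    (≤-reflexive (cong (λ δ → G i j + changeProbability S η δ) (sym (neg-drift i j))))
    where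
    square : drift η i j * drift η i j ≤ (fromℕ m * η) * (fromℕ m * η)
    square = 0≤q-p⇒p≤q (≤-trans (0≤* (0≤* (nonNegative⁻¹ 4ℚ) (0≤* (0≤fromℕ i) (0≤fromℕ j))) (0≤p² η))
      (≤-reflexive (trans (eq (fromℕ i) (fromℕ j) η) (cong (λ z → (z * η) * (z * η) - drift η i j * drift η i j) (trans (sym (fromℕ-+ i j)) (cong fromℕ e))))))
      where
      eq : ∀ i j η → 4ℚ * (i * j) * (η * η) ≡ ((i + j) * η) * ((i + j) * η) - ((j - i) * η) * ((j - i) * η)
      eq = solve-∀ ℚ-ring

-- Fourier weight at high degrees

trits : List Trit
trits = -𝟏 ∷ 𝟎 ∷ +𝟏 ∷ []

third : ∀ {A : Set} → A → ℚ
third _ = ⅓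

U : ∀ n → (Point n → ℚ) → ℚ
U = 𝔼ⁿ trits third

average : (Trit → ℚ) → ℚ
average φ = ⅓ * (φ -𝟏 + φ 𝟎 + φ +𝟏)

𝔼-trits : ∀ φ → 𝔼 trits third φ ≡ average φ
𝔼-trits φ = eq (φ -𝟏) (φ 𝟎) (φ +𝟏)
  where
  eq : ∀ a b c → ⅓ * a + (⅓ * b + (⅓ * c + 0ℚ)) ≡ ⅓ * (a + b + c)
  eq = solve-∀ ℚ-ring

U-suc : ∀ n F → U (suc n) F ≡ average (λ a → U n (λ x → F (a ∷ x)))
U-suc n F = trans (𝔼ⁿ-suc trits third n F) (𝔼-trits (λ a → U n (λ x → F (a ∷ x))))

U-cong : ∀ n {F G : Point n → ℚ} → (∀ x → F x ≡ G x) → U n F ≡ U n G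
U-cong n = 𝔼-cong (vecs trits n) (∏ third)

U-+ : ∀ n F G → U n (λ x → F x + G x) ≡ U n F + U n G
U-+ n = 𝔼-+ (vecs trits n) (∏ third)

U-* : ∀ n c F → U n (λ x → c * F x) ≡ c * U n F
U-* n = 𝔼-* (vecs trits n) (∏ third)

0≤∏third : ∀ {n} (x : Point n) → 0ℚ ≤ ∏ third x
0≤∏third = ∏-nonneg (λ _ → nonNegative⁻¹ ⅓)

0≤U : ∀ n {F} → (∀ x → 0ℚ ≤ F x) → 0ℚ ≤ U n F
0≤U n = 0≤𝔼 (vecs trits n) 0≤∏third

U-average : ∀ n (F : Trit → Point n → ℚ) → average (λ a → U n (F a)) ≡ U n (λ x → average (λ a → F a x))
U-average n F = sym (trans (U-* n ⅓ _) (cong (⅓ *_) (trans (U-+ n _ (F +𝟏)) (cong (_+ U n (F +𝟏)) (U-+ n (F -𝟏) (F 𝟎))))))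

average-cong : ∀ {φ ψ} → (∀ a → φ a ≡ ψ a) → average φ ≡ average ψ
average-cong e = cong (⅓ *_) (cong₂ _+_ (cong₂ _+_ (e -𝟏) (e 𝟎)) (e +𝟏))

average-mono : ∀ {φ ψ} → (∀ a → φ a ≤ ψ a) → average φ ≤ average ψ
average-mono le = *-monoˡ-≤ (nonNegative⁻¹ ⅓) (+-mono-≤ (+-mono-≤ (le -𝟏) (le 𝟎)) (le +𝟏))

-- kernel d is the reproducing kernel of the space spanned by functions of fewer than d coordinates.
contrast : Trit → Trit → ℚ
contrast -𝟏 -𝟏 = 2ℚ
contrast 𝟎  𝟎  = 2ℚ
contrast +𝟏 +𝟏 = 2ℚ
contrast _  _  = - 1ℚ

kernel : ∀ {n} → ℕ → Point n → Point n → ℚ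
kernel zero    x       y       = 0ℚ
kernel (suc d) []      []      = 1ℚ
kernel (suc d) (a ∷ x) (b ∷ y) = kernel (suc d) x y + contrast a b * kernel d x y

project : ∀ {n} → ℕ → (Point n → ℚ) → Point n → ℚ
project {n} d f y = U n (λ x → f x * kernel d x y)

-- The Fourier weight of f at degrees d and above, as the squared distance from its projection.
tail : ∀ {n} → ℕ → (Point n → ℚ) → ℚ
tail {n} d f = U n (λ y → (project d f y - f y) * (project d f y - f y))

norm² : ∀ {n} → (Point n → ℚ) → ℚ
norm² {n} f = U n (λ x → f x * f x)

mean : ∀ {n} → (Point (suc n) → ℚ) → Point n → ℚ
mean f x = average (λ a → f (a ∷ x))

-- The part with mean zero in the first coordinate. It spends one degree there, whereas `mean`
-- spends none; hence the different degrees in `project-suc` and `tail-suc`.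
fluctuation : ∀ {n} → (Point (suc n) → ℚ) → Trit → Point n → ℚ
fluctuation f a x = f (a ∷ x) - mean f x

-- `contrast a b` is 3 - 1 on the diagonal and 0 - 1 off it: the kernel of the projection of
-- functions on one coordinate to those with mean zero.
average-contrast : ∀ φ b → average (λ a → contrast a b * φ a) ≡ φ b - average φ
average-contrast φ -𝟏 = eq (φ -𝟏) (φ 𝟎) (φ +𝟏)
  where
  eq : ∀ a b c → ⅓ * (2ℚ * a + - 1ℚ * b + - 1ℚ * c) ≡ a - ⅓ * (a + b + c)
  eq = solve-∀ ℚ-ring
average-contrast φ 𝟎 = eq (φ -𝟏) (φ 𝟎) (φ +𝟏)
  where
  eq : ∀ a b c → ⅓ * (- 1ℚ * a + 2ℚ * b + - 1ℚ * c) ≡ b - ⅓ * (a + b + c)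
  eq = solve-∀ ℚ-ring
average-contrast φ +𝟏 = eq (φ -𝟏) (φ 𝟎) (φ +𝟏)
  where
  eq : ∀ a b c → ⅓ * (- 1ℚ * a + - 1ℚ * b + 2ℚ * c) ≡ c - ⅓ * (a + b + c)
  eq = solve-∀ ℚ-ring

project-suc : ∀ {n} d (f : Point (suc n) → ℚ) b y →
  project (suc d) f (b ∷ y) ≡ project (suc d) (mean f) y + project d (fluctuation f b) y
project-suc {n} d f b y = begin
  U (suc n) (λ x → f x * kernel (suc d) x (b ∷ y))
    ≡⟨ U-suc n _ ⟩
  average (λ a → U n (λ x → f (a ∷ x) * (kernel (suc d) x y + contrast a b * kernel d x y)))
    ≡⟨ U-average n (λ a x → f (a ∷ x) * (kernel (suc d) x y + contrast a b * kernel d x y)) ⟩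
  U n (λ x → average (λ a → f (a ∷ x) * (kernel (suc d) x y + contrast a b * kernel d x y)))
    ≡⟨ U-cong n (λ x → trans (pointwise x) (cong (λ z → mean f x * kernel (suc d) x y + z * kernel d x y) (average-contrast (λ a → f (a ∷ x)) b))) ⟩
  U n (λ x → mean f x * kernel (suc d) x y + fluctuation f b x * kernel d x y)
    ≡⟨ U-+ n _ _ ⟩
  project (suc d) (mean f) y + project d (fluctuation f b) y ∎
  where
  open ≡-Reasoning
  eq : ∀ p q r k k′ u v w → ⅓ * (p * (k + u * k′) + q * (k + v * k′) + r * (k + w * k′)) ≡
    ⅓ * (p + q + r) * k + ⅓ * (u * p + v * q + w * r) * k′
  eq = solve-∀ ℚ-ring
  pointwise : ∀ x → average (λ a → f (a ∷ x) * (kernel (suc d) x y + contrast a b * kernel d x y)) ≡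
    mean f x * kernel (suc d) x y + average (λ a → contrast a b * f (a ∷ x)) * kernel d x y
  pointwise x = eq (f (-𝟏 ∷ x)) (f (𝟎 ∷ x)) (f (+𝟏 ∷ x)) (kernel (suc d) x y) (kernel d x y) (contrast -𝟏 b) (contrast 𝟎 b) (contrast +𝟏 b)

average-fluctuation : ∀ {n} (f : Point (suc n) → ℚ) x → average (λ a → fluctuation f a x) ≡ 0ℚ
average-fluctuation f x = eq (f (-𝟏 ∷ x)) (f (𝟎 ∷ x)) (f (+𝟏 ∷ x))
  where
  eq : ∀ a b c → ⅓ * ((a - ⅓ * (a + b + c)) + (b - ⅓ * (a + b + c)) + (c - ⅓ * (a + b + c))) ≡ 0ℚ
  eq = solve-∀ ℚ-ring

average-project-fluctuation : ∀ {n} d (f : Point (suc n) → ℚ) y → average (λ b → project d (fluctuation f b) y) ≡ 0ℚ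
average-project-fluctuation {n} d f y = begin
  average (λ b → U n (λ x → fluctuation f b x * kernel d x y))
    ≡⟨ U-average n (λ b x → fluctuation f b x * kernel d x y) ⟩
  U n (λ x → average (λ b → fluctuation f b x * kernel d x y))
    ≡⟨ U-cong n (λ x → trans (eq (fluctuation f -𝟏 x) (fluctuation f 𝟎 x) (fluctuation f +𝟏 x) (kernel d x y))
         (trans (cong (kernel d x y *_) (average-fluctuation f x)) (trans (*-zeroʳ (kernel d x y)) (sym (*-zeroˡ 0ℚ))))) ⟩
  U n (λ x → 0ℚ * 0ℚ)
    ≡⟨ trans (U-* n 0ℚ (λ _ → 0ℚ)) (*-zeroˡ (U n (λ _ → 0ℚ))) ⟩
  0ℚ ∎
  where
  open ≡-Reasoning
  eq : ∀ a b c k → ⅓ * (a * k + b * k + c * k) ≡ k * (⅓ * (a + b + c))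
  eq = solve-∀ ℚ-ring

average-pythagoras : ∀ A (B : Trit → ℚ) → average B ≡ 0ℚ →
  average (λ b → (A + B b) * (A + B b)) ≡ A * A + average (λ b → B b * B b)
average-pythagoras A B e = trans (eq A (B -𝟏) (B 𝟎) (B +𝟏)) (trans (cong (λ z → (A * A + average (λ b → B b * B b)) + 2ℚ * A * z) e)
  (trans (cong ((A * A + average (λ b → B b * B b)) +_) (*-zeroʳ (2ℚ * A))) (+-identityʳ _)))
  where
  eq : ∀ a p q r → ⅓ * ((a + p) * (a + p) + (a + q) * (a + q) + (a + r) * (a + r)) ≡
    (a * a + ⅓ * (p * p + q * q + r * r)) + 2ℚ * a * (⅓ * (p + q + r))
  eq = solve-∀ ℚ-ring

U-pythagoras : ∀ n (F : Point (suc n) → ℚ) (A : Point n → ℚ) (B : Trit → Point n → ℚ) →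
  (∀ a x → F (a ∷ x) ≡ A x + B a x) → (∀ x → average (λ a → B a x) ≡ 0ℚ) →
  U (suc n) (λ x → F x * F x) ≡ U n (λ x → A x * A x) + average (λ a → U n (λ x → B a x * B a x))
U-pythagoras n F A B split zero-mean = begin
  U (suc n) (λ x → F x * F x)
    ≡⟨ trans (U-suc n (λ x → F x * F x)) (U-average n (λ a x → F (a ∷ x) * F (a ∷ x))) ⟩
  U n (λ x → average (λ a → F (a ∷ x) * F (a ∷ x)))
    ≡⟨ U-cong n (λ x → trans (average-cong (λ a → cong₂ _*_ (split a x) (split a x))) (average-pythagoras (A x) (λ a → B a x) (zero-mean x))) ⟩
  U n (λ x → A x * A x + average (λ a → B a x * B a x))
    ≡⟨ trans (U-+ n _ _) (cong (U n (λ x → A x * A x) +_) (sym (U-average n (λ a x → B a x * B a x)))) ⟩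
  U n (λ x → A x * A x) + average (λ a → U n (λ x → B a x * B a x)) ∎
  where open ≡-Reasoning

tail-suc : ∀ {n} d (f : Point (suc n) → ℚ) → tail (suc d) f ≡ tail (suc d) (mean f) + average (λ a → tail d (fluctuation f a))
tail-suc {n} d f = U-pythagoras n (λ y → project (suc d) f y - f y)
  (λ y → project (suc d) (mean f) y - mean f y) (λ a y → project d (fluctuation f a) y - fluctuation f a y)
  (λ a y → trans (cong (_- f (a ∷ y)) (project-suc d f a y)) (eq (project (suc d) (mean f) y) (project d (fluctuation f a) y) (f (a ∷ y)) (mean f y)))
  (λ y → trans (eq′ (λ a → project d (fluctuation f a) y) (λ a → fluctuation f a y))
    (cong₂ _-_ (average-project-fluctuation d f y) (average-fluctuation f y)))
  where
  eq : ∀ p q f m → (p + q) - f ≡ (p - m) + (q - (f - m))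
  eq = solve-∀ ℚ-ring
  eq₃ : ∀ a b c p q r → ⅓ * ((a - p) + (b - q) + (c - r)) ≡ ⅓ * (a + b + c) - ⅓ * (p + q + r)
  eq₃ = solve-∀ ℚ-ring
  eq′ : ∀ φ ψ → average (λ a → φ a - ψ a) ≡ average φ - average ψ
  eq′ φ ψ = eq₃ (φ -𝟏) (φ 𝟎) (φ +𝟏) (ψ -𝟏) (ψ 𝟎) (ψ +𝟏)

norm²-suc : ∀ {n} (f : Point (suc n) → ℚ) → norm² f ≡ norm² (mean f) + average (λ a → norm² (fluctuation f a))
norm²-suc {n} f = U-pythagoras n f (mean f) (fluctuation f) (λ a x → eq (f (a ∷ x)) (mean f x)) (average-fluctuation f)
  where
  eq : ∀ f m → f ≡ m + (f - m)
  eq = solve-∀ ℚ-ring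

tail-0 : ∀ {n} (f : Point n → ℚ) → tail 0 f ≡ norm² f
tail-0 {n} f = U-cong n (λ y → trans (cong (λ z → (z - f y) * (z - f y)) (vanish y)) (eq (f y)))
  where
  eq : ∀ f → (0ℚ - f) * (0ℚ - f) ≡ f * f
  eq = solve-∀ ℚ-ring
  vanish : ∀ y → project 0 f y ≡ 0ℚ
  vanish y = trans (U-cong n (λ x → trans (*-zeroʳ (f x)) (sym (*-zeroˡ 0ℚ)))) (trans (U-* n 0ℚ (λ _ → 0ℚ)) (*-zeroˡ (U n (λ _ → 0ℚ))))

0≤tail : ∀ {n} d (f : Point n → ℚ) → 0ℚ ≤ tail d f
0≤tail {n} d f = 0≤U n (λ y → 0≤p² (project d f y - f y))

tail-base : ∀ d (f : Point 0 → ℚ) → tail (suc d) f ≡ 0ℚ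
tail-base d f = eq (f [])
  where
  eq : ∀ c → 1ℚ * (((1ℚ * (c * 1ℚ) + 0ℚ) - c) * ((1ℚ * (c * 1ℚ) + 0ℚ) - c)) + 0ℚ ≡ 0ℚ
  eq = solve-∀ ℚ-ring

-- Every function has degree at most n. In the dense regime this takes the place of the bound by
-- noise.
tail-vanishes : ∀ {n} d (f : Point n → ℚ) → n ℕ.< d → tail d f ≡ 0ℚ
tail-vanishes {zero}  (suc d) f _             = tail-base d f
tail-vanishes {suc n} (suc d) f (ℕ.s≤s n<d) = trans (tail-suc d f) (cong₂ _+_ (tail-vanishes (suc d) (mean f) (ℕ.m<n⇒m<1+n n<d))
  (average-cong {ψ = λ _ → 0ℚ} (λ a → tail-vanishes d (fluctuation f a) n<d)))

-- Noise stability

tritPairs : List (Trit × Trit)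
tritPairs = (-𝟏 , -𝟏) ∷ (-𝟏 , 𝟎) ∷ (-𝟏 , +𝟏) ∷ (𝟎 , -𝟏) ∷ (𝟎 , 𝟎) ∷ (𝟎 , +𝟏) ∷ (+𝟏 , -𝟏) ∷ (+𝟏 , 𝟎) ∷ (+𝟏 , +𝟏) ∷ []

module _ (η : ℚ) where

  -- The second coordinate is the first, rerandomised with probability 9 η.
  noise : Trit × Trit → ℚ
  noise (-𝟏 , -𝟏) = ⅓ - 2ℚ * η
  noise (𝟎  , 𝟎 ) = ⅓ - 2ℚ * η
  noise (+𝟏 , +𝟏) = ⅓ - 2ℚ * η
  noise _         = η

  -- The bilinear form ⟨f, T g⟩ of the noise operator T.
  correlation : ∀ {n} → (f g : Point n → ℚ) → ℚ
  correlation {n} f g = 𝔼ⁿ tritPairs noise n (λ v → f (Vec.map proj₁ v) * g (Vec.map proj₂ v))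

  correlation-suc : ∀ {n} (f g : Point (suc n) → ℚ) → correlation f g ≡
    𝔼 tritPairs noise (λ (a , b) → correlation (λ x → f (a ∷ x)) (λ x → g (b ∷ x)))
  correlation-suc {n} f g = 𝔼ⁿ-suc tritPairs noise n (λ v → f (Vec.map proj₁ v) * g (Vec.map proj₂ v))

  correlation-combineˡ : ∀ {n} (f f′ g : Point n → ℚ) c c′ →
    correlation (λ x → c * f x + c′ * f′ x) g ≡ c * correlation f g + c′ * correlation f′ g
  correlation-combineˡ {n} f f′ g c c′ = trans (𝔼-cong (vecs tritPairs n) (∏ noise) (λ v → eq c c′ (f (Vec.map proj₁ v)) (f′ (Vec.map proj₁ v)) (g (Vec.map proj₂ v))))
    (trans (𝔼-+ (vecs tritPairs n) (∏ noise) _ _) (cong₂ _+_ (𝔼-* (vecs tritPairs n) (∏ noise) c _) (𝔼-* (vecs tritPairs n) (∏ noise) c′ _)))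
    where
    eq : ∀ c c′ f f′ g → (c * f + c′ * f′) * g ≡ c * (f * g) + c′ * (f′ * g)
    eq = solve-∀ ℚ-ring

  correlation-combineʳ : ∀ {n} (f g g′ : Point n → ℚ) c c′ →
    correlation f (λ x → c * g x + c′ * g′ x) ≡ c * correlation f g + c′ * correlation f g′
  correlation-combineʳ {n} f g g′ c c′ = trans (𝔼-cong (vecs tritPairs n) (∏ noise) (λ v → eq c c′ (f (Vec.map proj₁ v)) (g (Vec.map proj₂ v)) (g′ (Vec.map proj₂ v))))
    (trans (𝔼-+ (vecs tritPairs n) (∏ noise) _ _) (cong₂ _+_ (𝔼-* (vecs tritPairs n) (∏ noise) c _) (𝔼-* (vecs tritPairs n) (∏ noise) c′ _)))
    where
    eq : ∀ c c′ f g g′ → f * (c * g + c′ * g′) ≡ c * (f * g) + c′ * (f * g′)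
    eq = solve-∀ ℚ-ring

  correlation-cong : ∀ {n} {f f′ g g′ : Point n → ℚ} → (∀ x → f x ≡ f′ x) → (∀ x → g x ≡ g′ x) → correlation f g ≡ correlation f′ g′
  correlation-cong {n} e e′ = 𝔼-cong (vecs tritPairs n) (∏ noise) (λ v → cong₂ _*_ (e (Vec.map proj₁ v)) (e′ (Vec.map proj₂ v)))

  ρ : ℚ
  ρ = 1ℚ - fromℕ 9 * η

  private
    module Split {n} (f : Point (suc n) → ℚ) where
      fᵃ : Trit → Point n → ℚ
      fᵃ a x = f (a ∷ x)
      B : Trit → Trit → ℚ
      B a b = correlation (fᵃ a) (fᵃ b)
      mean≡ : ∀ x → mean f x ≡ ⅓ * fᵃ -𝟏 x + 1ℚ * (⅓ * fᵃ 𝟎 x + ⅓ * fᵃ +𝟏 x)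
      mean≡ x = eq (fᵃ -𝟏 x) (fᵃ 𝟎 x) (fᵃ +𝟏 x)
        where
        eq : ∀ a b c → ⅓ * (a + b + c) ≡ ⅓ * a + 1ℚ * (⅓ * b + ⅓ * c)
        eq = solve-∀ ℚ-ring
      meanʳ : ∀ g → correlation g (mean f) ≡ ⅓ * correlation g (fᵃ -𝟏) + 1ℚ * (⅓ * correlation g (fᵃ 𝟎) + ⅓ * correlation g (fᵃ +𝟏))
      meanʳ g = trans (correlation-cong {f = g} (λ _ → refl) mean≡) (trans (correlation-combineʳ g (fᵃ -𝟏) (λ x → ⅓ * fᵃ 𝟎 x + ⅓ * fᵃ +𝟏 x) ⅓ 1ℚ)
        (cong (λ z → ⅓ * correlation g (fᵃ -𝟏) + 1ℚ * z) (correlation-combineʳ g (fᵃ 𝟎) (fᵃ +𝟏) ⅓ ⅓)))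
      meanˡ : ∀ g → correlation (mean f) g ≡ ⅓ * correlation (fᵃ -𝟏) g + 1ℚ * (⅓ * correlation (fᵃ 𝟎) g + ⅓ * correlation (fᵃ +𝟏) g)
      meanˡ g = trans (correlation-cong {g = g} mean≡ (λ _ → refl)) (trans (correlation-combineˡ (fᵃ -𝟏) (λ x → ⅓ * fᵃ 𝟎 x + ⅓ * fᵃ +𝟏 x) g ⅓ 1ℚ)
        (cong (λ z → ⅓ * correlation (fᵃ -𝟏) g + 1ℚ * z) (correlation-combineˡ (fᵃ 𝟎) (fᵃ +𝟏) g ⅓ ⅓)))
      avg : (Trit → ℚ) → ℚ
      avg φ = ⅓ * φ -𝟏 + 1ℚ * (⅓ * φ 𝟎 + ⅓ * φ +𝟏)
      mm : correlation (mean f) (mean f) ≡ avg (λ a → avg (B a))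
      mm = trans (meanˡ (mean f)) (cong₂ (λ u v → ⅓ * u + 1ℚ * v) (meanʳ (fᵃ -𝟏)) (cong₂ (λ u v → ⅓ * u + ⅓ * v) (meanʳ (fᵃ 𝟎)) (meanʳ (fᵃ +𝟏))))
      fluct : ∀ a → correlation (fluctuation f a) (fluctuation f a) ≡ (B a a - avg (B a)) - (avg (λ b → B b a) - avg (λ a → avg (B a)))
      fluct a = begin
        correlation (fluctuation f a) (fluctuation f a)
          ≡⟨ correlation-cong (λ x → eq (fᵃ a x) (mean f x)) (λ x → eq (fᵃ a x) (mean f x)) ⟩
        correlation (λ x → 1ℚ * fᵃ a x + - 1ℚ * mean f x) (λ x → 1ℚ * fᵃ a x + - 1ℚ * mean f x)
          ≡⟨ trans (correlation-combineˡ (fᵃ a) (mean f) (λ x → 1ℚ * fᵃ a x + - 1ℚ * mean f x) 1ℚ (- 1ℚ)) (cong₂ (λ u v → 1ℚ * u + - 1ℚ * v)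
               (correlation-combineʳ (fᵃ a) (fᵃ a) (mean f) 1ℚ (- 1ℚ)) (correlation-combineʳ (mean f) (fᵃ a) (mean f) 1ℚ (- 1ℚ))) ⟩
        1ℚ * (1ℚ * B a a + - 1ℚ * correlation (fᵃ a) (mean f)) + - 1ℚ * (1ℚ * correlation (mean f) (fᵃ a) + - 1ℚ * correlation (mean f) (mean f))
          ≡⟨ eq′ (B a a) (correlation (fᵃ a) (mean f)) (correlation (mean f) (fᵃ a)) (correlation (mean f) (mean f)) ⟩
        (B a a - correlation (fᵃ a) (mean f)) - (correlation (mean f) (fᵃ a) - correlation (mean f) (mean f))
          ≡⟨ cong₂ _-_ (cong (λ z → B a a - z) (meanʳ (fᵃ a))) (cong₂ _-_ (meanˡ (fᵃ a)) mm) ⟩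
        (B a a - avg (B a)) - (avg (λ b → B b a) - avg (λ a → avg (B a))) ∎
        where
        open ≡-Reasoning
        eq : ∀ f m → f - m ≡ 1ℚ * f + - 1ℚ * m
        eq = solve-∀ ℚ-ring
        eq′ : ∀ p q r s → 1ℚ * (1ℚ * p + - 1ℚ * q) + - 1ℚ * (1ℚ * r + - 1ℚ * s) ≡ (p - q) - (r - s)
        eq′ = solve-∀ ℚ-ring

  -- In one coordinate T fixes constants and multiplies functions of mean zero by ρ, and the mixed
  -- terms vanish. Both sides are expanded into the nine correlations between restrictions of f.
  correlation-split : ∀ {n} (f : Point (suc n) → ℚ) → correlation f f ≡
    correlation (mean f) (mean f) + ρ * average (λ a → correlation (fluctuation f a) (fluctuation f a))
  correlation-split {n} f = trans (correlation-suc f f) (trans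
    (eq η (B -𝟏 -𝟏) (B -𝟏 𝟎) (B -𝟏 +𝟏) (B 𝟎 -𝟏) (B 𝟎 𝟎) (B 𝟎 +𝟏) (B +𝟏 -𝟏) (B +𝟏 𝟎) (B +𝟏 +𝟏))
    (sym (cong₂ (λ u v → u + ρ * v) mm (average-cong fluct))))
    where
    open Split f
    eq : ∀ η a b c d e f g h i →
      (⅓ - 2ℚ * η) * a + (η * b + (η * c + (η * d + ((⅓ - 2ℚ * η) * e + (η * f + (η * g + (η * h + ((⅓ - 2ℚ * η) * i + 0ℚ))))))))
      ≡ (⅓ * (⅓ * a + 1ℚ * (⅓ * b + ⅓ * c)) + 1ℚ * (⅓ * (⅓ * d + 1ℚ * (⅓ * e + ⅓ * f)) + ⅓ * (⅓ * g + 1ℚ * (⅓ * h + ⅓ * i))))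
      + (1ℚ - fromℕ 9 * η) * (⅓ * (
        ((a - (⅓ * a + 1ℚ * (⅓ * b + ⅓ * c))) - ((⅓ * a + 1ℚ * (⅓ * d + ⅓ * g)) - (⅓ * (⅓ * a + 1ℚ * (⅓ * b + ⅓ * c)) + 1ℚ * (⅓ * (⅓ * d + 1ℚ * (⅓ * e + ⅓ * f)) + ⅓ * (⅓ * g + 1ℚ * (⅓ * h + ⅓ * i))))))
        + ((e - (⅓ * d + 1ℚ * (⅓ * e + ⅓ * f))) - ((⅓ * b + 1ℚ * (⅓ * e + ⅓ * h)) - (⅓ * (⅓ * a + 1ℚ * (⅓ * b + ⅓ * c)) + 1ℚ * (⅓ * (⅓ * d + 1ℚ * (⅓ * e + ⅓ * f)) + ⅓ * (⅓ * g + 1ℚ * (⅓ * h + ⅓ * i))))))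
        + ((i - (⅓ * g + 1ℚ * (⅓ * h + ⅓ * i))) - ((⅓ * c + 1ℚ * (⅓ * f + ⅓ * i)) - (⅓ * (⅓ * a + 1ℚ * (⅓ * b + ⅓ * c)) + 1ℚ * (⅓ * (⅓ * d + 1ℚ * (⅓ * e + ⅓ * f)) + ⅓ * (⅓ * g + 1ℚ * (⅓ * h + ⅓ * i))))))))
    eq = solve-∀ ℚ-ring

  module _ (0≤ρ : 0ℚ ≤ ρ) (ρ≤1 : ρ ≤ 1ℚ) where

    -- The weight at degree k enters the right side with the factor 1 - λ′ ρᵏ, which is at least 1 -
    -- λ′ ρᵈ for k ≥ d and nonnegative otherwise. The parameter λ′ serves the induction: a
    -- fluctuation lowers d by one and turns λ′ into λ′ ρ.
    tail-bound : ∀ {n} d (f : Point n → ℚ) λ′ → 0ℚ ≤ λ′ → λ′ ≤ 1ℚ →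
      (1ℚ - λ′ * ρ ^ d) * tail d f ≤ norm² f - λ′ * correlation f f
    tail-bound {zero} zero f λ′ 0≤λ λ≤1 = ≤-reflexive (eq λ′ (f []))
      where
      eq : ∀ λ′ c → (1ℚ - λ′ * 1ℚ) * (1ℚ * (((1ℚ * (c * 0ℚ) + 0ℚ) - c) * ((1ℚ * (c * 0ℚ) + 0ℚ) - c)) + 0ℚ) ≡ (1ℚ * (c * c) + 0ℚ) - λ′ * (1ℚ * (c * c) + 0ℚ)
      eq = solve-∀ ℚ-ring
    tail-bound {zero} (suc d) f λ′ 0≤λ λ≤1 = ≤-trans
      (≤-reflexive (trans (cong ((1ℚ - λ′ * ρ ^ suc d) *_) (tail-base d f)) (*-zeroʳ (1ℚ - λ′ * ρ ^ suc d))))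
      (≤-trans (0≤* (p≤q⇒0≤q-p λ≤1) (0≤p² (f []))) (≤-reflexive (eq λ′ (f []))))
      where
      eq : ∀ λ′ c → (1ℚ - λ′) * (c * c) ≡ (1ℚ * (c * c) + 0ℚ) - λ′ * (1ℚ * (c * c) + 0ℚ)
      eq = solve-∀ ℚ-ring
    tail-bound {suc n} d f λ′ 0≤λ λ≤1 = begin
      (1ℚ - λ′ * ρ ^ d) * tail d f
        ≤⟨ step d ⟩
      (norm² (mean f) - λ′ * correlation (mean f) (mean f)) + average (λ a → norm² (fluctuation f a) - (λ′ * ρ) * correlation (fluctuation f a) (fluctuation f a))
        ≡⟨ eq (norm² (mean f)) λ′ (correlation (mean f) (mean f)) ρ (N -𝟏) (N 𝟎) (N +𝟏) (Q -𝟏) (Q 𝟎) (Q +𝟏) ⟩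
      (norm² (mean f) + average N) - λ′ * (correlation (mean f) (mean f) + ρ * average Q)
        ≡⟨ cong₂ (λ u v → u - λ′ * v) (norm²-suc f) (correlation-split f) ⟨
      norm² f - λ′ * correlation f f ∎
      where
      open ≤-Reasoning
      N Q : Trit → ℚ
      N a = norm² (fluctuation f a)
      Q a = correlation (fluctuation f a) (fluctuation f a)
      eq : ∀ n λ′ q ρ a b c x y z → (n - λ′ * q) + ⅓ * ((a - (λ′ * ρ) * x) + (b - (λ′ * ρ) * y) + (c - (λ′ * ρ) * z)) ≡
        (n + ⅓ * (a + b + c)) - λ′ * (q + ρ * (⅓ * (x + y + z)))
      eq = solve-∀ ℚ-ring
      0≤λρ : 0ℚ ≤ λ′ * ρ
      0≤λρ = 0≤* 0≤λ 0≤ρ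
      λρ≤λ : λ′ * ρ ≤ λ′
      λρ≤λ = ≤-trans (*-monoˡ-≤ 0≤λ ρ≤1) (≤-reflexive (*-identityʳ λ′))
      λρ≤1 = ≤-trans λρ≤λ λ≤1
      R = (norm² (mean f) - λ′ * correlation (mean f) (mean f)) + average (λ a → norm² (fluctuation f a) - (λ′ * ρ) * correlation (fluctuation f a) (fluctuation f a))
      eq₁ : ∀ c n a b d → c * (n + ⅓ * (a + b + d)) ≡ c * n + ⅓ * (c * a + c * b + c * d)
      eq₁ = solve-∀ ℚ-ring
      eq₂ : ∀ λ′ ρ r → λ′ * (ρ * r) ≡ (λ′ * ρ) * r
      eq₂ = solve-∀ ℚ-ring
      step : ∀ d → (1ℚ - λ′ * ρ ^ d) * tail d f ≤ R
      -- Degree 0 cannot be lowered, so the fluctuation keeps it; 1 - λ′ ≤ 1 - λ′ ρ makes up for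
      -- this.
      step zero = begin
        (1ℚ - λ′ * 1ℚ) * tail 0 f
          ≡⟨ cong ((1ℚ - λ′ * 1ℚ) *_) (trans (tail-0 f) (norm²-suc f)) ⟩
        (1ℚ - λ′ * 1ℚ) * (norm² (mean f) + average N)
          ≡⟨ eq₁ (1ℚ - λ′ * 1ℚ) (norm² (mean f)) (N -𝟏) (N 𝟎) (N +𝟏) ⟩
        (1ℚ - λ′ * 1ℚ) * norm² (mean f) + average (λ a → (1ℚ - λ′ * 1ℚ) * N a)
          ≤⟨ +-mono-≤ (≤-trans (≤-reflexive (cong ((1ℚ - λ′ * 1ℚ) *_) (sym (tail-0 (mean f))))) (tail-bound 0 (mean f) λ′ 0≤λ λ≤1))
               (average-mono λ a → ≤-trans (*-monoʳ-≤ (≤-trans (0≤tail 0 (fluctuation f a)) (≤-reflexive (tail-0 (fluctuation f a))))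
                 (+-monoʳ-≤ 1ℚ (neg-antimono-≤ (*-monoʳ-≤ 0≤1 λρ≤λ))))
                 (≤-trans (≤-reflexive (cong ((1ℚ - λ′ * ρ * 1ℚ) *_) (sym (tail-0 (fluctuation f a))))) (tail-bound 0 (fluctuation f a) (λ′ * ρ) 0≤λρ λρ≤1))) ⟩
        R ∎
      step (suc d) = begin
        (1ℚ - λ′ * (ρ * ρ ^ d)) * tail (suc d) f
          ≡⟨ cong ((1ℚ - λ′ * (ρ * ρ ^ d)) *_) (tail-suc d f) ⟩
        (1ℚ - λ′ * (ρ * ρ ^ d)) * (tail (suc d) (mean f) + average V)
          ≡⟨ eq₁ (1ℚ - λ′ * (ρ * ρ ^ d)) (tail (suc d) (mean f)) (V -𝟏) (V 𝟎) (V +𝟏) ⟩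
        (1ℚ - λ′ * (ρ * ρ ^ d)) * tail (suc d) (mean f) + average (λ a → (1ℚ - λ′ * (ρ * ρ ^ d)) * V a)
          ≤⟨ +-mono-≤ (tail-bound (suc d) (mean f) λ′ 0≤λ λ≤1)
               (average-mono λ a → ≤-trans (≤-reflexive (cong (λ z → (1ℚ - z) * V a) (eq₂ λ′ ρ (ρ ^ d)))) (tail-bound d (fluctuation f a) (λ′ * ρ) 0≤λρ λρ≤1)) ⟩
        R ∎
        where
        V : Trit → ℚ
        V a = tail d (fluctuation f a)

-- Coupling the noise with the steps of the walk

𝟙² : ∀ b → 𝟙 b * 𝟙 b ≡ 𝟙 b
𝟙² true  = refl
𝟙² false = refl

-- Applied to two noisy copies coordinate by coordinate, this gives a common origin from which each
-- copy is reached by one step without drift.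
meet : Trit → Trit → Trit
meet -𝟏 -𝟏 = -𝟏
meet +𝟏 +𝟏 = +𝟏
meet _  _  = 𝟎

module _ (η : ℚ) where

  pairs-uniform : ∀ (φ : Trit → ℚ) → 𝔼 tritPairs (noise η) (λ p → φ (proj₁ p)) ≡ 𝔼 trits third φ
  pairs-uniform φ = eq η (φ -𝟏) (φ 𝟎) (φ +𝟏)
    where
    eq : ∀ η a b c → (⅓ - 2ℚ * η) * a + (η * a + (η * a + (η * b + ((⅓ - 2ℚ * η) * b + (η * b + (η * c + (η * c + ((⅓ - 2ℚ * η) * c + 0ℚ))))))))
      ≡ ⅓ * a + (⅓ * b + (⅓ * c + 0ℚ))
    eq = solve-∀ ℚ-ring

  -- For a = s the meet is 0 for the two values b ≠ s, of weight η each, which matches the weight 2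
  -- η of `leave s`. For a = 0 it is always 0, with total weight ⅓.
  pairs-moveˡ : ∀ (φ : Trit × Trit → ℚ) → 𝔼 tritPairs (noise η) (λ (a , b) → φ (meet a b , a)) ≡ 𝔼 moves (moveWeight η 0ℚ) (λ v → φ (before v , after v))
  pairs-moveˡ φ = eq η (φ (-𝟏 , -𝟏)) (φ (𝟎 , -𝟏)) (φ (𝟎 , 𝟎)) (φ (𝟎 , +𝟏)) (φ (+𝟏 , +𝟏))
    where
    eq : ∀ η m l z r p → (⅓ - 2ℚ * η) * m + (η * l + (η * l + (η * z + ((⅓ - 2ℚ * η) * z + (η * z + (η * r + (η * r + ((⅓ - 2ℚ * η) * p + 0ℚ))))))))
      ≡ (⅓ + 2ℚ * 0ℚ) * z + (2ℚ * η * r + (2ℚ * η * l + ((⅓ - 2ℚ * η - 0ℚ) * p + ((⅓ - 2ℚ * η - 0ℚ) * m + 0ℚ))))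
    eq = solve-∀ ℚ-ring

  pairs-moveʳ : ∀ (φ : Trit × Trit → ℚ) → 𝔼 tritPairs (noise η) (λ (a , b) → φ (meet a b , b)) ≡ 𝔼 moves (moveWeight η 0ℚ) (λ v → φ (before v , after v))
  pairs-moveʳ φ = eq η (φ (-𝟏 , -𝟏)) (φ (𝟎 , -𝟏)) (φ (𝟎 , 𝟎)) (φ (𝟎 , +𝟏)) (φ (+𝟏 , +𝟏))
    where
    eq : ∀ η m l z r p → (⅓ - 2ℚ * η) * m + (η * z + (η * r + (η * l + ((⅓ - 2ℚ * η) * z + (η * r + (η * l + (η * z + ((⅓ - 2ℚ * η) * p + 0ℚ))))))))
      ≡ (⅓ + 2ℚ * 0ℚ) * z + (2ℚ * η * r + (2ℚ * η * l + ((⅓ - 2ℚ * η - 0ℚ) * p + ((⅓ - 2ℚ * η - 0ℚ) * m + 0ℚ))))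
    eq = solve-∀ ℚ-ring

  module _ (0≤η : 0ℚ ≤ η) (12η≤1 : fromℕ 12 * η ≤ 1ℚ) {n : ℕ} (S : Subset n) where

    private
      P = 𝔼ⁿ tritPairs (noise η) n
      change : Vec (Trit × Trit) n → ℚ
      change v = 𝟙 (S (Vec.map proj₁ v) xor S (Vec.map proj₂ v))
      0≤stay : 0ℚ ≤ ⅓ - 2ℚ * η
      0≤stay = ≤-trans (0≤+ (0≤* {ℤ.+ 1 ℚ./ 6} (nonNegative⁻¹ _) (p≤q⇒0≤q-p 12η≤1)) (nonNegative⁻¹ (ℤ.+ 1 ℚ./ 6))) (≤-reflexive (eq η))
        where
        eq : ∀ η → (ℤ.+ 1 ℚ./ 6) * (1ℚ - fromℕ 12 * η) + (ℤ.+ 1 ℚ./ 6) ≡ ⅓ - 2ℚ * η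
        eq = solve-∀ ℚ-ring
      noise-nonneg : ∀ p → 0ℚ ≤ noise η p
      noise-nonneg (-𝟏 , -𝟏) = 0≤stay
      noise-nonneg (-𝟏 , 𝟎 ) = 0≤η
      noise-nonneg (-𝟏 , +𝟏) = 0≤η
      noise-nonneg (𝟎  , -𝟏) = 0≤η
      noise-nonneg (𝟎  , 𝟎 ) = 0≤stay
      noise-nonneg (𝟎  , +𝟏) = 0≤η
      noise-nonneg (+𝟏 , -𝟏) = 0≤η
      noise-nonneg (+𝟏 , 𝟎 ) = 0≤η
      noise-nonneg (+𝟏 , +𝟏) = 0≤stay

      along : ∀ (h : Trit × Trit → Trit) →
        (∀ (φ : Trit × Trit → ℚ) → 𝔼 tritPairs (noise η) (λ p → φ (meet (proj₁ p) (proj₂ p) , h p)) ≡ 𝔼 moves (moveWeight η 0ℚ) (λ v → φ (before v , after v))) →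
        P (λ v → 𝟙 (S (Vec.map (λ p → meet (proj₁ p) (proj₂ p)) v) xor S (Vec.map h v))) ≡ changeProbability S η 0ℚ
      along h e = trans (𝔼-cong (vecs tritPairs n) (∏ (noise η)) (λ v → cong₂ (λ x y → 𝟙 (S x xor S y)) (Vec.map-∘ proj₁ h′ v) (Vec.map-∘ proj₂ h′ v)))
        (trans (pushforward tritPairs (noise η) h′ moves (moveWeight η 0ℚ) g e n change)
        (𝔼-cong (vecs moves n) (∏ (moveWeight η 0ℚ)) (λ v → cong₂ (λ x y → 𝟙 (S x xor S y)) (sym (Vec.map-∘ proj₁ g v)) (sym (Vec.map-∘ proj₂ g v)))))
        where
        h′ : Trit × Trit → Trit × Trit
        h′ p = meet (proj₁ p) (proj₂ p) , h p
        g : Move → Trit × Trit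
        g v = before v , after v

    -- Two coupled points agree unless one of them differs from their meet in membership.
    correlation-change : norm² (λ x → 𝟙 (S x)) - correlation η (λ x → 𝟙 (S x)) (λ x → 𝟙 (S x)) ≤ changeProbability S η 0ℚ + changeProbability S η 0ℚ
    correlation-change = begin
      norm² f - correlation η f f
        ≡⟨ cong (_- correlation η f f) (trans (U-cong n (λ x → cong (λ y → f y * f y) (sym (Vec.map-id x))))
             (trans (sym (pushforward tritPairs (noise η) proj₁ trits third (λ a → a) pairs-uniform n (λ x → f x * f x)))
               (𝔼-cong (vecs tritPairs n) (∏ (noise η)) (λ v → refl)))) ⟩
      P (λ v → f (Vec.map proj₁ v) * f (Vec.map proj₁ v)) - correlation η f f
        ≡⟨ trans (eq (P (λ v → f (Vec.map proj₁ v) * f (Vec.map proj₁ v))) (correlation η f f)) (cong (P (λ v → f (Vec.map proj₁ v) * f (Vec.map proj₁ v)) +_) (sym (𝔼-* (vecs tritPairs n) (∏ (noise η)) (- 1ℚ) _))) ⟩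
      P (λ v → f (Vec.map proj₁ v) * f (Vec.map proj₁ v)) + P (λ v → - 1ℚ * (f (Vec.map proj₁ v) * f (Vec.map proj₂ v)))
        ≡⟨ 𝔼-+ (vecs tritPairs n) (∏ (noise η)) _ _ ⟨
      P (λ v → f (Vec.map proj₁ v) * f (Vec.map proj₁ v) + - 1ℚ * (f (Vec.map proj₁ v) * f (Vec.map proj₂ v)))
        ≤⟨ 𝔼-mono (vecs tritPairs n) (∏-nonneg noise-nonneg) (λ v → boolean (S (Vec.map (λ p → meet (proj₁ p) (proj₂ p)) v)) (S (Vec.map proj₁ v)) (S (Vec.map proj₂ v))) ⟩
      P (λ v → 𝟙 (S (Vec.map (λ p → meet (proj₁ p) (proj₂ p)) v) xor S (Vec.map proj₁ v)) + 𝟙 (S (Vec.map (λ p → meet (proj₁ p) (proj₂ p)) v) xor S (Vec.map proj₂ v)))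
        ≡⟨ 𝔼-+ (vecs tritPairs n) (∏ (noise η)) _ _ ⟩
      P (λ v → 𝟙 (S (Vec.map (λ p → meet (proj₁ p) (proj₂ p)) v) xor S (Vec.map proj₁ v))) + P (λ v → 𝟙 (S (Vec.map (λ p → meet (proj₁ p) (proj₂ p)) v) xor S (Vec.map proj₂ v)))
        ≡⟨ cong₂ _+_ (along proj₁ pairs-moveˡ) (along proj₂ pairs-moveʳ) ⟩
      changeProbability S η 0ℚ + changeProbability S η 0ℚ ∎
      where
      open ≤-Reasoning
      f : Point n → ℚ
      f x = 𝟙 (S x)
      eq : ∀ a b → a - b ≡ a + - 1ℚ * b
      eq = solve-∀ ℚ-ring
      boolean : ∀ m a b → 𝟙 a * 𝟙 a + - 1ℚ * (𝟙 a * 𝟙 b) ≤ 𝟙 (m xor a) + 𝟙 (m xor b)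
      boolean true  true  true  = ≤-refl
      boolean true  true  false = ≤-refl
      boolean true  false true  = 0≤1
      boolean true  false false = nonNegative⁻¹ 2ℚ
      boolean false true  true  = nonNegative⁻¹ 2ℚ
      boolean false true  false = ≤-refl
      boolean false false true  = 0≤1
      boolean false false false = ≤-refl

    -- With λ′ = 1 and ρᵈ ≤ ½ the factor in `tail-bound` is at least ½; the other factor 2 comes
    -- from the two steps of the coupling.
    tail≤changeProbability : ∀ d → ρ η ^ d ≤ ½ → tail d (λ x → 𝟙 (S x)) ≤ 4ℚ * changeProbability S η 0ℚ
    tail≤changeProbability d ρᵈ≤½ = begin
      τ                                            ≡⟨ eq₁ τ ⟩
      2ℚ * ((1ℚ - ½) * τ)                          ≤⟨ *-monoˡ-≤ (nonNegative⁻¹ 2ℚ) (*-monoʳ-≤ (0≤tail d f) (+-monoʳ-≤ 1ℚ (neg-antimono-≤ ρᵈ≤½))) ⟩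
      2ℚ * ((1ℚ - ρ η ^ d) * τ)                    ≡⟨ cong (λ z → 2ℚ * ((1ℚ - z) * τ)) (sym (*-identityˡ (ρ η ^ d))) ⟩
      2ℚ * ((1ℚ - 1ℚ * ρ η ^ d) * τ)               ≤⟨ *-monoˡ-≤ (nonNegative⁻¹ 2ℚ) (tail-bound η 0≤ρ ρ≤1 d f 1ℚ 0≤1 ≤-refl) ⟩
      2ℚ * (norm² f - 1ℚ * correlation η f f)      ≡⟨ cong (λ z → 2ℚ * (norm² f - z)) (*-identityˡ (correlation η f f)) ⟩
      2ℚ * (norm² f - correlation η f f)           ≤⟨ *-monoˡ-≤ (nonNegative⁻¹ 2ℚ) correlation-change ⟩
      2ℚ * (C + C)                                 ≡⟨ eq₂ C ⟩
      4ℚ * C                                       ∎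
      where
      open ≤-Reasoning
      f : Point n → ℚ
      f x = 𝟙 (S x)
      τ = tail d f
      C = changeProbability S η 0ℚ
      eq₁ : ∀ t → t ≡ 2ℚ * ((1ℚ - ½) * t)
      eq₁ = solve-∀ ℚ-ring
      eq₂ : ∀ c → 2ℚ * (c + c) ≡ 4ℚ * c
      eq₂ = solve-∀ ℚ-ring
      0≤ρ : 0ℚ ≤ ρ η
      0≤ρ = ≤-trans (0≤+ (0≤* {ℤ.+ 3 ℚ./ 4} (nonNegative⁻¹ _) (p≤q⇒0≤q-p 12η≤1)) (nonNegative⁻¹ (ℤ.+ 1 ℚ./ 4))) (≤-reflexive (eq η))
        where
        eq : ∀ η → (ℤ.+ 3 ℚ./ 4) * (1ℚ - fromℕ 12 * η) + (ℤ.+ 1 ℚ./ 4) ≡ 1ℚ - fromℕ 9 * η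
        eq = solve-∀ ℚ-ring
      ρ≤1 : ρ η ≤ 1ℚ
      ρ≤1 = ≤-trans (+-monoʳ-≤ 1ℚ (neg-antimono-≤ (0≤* (0≤fromℕ 9) 0≤η))) (≤-reflexive (+-identityʳ 1ℚ))

-- The dimension of the functions of low degree

-- The squared Hilbert–Schmidt norm of the projection, that is, the dimension of its range.
dimension : ℕ → ℕ → ℚ
dimension n d = U n (λ y → U n (λ x → kernel d x y * kernel d x y))

-- A new coordinate contributes the constant function, which costs no degree, and two dimensions of
-- functions with mean zero, which cost one. In closed form the dimension is the sum of C(n, k) 2^k
-- over k < d.
dimension-suc : ∀ n d → dimension (suc n) (suc d) ≡ dimension n (suc d) + 2ℚ * dimension n d
dimension-suc n d = begin
  U (suc n) (λ y → U (suc n) (λ x → kernel (suc d) x y * kernel (suc d) x y))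
    ≡⟨ trans (U-suc n _) (average-cong (λ b → U-cong n (λ y → U-suc n (λ x → kernel (suc d) x (b ∷ y) * kernel (suc d) x (b ∷ y))))) ⟩
  average (λ b → U n (λ y → average (λ a → U n (λ x → K a b x y * K a b x y))))
    ≡⟨ average-cong (λ b → U-cong n (λ y → U-average n (λ a x → K a b x y * K a b x y))) ⟩
  average (λ b → U n (λ y → U n (λ x → average (λ a → K a b x y * K a b x y))))
    ≡⟨ average-cong (λ b → U-cong n (λ y → U-cong n (λ x → squares b (kernel (suc d) x y) (kernel d x y)))) ⟩
  average (λ b → U n (λ y → U n (λ x → kernel (suc d) x y * kernel (suc d) x y + 2ℚ * (kernel d x y * kernel d x y))))
    ≡⟨ eq _ ⟩
  U n (λ y → U n (λ x → kernel (suc d) x y * kernel (suc d) x y + 2ℚ * (kernel d x y * kernel d x y)))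
    ≡⟨ U-cong n (λ y → trans (U-+ n _ _) (cong (U n (λ x → kernel (suc d) x y * kernel (suc d) x y) +_) (U-* n 2ℚ _))) ⟩
  U n (λ y → U n (λ x → kernel (suc d) x y * kernel (suc d) x y) + 2ℚ * U n (λ x → kernel d x y * kernel d x y))
    ≡⟨ trans (U-+ n _ _) (cong (dimension n (suc d) +_) (U-* n 2ℚ _)) ⟩
  dimension n (suc d) + 2ℚ * dimension n d ∎
  where
  open ≡-Reasoning
  K : Trit → Trit → Point n → Point n → ℚ
  K a b x y = kernel (suc d) x y + contrast a b * kernel d x y
  eq : ∀ a → ⅓ * (a + a + a) ≡ a
  eq = solve-∀ ℚ-ring
  squares : ∀ b k k′ → average (λ a → (k + contrast a b * k′) * (k + contrast a b * k′)) ≡ k * k + 2ℚ * (k′ * k′)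
  squares -𝟏 = eq₁
    where
    eq₁ : ∀ k k′ → ⅓ * ((k + 2ℚ * k′) * (k + 2ℚ * k′) + (k + - 1ℚ * k′) * (k + - 1ℚ * k′) + (k + - 1ℚ * k′) * (k + - 1ℚ * k′)) ≡ k * k + 2ℚ * (k′ * k′)
    eq₁ = solve-∀ ℚ-ring
  squares 𝟎 = eq₁
    where
    eq₁ : ∀ k k′ → ⅓ * ((k + - 1ℚ * k′) * (k + - 1ℚ * k′) + (k + 2ℚ * k′) * (k + 2ℚ * k′) + (k + - 1ℚ * k′) * (k + - 1ℚ * k′)) ≡ k * k + 2ℚ * (k′ * k′)
    eq₁ = solve-∀ ℚ-ring
  squares +𝟏 = eq₁
    where
    eq₁ : ∀ k k′ → ⅓ * ((k + - 1ℚ * k′) * (k + - 1ℚ * k′) + (k + - 1ℚ * k′) * (k + - 1ℚ * k′) + (k + 2ℚ * k′) * (k + 2ℚ * k′)) ≡ k * k + 2ℚ * (k′ * k′)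
    eq₁ = solve-∀ ℚ-ring

dimension-0 : ∀ n → dimension n 0 ≡ 0ℚ
dimension-0 n = trans (U-cong n (λ y → trans (U-* n 0ℚ (λ _ → 0ℚ)) (trans (*-zeroˡ (U n (λ _ → 0ℚ))) (sym (*-zeroˡ 0ℚ)))))
  (trans (U-* n 0ℚ (λ _ → 0ℚ)) (*-zeroˡ (U n (λ _ → 0ℚ))))

0≤^ : ∀ {x} n → 0ℚ ≤ x → 0ℚ ≤ x ^ n
0≤^ zero    0≤x = 0≤1
0≤^ (suc n) 0≤x = 0≤* 0≤x (0≤^ n 0≤x)

1≤^ : ∀ {x} n → 1ℚ ≤ x → 1ℚ ≤ x ^ n
1≤^ zero    1≤x = ≤-refl
1≤^ (suc n) 1≤x = *-mono-≤-nonNeg 0≤1 (0≤^ n (≤-trans 0≤1 1≤x)) 1≤x (1≤^ n 1≤x)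

-- The binomial sum for the dimension is compared with the binomial expansion of (1 + 2 x) ^ n.
dimension-bound : ∀ X x → 1ℚ ≤ X → x * X ≡ 1ℚ → 0ℚ ≤ x → ∀ n d → dimension n d ≤ X ^ d * (1ℚ + 2ℚ * x) ^ n
dimension-bound X x 1≤X xX≡1 0≤x = go
  where
  open ≤-Reasoning
  0≤X = ≤-trans 0≤1 1≤X
  0≤1+2x : 0ℚ ≤ 1ℚ + 2ℚ * x
  0≤1+2x = 0≤+ 0≤1 (0≤* (nonNegative⁻¹ 2ℚ) 0≤x)
  eq : ∀ x X p q → X * p * q + 2ℚ * ((x * X) * (p * q)) ≡ X * p * ((1ℚ + 2ℚ * x) * q)
  eq = solve-∀ ℚ-ring
  go : ∀ n d → dimension n d ≤ X ^ d * (1ℚ + 2ℚ * x) ^ n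
  go n zero = ≤-trans (≤-reflexive (dimension-0 n)) (0≤* 0≤1 (0≤^ n 0≤1+2x))
  go zero (suc d) = ≤-trans (1≤^ (suc d) 1≤X) (≤-reflexive (sym (*-identityʳ (X ^ suc d))))
  go (suc n) (suc d) = begin
    dimension (suc n) (suc d)
      ≡⟨ dimension-suc n d ⟩
    dimension n (suc d) + 2ℚ * dimension n d
      ≤⟨ +-mono-≤ (go n (suc d)) (*-monoˡ-≤ (nonNegative⁻¹ 2ℚ) (go n d)) ⟩
    X * X ^ d * (1ℚ + 2ℚ * x) ^ n + 2ℚ * (X ^ d * (1ℚ + 2ℚ * x) ^ n)
      ≡⟨ cong (λ z → X * X ^ d * (1ℚ + 2ℚ * x) ^ n + 2ℚ * z) (trans (sym (*-identityˡ (X ^ d * (1ℚ + 2ℚ * x) ^ n))) (cong (_* (X ^ d * (1ℚ + 2ℚ * x) ^ n)) (sym xX≡1))) ⟩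
    X * X ^ d * (1ℚ + 2ℚ * x) ^ n + 2ℚ * ((x * X) * (X ^ d * (1ℚ + 2ℚ * x) ^ n))
      ≡⟨ eq x X (X ^ d) ((1ℚ + 2ℚ * x) ^ n) ⟩
    X * X ^ d * ((1ℚ + 2ℚ * x) * (1ℚ + 2ℚ * x) ^ n) ∎

-- Probabilities as expectations

/-cancel : ∀ z N .{{_ : ℕ.NonZero N}} → (z ℚ./ N) * fromℕ N ≡ fromℤ z
/-cancel z (suc N) = toℚᵘ-injective (begin
  ℚ.toℚᵘ ((z ℚ./ suc N) * fromℕ (suc N))                 ≈⟨ toℚᵘ-homo-* (z ℚ./ suc N) (fromℕ (suc N)) ⟩
  ℚ.toℚᵘ (z ℚ./ suc N) ℚᵘ.* ℚ.toℚᵘ (fromℕ (suc N))       ≈⟨ ℚᵘ.*-cong (toℚᵘ-fromℚᵘ (ℚᵘ.mkℚᵘ z N)) (toℚᵘ-fromℚᵘ (ℚᵘ.mkℚᵘ (ℤ.+ suc N) 0)) ⟩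
  ℚᵘ.mkℚᵘ z N ℚᵘ.* ℚᵘ.mkℚᵘ (ℤ.+ suc N) 0                 ≈⟨ ℚᵘ.*≡* (trans (ℤ.*-identityʳ (z ℤ.* ℤ.+ suc N)) (cong (λ k → z ℤ.* ℤ.+ k) (sym (ℕ.*-identityʳ (suc N))))) ⟩
  ℚᵘ.mkℚᵘ z 0                                            ≈⟨ toℚᵘ-fromℚᵘ (ℚᵘ.mkℚᵘ z 0) ⟨
  ℚ.toℚᵘ (fromℤ z)                                       ∎)
  where open ℚᵘ.≃-Reasoning

count-∑ : ∀ {A : Set} (p : A → Bool) as → fromℕ (List.length (filterᵇ p as)) ≡ ∑ as (λ a → 𝟙 (p a))
count-∑ p []       = refl
count-∑ p (a ∷ as) with p a
... | true  = trans (fromℕ-suc (List.length (filterᵇ p as))) (cong (1ℚ +_) (count-∑ p as))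
... | false = trans (count-∑ p as) (sym (+-identityˡ _))

toList-vectors≡vecs : ∀ {A : Set} (as : List⁺ A) n → toList (vectors as n) ≡ vecs (toList as) n
toList-vectors≡vecs as zero    = refl
toList-vectors≡vecs as (suc n) = trans (toList-vectors as n)
  (List.concatMap-cong (λ a → cong (List.map (a ∷_)) (toList-vectors≡vecs as n)) (toList as))

∏-const : ∀ {A : Set} {n} {w : A → ℚ} {c} → (∀ a → w a ≡ c) → ∀ (v : Vec A n) → ∏ w v ≡ c ^ n
∏-const e []      = refl
∏-const e (a ∷ v) = cong₂ _*_ (e a) (∏-const e v)

ratio : ∀ c p q x y → c * q ≡ 1ℚ → p * q ≡ x → c * x ≡ y → p ≡ y
ratio c p q x y cq≡1 pq≡x cx≡y = begin
  p            ≡⟨ *-identityʳ p ⟨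
  p * 1ℚ       ≡⟨ cong (p *_) cq≡1 ⟨
  p * (c * q)  ≡⟨ eq p c q ⟩
  c * (p * q)  ≡⟨ cong (c *_) pq≡x ⟩
  c * x        ≡⟨ cx≡y ⟩
  y            ∎
  where
  open ≡-Reasoning
  eq : ∀ p c q → p * (c * q) ≡ c * (p * q)
  eq = solve-∀ ℚ-ring

-- N is kept apart from the length of the list, because `dist` divides by a power of 3 and `Pr` by
-- the length of a nonempty list.
uniform-ratio : ∀ {A : Set} (as : List A) w c → (∀ a → w a ≡ c) → ∑ as w ≡ 1ℚ →
  ∀ N z .{{_ : ℕ.NonZero N}} → N ≡ List.length as → ∀ (e : A → Bool) → fromℤ z ≡ ∑ as (λ a → 𝟙 (e a)) →
  z ℚ./ N ≡ 𝔼 as w (λ a → 𝟙 (e a))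
uniform-ratio as w c w≡c one N z refl e z≡ = ratio c (z ℚ./ N) (fromℕ N) (∑ as (λ a → 𝟙 (e a))) _
  (begin
    c * fromℕ (List.length as)      ≡⟨ *-comm c _ ⟩
    fromℕ (List.length as) * c      ≡⟨ ∑-const as c ⟨
    ∑ as (λ _ → c)                  ≡⟨ ∑-cong as w≡c ⟨
    ∑ as w                          ≡⟨ one ⟩
    1ℚ                              ∎)
  (trans (/-cancel z N) z≡)
  (trans (sym (∑-*ˡ as c)) (∑-cong as λ a → cong (_* 𝟙 (e a)) (sym (w≡c a))))
  where open ≡-Reasoning

∑-trits : ∑ trits third ≡ 1ℚ
∑-trits = refl

∑-points : ∀ n → ∑ (vecs trits n) (∏ third) ≡ 1ℚ
∑-points = ∑-∏ trits third ∑-trits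

length-vecs : ∀ n → List.length (vecs trits n) ≡ 3 ℕ.^ n
length-vecs zero    = refl
length-vecs (suc n) = trans (List.length-++ (List.map (-𝟏 ∷_) V)) (cong₂ ℕ._+_ (len -𝟏)
  (trans (List.length-++ (List.map (𝟎 ∷_) V)) (cong₂ ℕ._+_ (len 𝟎)
    (trans (List.length-++ (List.map (+𝟏 ∷_) V)) (cong (ℕ._+ 0) (len +𝟏))))))
  where
  V = vecs trits n
  len : ∀ a → List.length (List.map (a ∷_) V) ≡ 3 ℕ.^ n
  len a = trans (List.length-map (a ∷_) V) (length-vecs n)

dist-U : ∀ {n} (S S′ : Subset n) → dist S S′ ≡ U n (λ x → 𝟙 (S x xor S′ x))
dist-U {n} S S′ = uniform-ratio (vecs trits n) (∏ third) (⅓ ^ n) (∏-const (λ _ → refl)) (∑-points n)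
  (3 ℕ.^ n) (ℤ.+ ∣ S Δ S′ ∣) {{ℕ.m^n≢0 3 n}} (sym (length-vecs n)) (λ x → S x xor S′ x)
  (trans (count-∑ (S Δ S′) (toList (points n))) (cong (λ L → ∑ L (λ x → 𝟙 (S x xor S′ x))) (toList-vectors≡vecs _ n)))

-- Sampling

tally : ∀ {A : Set} {k} → (A → ℚ) → Vec A k → ℚ
tally φ []       = 0ℚ
tally φ (x ∷ xs) = φ x + tally φ xs

tally-map : ∀ {A B : Set} {k} (φ : B → ℚ) (h : A → B) (xs : Vec A k) → tally φ (Vec.map h xs) ≡ tally (φ ∘ h) xs
tally-map φ h []       = refl
tally-map φ h (x ∷ xs) = cong (φ (h x) +_) (tally-map φ h xs)

𝔼ⁿ-take-drop : ∀ {A : Set} (L : List A) w k l (F : Vec A k → Vec A l → ℚ) →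
  𝔼ⁿ L w (k ℕ.+ l) (λ v → F (Vec.take k v) (Vec.drop k v)) ≡ 𝔼ⁿ L w k (λ xs → 𝔼ⁿ L w l (F xs))
𝔼ⁿ-take-drop L w zero    l F = sym (trans (+-identityʳ _) (*-identityˡ _))
𝔼ⁿ-take-drop L w (suc k) l F = trans (𝔼ⁿ-suc L w (k ℕ.+ l) _)
  (trans (𝔼-cong L w (λ a → 𝔼ⁿ-take-drop L w k l (λ xs → F (a ∷ xs)))) (sym (𝔼ⁿ-suc L w k (λ xs → 𝔼ⁿ L w l (F xs)))))

-- Variances of independent samples add up. The constant c absorbs the samples already drawn in the
-- induction; in the applications it is minus a target value, so that the last term is the squared
-- bias.
second-moment : ∀ {A : Set} (L : List A) w → ∑ L w ≡ 1ℚ → ∀ (φ : A → ℚ) k c →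
  𝔼ⁿ L w k (λ xs → (c + tally φ xs) * (c + tally φ xs)) ≡
  fromℕ k * (𝔼 L w (λ a → φ a * φ a) - 𝔼 L w φ * 𝔼 L w φ) + (c + fromℕ k * 𝔼 L w φ) * (c + fromℕ k * 𝔼 L w φ)
second-moment L w one φ zero    c = eq c (𝔼 L w (λ a → φ a * φ a)) (𝔼 L w φ)
  where
  eq : ∀ c σ μ → 1ℚ * ((c + 0ℚ) * (c + 0ℚ)) + 0ℚ ≡ 0ℚ * (σ - μ * μ) + (c + 0ℚ * μ) * (c + 0ℚ * μ)
  eq = solve-∀ ℚ-ring
second-moment L w one φ (suc k) c = begin
  𝔼ⁿ L w (suc k) (λ xs → (c + tally φ xs) * (c + tally φ xs))
    ≡⟨ 𝔼ⁿ-suc L w k _ ⟩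
  𝔼 L w (λ a → 𝔼ⁿ L w k (λ xs → (c + (φ a + tally φ xs)) * (c + (φ a + tally φ xs))))
    ≡⟨ 𝔼-cong L w (λ a → trans (𝔼-cong (vecs L k) (∏ w) (λ xs → cong (λ z → z * z) (sym (+-assoc c (φ a) (tally φ xs)))))
         (trans (second-moment L w one φ k (c + φ a)) (eq₁ (K * v) c (φ a) K μ))) ⟩
  𝔼 L w (λ a → (K * v + (c + K * μ) * (c + K * μ)) + (2ℚ * (c + K * μ) * φ a + φ a * φ a))
    ≡⟨ trans (𝔼-+ L w (λ _ → K * v + (c + K * μ) * (c + K * μ)) (λ a → 2ℚ * (c + K * μ) * φ a + φ a * φ a)) (cong₂ _+_ (𝔼-const L w one _) (trans (𝔼-+ L w (λ a → 2ℚ * (c + K * μ) * φ a) (λ a → φ a * φ a)) (cong (_+ σ) (𝔼-* L w (2ℚ * (c + K * μ)) φ)))) ⟩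
  (K * v + (c + K * μ) * (c + K * μ)) + (2ℚ * (c + K * μ) * μ + σ)
    ≡⟨ eq₂ K c μ σ ⟩
  (1ℚ + K) * v + (c + (1ℚ + K) * μ) * (c + (1ℚ + K) * μ)
    ≡⟨ cong (λ z → z * v + (c + z * μ) * (c + z * μ)) (fromℕ-suc k) ⟨
  fromℕ (suc k) * v + (c + fromℕ (suc k) * μ) * (c + fromℕ (suc k) * μ) ∎
  where
  open ≡-Reasoning
  K = fromℕ k
  μ = 𝔼 L w φ
  σ = 𝔼 L w (λ a → φ a * φ a)
  v = σ - μ * μ
  eq₁ : ∀ z c f K μ → z + ((c + f) + K * μ) * ((c + f) + K * μ) ≡ (z + (c + K * μ) * (c + K * μ)) + (2ℚ * (c + K * μ) * f + f * f)
  eq₁ = solve-∀ ℚ-ring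
  eq₂ : ∀ K c μ σ → (K * (σ - μ * μ) + (c + K * μ) * (c + K * μ)) + (2ℚ * (c + K * μ) * μ + σ) ≡
    (1ℚ + K) * (σ - μ * μ) + (c + (1ℚ + K) * μ) * (c + (1ℚ + K) * μ)
  eq₂ = solve-∀ ℚ-ring

-- Searching for a convex hypothesis

does⇒ : ∀ {P : Set} (P? : Dec P) → does P? ≡ true → P
does⇒ (yes p) refl = p

does⇒¬ : ∀ {P : Set} (P? : Dec P) → does P? ≡ false → ¬ P
does⇒¬ (no ¬p) refl = ¬p

∧⇒ : ∀ {a b} → a ∧ b ≡ true → a ≡ true × b ≡ true
∧⇒ {true} {true} refl = refl , refl

glue : ∀ {n} → Subset n → Subset n → Subset n → Subset (suc n)
glue f g h (-𝟏 ∷ x) = f x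
glue f g h (𝟎 ∷ x)  = g x
glue f g h (+𝟏 ∷ x) = h x

subsets : ∀ n → List (Subset n)
subsets zero    = (λ _ → false) ∷ (λ _ → true) ∷ []
subsets (suc n) = concatMap (λ f → concatMap (λ g → List.map (glue f g) (subsets n)) (subsets n)) (subsets n)

-- A membership function is recovered from finitely many candidates only up to pointwise equality,
-- hence `convex-resp`.
subsets-complete : ∀ {n} (S : Subset n) → ∃ λ S′ → S′ ∈ₗ subsets n × (∀ x → S′ x ≡ S x)
subsets-complete {zero} S with S [] in e
... | false = (λ _ → false) , here refl , λ { [] → sym e }
... | true  = (λ _ → true) , there (here refl) , λ { [] → sym e }
subsets-complete {suc n} S
  with subsets-complete (λ x → S (-𝟏 ∷ x)) | subsets-complete (λ x → S (𝟎 ∷ x)) | subsets-complete (λ x → S (+𝟏 ∷ x))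
... | f , f∈ , f≡ | g , g∈ , g≡ | h , h∈ , h≡ = glue f g h ,
  ∈-concatMap⁺ _ (Any.map (λ { refl → ∈-concatMap⁺ (λ g′ → List.map (glue f g′) (subsets n)) (Any.map (λ { refl → ∈-map⁺ (glue f g) h∈ }) g∈) }) f∈) ,
  λ { (-𝟏 ∷ x) → f≡ x ; (𝟎 ∷ x) → g≡ x ; (+𝟏 ∷ x) → h≡ x }

convex-resp : ∀ {n} {S S′ : Subset n} → (∀ x → S′ x ≡ S x) → Convex S → Convex S′
convex-resp {S = S} {S′} e convex x = mk⇔
  (λ x∈ → ∈⇒conv S′ x x∈)
  (λ conv → subst T (sym (e x)) (Equivalence.from (convex x) (record { Conv conv ; point∈S = λ i → subst T (e _) (Conv.point∈S conv i) })))

search : ∀ {A : Set} → (A → Bool) → List A → Maybe A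
search p []       = nothing
search p (a ∷ as) with p a
... | true  = just a
... | false = search p as

search-sound : ∀ {A : Set} (p : A → Bool) as {a} → search p as ≡ just a → p a ≡ true
search-sound p (a ∷ as) e with p a in pa
search-sound p (a ∷ as) refl | true = pa
... | false = search-sound p as e

search-complete : ∀ {A : Set} (p : A → Bool) {as a} → a ∈ₗ as → p a ≡ true → ∃ λ b → search p as ≡ just b
search-complete p {b ∷ as} a∈ pa with p b in pb
... | true = b , refl
search-complete p {b ∷ as} (here refl) pa | false with trans (sym pa) pb
... | ()
search-complete p {b ∷ as} (there a∈) pa | false = search-complete p a∈ pa

label : ∀ {n k} → Subset n → Vec (Point n) k → Vec (Point n × Bool) k
label S = Vec.map (λ x → x , S x)

-- The tester and its errors

module _ {n : ℕ} (d m : ℕ) (ε : ℚ) where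

  -- Squared distance ε/16 from the estimate, times m². By the parallelogram law two sets within it
  -- differ on a share of at most 4 · ε/16 = ε/4 of the points.
  tolerance : ℚ
  tolerance = (fromℕ m * fromℕ m) * (ε * (ℤ.+ 1 ℚ./ 16))

  -- m times an estimate of the projection.
  estimate : Vec (Point n × Bool) m → Point n → ℚ
  estimate xs y = tally (λ (x , b) → 𝟙 b * kernel d x y) xs

  -- m² times the squared distance of g from the estimate. Scaling by m avoids division by the
  -- number of samples.
  discrepancy : Vec (Point n × Bool) m → Subset n → ℚ
  discrepancy xs g = U n (λ y → (- (fromℕ m * 𝟙 (g y)) + estimate xs y) * (- (fromℕ m * 𝟙 (g y)) + estimate xs y))

  fits : Vec (Point n × Bool) m → Subset n → Bool
  fits xs g = does (convex? g) ∧ does (discrepancy xs g ≤? tolerance)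

  disagreements : Subset n → Vec (Point n × Bool) m → ℚ
  disagreements g = tally (λ (y , b) → 𝟙 (b xor g y))

  -- The threshold m ε/2 lies between the mean counts in the two cases: at most m ε/4 if the
  -- hypothesis is within ε/4 of S, and at least m ε if S is ε-far from it.
  verdict : Maybe (Subset n) → Vec (Point n × Bool) m → Bool
  verdict nothing  ys = false
  verdict (just g) ys = does (disagreements g ys ≤? fromℕ m * (ε * ½))

  hypothesis : Vec (Point n × Bool) m → Maybe (Subset n)
  hypothesis xs = search (fits xs) (subsets n)

  tester : SampleBasedAlgorithm n
  tester = record { samples = m ℕ.+ m ; bits = 0 ; accepts = λ _ v → verdict (hypothesis (Vec.take m v)) (Vec.drop m v) }

  private
    X = vecs trits n
    w : Point n → ℚ
    w = ∏ third
    V : (Vec (Point n) m → ℚ) → ℚ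
    V = 𝔼ⁿ X w m
    0≤w : ∀ (xs : Vec (Point n) m) → 0ℚ ≤ ∏ w xs
    0≤w = ∏-nonneg 0≤∏third
    V-mono : ∀ {F G} → (∀ xs → F xs ≤ G xs) → V F ≤ V G
    V-mono {F} {G} = 𝔼-mono (vecs X m) {∏ w} {F} {G} 0≤w
    V-const : ∀ c → V (λ _ → c) ≡ c
    V-const = 𝔼-const (vecs X m) (∏ w) (∑-∏ X w (∑-points n) m)
    K = fromℕ m

  verdictOn : Subset n → Vec (Point n) m → Vec (Point n) m → Bool
  verdictOn S xs ys = verdict (hypothesis (label S xs)) (label S ys)

  -- f is `id` for acceptance and `not` for rejection. The halves of the sample are independent, so
  -- the second can be averaged while the hypothesis is fixed.
  Pr-runs : ∀ (S : Subset n) (f : Bool → Bool) →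
    Pr (SampleBasedAlgorithm.runs tester) (λ run → f (SampleBasedAlgorithm.acceptsOn tester S run)) ≡ V (λ xs → V (λ ys → 𝟙 (f (verdictOn S xs ys))))
  Pr-runs S f = begin
    Pr runs (λ run → f (acceptsOn S run))
      ≡⟨ uniform-ratio runsL (λ (_ , v) → ∏ w v) ((⅓ ^ n) ^ (m ℕ.+ m)) (λ (_ , v) → ∏-const (∏-const (λ _ → refl)) v)
           (trans (∑-map ([] ,_) (vecs X (m ℕ.+ m))) (∑-∏ X w (∑-points n) (m ℕ.+ m)))
           (List⁺.length runs) (ℤ.+ count (λ run → f (acceptsOn S run)) runs) (cong List.length toList-runs) (λ run → f (acceptsOn S run))
           (trans (count-∑ (λ run → f (acceptsOn S run)) (toList runs)) (cong (λ L → ∑ L (λ run → 𝟙 (f (acceptsOn S run)))) toList-runs)) ⟩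
    𝔼 runsL (λ (_ , v) → ∏ w v) (λ run → 𝟙 (f (acceptsOn S run)))
      ≡⟨ ∑-map ([] ,_) (vecs X (m ℕ.+ m)) ⟩
    𝔼ⁿ X w (m ℕ.+ m) (λ v → 𝟙 (f (acceptsOn S ([] , v))))
      ≡⟨ 𝔼-cong (vecs X (m ℕ.+ m)) (∏ w) (λ v → cong₂ (λ xs ys → 𝟙 (f (verdict (hypothesis xs) ys))) (Vec.take-map _ m v) (Vec.drop-map _ m v)) ⟩
    𝔼ⁿ X w (m ℕ.+ m) (λ v → 𝟙 (f (verdictOn S (Vec.take m v) (Vec.drop m v))))
      ≡⟨ 𝔼ⁿ-take-drop X w m m (λ xs ys → 𝟙 (f (verdictOn S xs ys))) ⟩
    V (λ xs → V (λ ys → 𝟙 (f (verdictOn S xs ys)))) ∎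
    where
    open ≡-Reasoning
    open SampleBasedAlgorithm tester using (runs; acceptsOn)
    runsL : List (Vec Bool 0 × Vec (Point n) (m ℕ.+ m))
    runsL = List.map ([] ,_) (vecs X (m ℕ.+ m))
    toList-runs : toList runs ≡ runsL
    toList-runs = trans (toList-concatMap (λ a → List⁺.map (a ,_) (vectors (points n) (m ℕ.+ m))) (bitstrings 0))
      (trans (List.++-identityʳ _) (trans (toList-map ([] ,_) (vectors (points n) (m ℕ.+ m)))
      (cong (List.map ([] ,_)) (trans (toList-vectors≡vecs (points n) (m ℕ.+ m)) (cong (λ L → vecs L (m ℕ.+ m)) (toList-vectors≡vecs _ n))))))

  module _ (0<ε : 0ℚ < ε) (24≤mε : fromℕ 24 ≤ K * ε) where

    private
      0≤K = 0≤fromℕ m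
      0<24 : 0ℚ < fromℕ 24
      0<24 = positive⁻¹ (fromℕ 24)
      0<mε : 0ℚ < K * ε
      0<mε = <-≤-trans 0<24 24≤mε

    error : Subset n → Subset n → ℚ
    error S g = U n (λ x → 𝟙 (S x xor g x))

    0≤error : ∀ S g → 0ℚ ≤ error S g
    0≤error S g = 0≤U n (λ x → 0≤𝟙 (S x xor g x))

    deviation : Subset n → Subset n → Vec (Point n) m → ℚ
    deviation S g ys = (- (K * error S g) + disagreements g (label S ys)) * (- (K * error S g) + disagreements g (label S ys))

    -- The variance of a binomial count is at most its mean.
    V-deviation : ∀ S g → V (deviation S g) ≤ K * error S g
    V-deviation S g = begin
      V (deviation S g)
        ≡⟨ 𝔼-cong (vecs X m) (∏ w) (λ ys → cong (λ z → (- (K * error S g) + z) * (- (K * error S g) + z)) (tally-map _ (λ x → x , S x) ys)) ⟩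
      V (λ ys → (- (K * error S g) + tally φ ys) * (- (K * error S g) + tally φ ys))
        ≡⟨ second-moment X w (∑-points n) φ m (- (K * error S g)) ⟩
      K * (U n (λ a → φ a * φ a) - error S g * error S g) + (- (K * error S g) + K * error S g) * (- (K * error S g) + K * error S g)
        ≡⟨ cong (λ z → K * (z - error S g * error S g) + (- (K * error S g) + K * error S g) * (- (K * error S g) + K * error S g)) (U-cong n (λ x → 𝟙² (S x xor g x))) ⟩
      K * (error S g - error S g * error S g) + (- (K * error S g) + K * error S g) * (- (K * error S g) + K * error S g)
        ≤⟨ 0≤q-p⇒p≤q (≤-trans (0≤* 0≤K (0≤p² (error S g))) (≤-reflexive (eq K (error S g)))) ⟩
      K * error S g ∎
      where
      open ≤-Reasoning
      φ : Point n → ℚ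
      φ x = 𝟙 (S x xor g x)
      eq : ∀ k e → k * (e * e) ≡ k * e - (k * (e - e * e) + (- (k * e) + k * e) * (- (k * e) + k * e))
      eq = solve-∀ ℚ-ring

    -- A convex set may be lost in the estimate or in the final comparison; 1/6 for each leaves 2/3.
    sixth : ℚ
    sixth = ℤ.+ 1 ℚ./ 6

    -- The origin of 24: Chebyshev's inequality will bound the failure probability by 4 / t.
    sixth-bound : ∀ {t p} → fromℕ 24 ≤ t → 0ℚ ≤ p → t * (t * p) ≤ t * fromℕ 4 → p ≤ sixth
    sixth-bound {t} {p} 24≤t 0≤p tp = *-cancelˡ-≤-pos (fromℕ 24) (≤-trans (*-monoʳ-≤ 0≤p 24≤t)
      (*-cancelˡ-≤-pos t {{positive (<-≤-trans 0<24 24≤t)}} tp))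

    deviation-bound : ∀ S g (e : Vec (Point n) m → Bool) t → fromℕ 24 ≤ t → K * error S g ≤ t →
      (∀ ys → (t * t) * 𝟙 (e ys) ≤ fromℕ 4 * deviation S g ys) → V (λ ys → 𝟙 (e ys)) ≤ sixth
    deviation-bound S g e t 24≤t s≤t far = sixth-bound 24≤t (0≤𝔼 (vecs X m) {∏ w} 0≤w (λ ys → 0≤𝟙 (e ys))) (begin
      t * (t * V (λ ys → 𝟙 (e ys)))          ≡⟨ *-assoc t t _ ⟨
      (t * t) * V (λ ys → 𝟙 (e ys))          ≡⟨ 𝔼-* (vecs X m) (∏ w) (t * t) _ ⟨
      V (λ ys → (t * t) * 𝟙 (e ys))          ≤⟨ V-mono far ⟩
      V (λ ys → fromℕ 4 * deviation S g ys)  ≡⟨ 𝔼-* (vecs X m) (∏ w) (fromℕ 4) _ ⟩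
      fromℕ 4 * V (deviation S g)            ≤⟨ *-monoˡ-≤ (0≤fromℕ 4) (≤-trans (V-deviation S g) s≤t) ⟩
      fromℕ 4 * t                            ≡⟨ *-comm (fromℕ 4) t ⟩
      t * fromℕ 4                            ∎)
      where open ≤-Reasoning

    square-mono : ∀ {p q} → 0ℚ ≤ p → p ≤ q → p * p ≤ q * q
    square-mono 0≤p p≤q = *-mono-≤-nonNeg 0≤p (≤-trans 0≤p p≤q) p≤q p≤q

    -- Acceptance requires a count of at most m ε/2, hence a deviation from the mean s of at least
    -- s/2.
    far-rejected : ∀ S g → ε ≤ error S g → V (λ ys → 𝟙 (verdict (just g) (label S ys))) ≤ sixth
    far-rejected S g ε≤ = deviation-bound S g (λ ys → verdict (just g) (label S ys)) s (≤-trans 24≤mε mε≤s) ≤-refl far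
      where
      s = K * error S g
      mε≤s : K * ε ≤ s
      mε≤s = *-monoˡ-≤ 0≤K ε≤
      0≤s : 0ℚ ≤ s
      0≤s = 0≤* 0≤K (0≤error S g)
      eq : ∀ s → fromℕ 4 * ((½ * s) * (½ * s)) ≡ (s * s) * 1ℚ
      eq = solve-∀ ℚ-ring
      eq′ : ∀ s x → fromℕ 4 * ((s - x) * (s - x)) ≡ fromℕ 4 * ((- s + x) * (- s + x))
      eq′ = solve-∀ ℚ-ring
      eq″ : ∀ s → ½ * s ≡ s - ½ * s
      eq″ = solve-∀ ℚ-ring
      eq‴ : ∀ k e → k * (e * ½) ≡ ½ * (k * e)
      eq‴ = solve-∀ ℚ-ring
      far : ∀ ys → (s * s) * 𝟙 (verdict (just g) (label S ys)) ≤ fromℕ 4 * deviation S g ys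
      far ys = bound (does few?) refl
        where
        few? = disagreements g (label S ys) ≤? K * (ε * ½)
        bound : ∀ b → does few? ≡ b → (s * s) * 𝟙 b ≤ fromℕ 4 * deviation S g ys
        bound false _ = ≤-trans (≤-reflexive (*-zeroʳ (s * s))) (0≤* (0≤fromℕ 4) (0≤p² (- s + disagreements g (label S ys))))
        bound true e = ≤-trans (≤-reflexive (sym (eq s))) (≤-trans (*-monoˡ-≤ (0≤fromℕ 4) (square-mono (0≤* (nonNegative⁻¹ ½) 0≤s)
            (≤-trans (≤-reflexive (eq″ s)) (+-monoʳ-≤ s (neg-antimono-≤ (≤-trans (does⇒ few? e) (≤-trans (≤-reflexive (eq‴ K ε)) (*-monoˡ-≤ (nonNegative⁻¹ ½) mε≤s))))))))
            (≤-reflexive (eq′ s (disagreements g (label S ys)))))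

    -- The mean is at most m ε/4 and rejection requires a count above m ε/2, hence a deviation of at
    -- least m ε/4.
    near-accepted : ∀ S g → fromℕ 4 * error S g ≤ ε → V (λ ys → 𝟙 (not (verdict (just g) (label S ys)))) ≤ sixth
    near-accepted S g near = *-cancelˡ-≤-pos (fromℕ 24) (≤-trans (*-monoʳ-≤ (0≤𝔼 (vecs X m) {∏ w} 0≤w (λ ys → 0≤𝟙 (e ys))) 24≤mε) (*-cancelˡ-≤-pos t {{positive 0<mε}} (begin
      t * (t * V (λ ys → 𝟙 (e ys)))           ≡⟨ *-assoc t t _ ⟨
      (t * t) * V (λ ys → 𝟙 (e ys))           ≡⟨ 𝔼-* (vecs X m) (∏ w) (t * t) _ ⟨
      V (λ ys → (t * t) * 𝟙 (e ys))           ≤⟨ V-mono far ⟩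
      V (λ ys → fromℕ 16 * deviation S g ys)  ≡⟨ 𝔼-* (vecs X m) (∏ w) (fromℕ 16) _ ⟩
      fromℕ 16 * V (deviation S g)            ≤⟨ *-monoˡ-≤ (0≤fromℕ 16) (V-deviation S g) ⟩
      fromℕ 16 * (K * error S g)              ≡⟨ eq K (error S g) ⟩
      fromℕ 4 * (fromℕ 4 * (K * error S g))   ≤⟨ *-monoˡ-≤ (0≤fromℕ 4) 4s≤t ⟩
      fromℕ 4 * t                             ≡⟨ *-comm (fromℕ 4) t ⟩
      t * fromℕ 4                             ∎)))
      where
      open ≤-Reasoning
      t = K * ε
      s = K * error S g
      e : Vec (Point n) m → Bool
      e ys = not (verdict (just g) (label S ys))
      eq : ∀ k x → fromℕ 16 * (k * x) ≡ fromℕ 4 * (fromℕ 4 * (k * x))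
      eq = solve-∀ ℚ-ring
      4s≤t : fromℕ 4 * s ≤ t
      4s≤t = ≤-trans (≤-reflexive (eq₀ K (error S g))) (*-monoˡ-≤ 0≤K near)
        where
        eq₀ : ∀ k x → fromℕ 4 * (k * x) ≡ k * (fromℕ 4 * x)
        eq₀ = solve-∀ ℚ-ring
      ¼ = ½ * ½
      eq₁ : ∀ t → fromℕ 16 * ((¼ * t) * (¼ * t)) ≡ (t * t) * 1ℚ
      eq₁ = solve-∀ ℚ-ring
      eq₂ : ∀ k e → ¼ * (k * e) ≡ k * (e * ½) - ¼ * (k * e)
      eq₂ = solve-∀ ℚ-ring
      eq₃ : ∀ s x → x - ¼ * (fromℕ 4 * s) ≡ - s + x
      eq₃ = solve-∀ ℚ-ring
      far : ∀ ys → (t * t) * 𝟙 (e ys) ≤ fromℕ 16 * deviation S g ys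
      far ys = bound (does few?) refl
        where
        few? = disagreements g (label S ys) ≤? K * (ε * ½)
        bound : ∀ b → does few? ≡ b → (t * t) * 𝟙 (not b) ≤ fromℕ 16 * deviation S g ys
        bound true _ = ≤-trans (≤-reflexive (*-zeroʳ (t * t))) (0≤* (0≤fromℕ 16) (0≤p² (- s + disagreements g (label S ys))))
        bound false e = ≤-trans (≤-reflexive (sym (eq₁ t))) (*-monoˡ-≤ (0≤fromℕ 16) (square-mono (0≤* (nonNegative⁻¹ ¼) (<⇒≤ 0<mε))
            (≤-trans (≤-reflexive (eq₂ K ε)) (≤-trans (+-mono-≤ (<⇒≤ (≰⇒> (does⇒¬ few? e))) (neg-antimono-≤ (*-monoˡ-≤ (nonNegative⁻¹ ¼) 4s≤t)))
              (≤-reflexive (eq₃ s (disagreements g (label S ys))))))))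

    -- Whatever the first half of the sample suggests, a hypothesis is convex and therefore ε-far
    -- from S, so the second half alone decides.
    rejects : ∀ S → FarFromConvex ε S → ℤ.+ 2 ℚ./ 3 ≤ Pr-reject tester S
    rejects S far = begin
      ℤ.+ 2 ℚ./ 3
        ≤⟨ nonNeg-gap ⟩
      1ℚ + - 1ℚ * sixth
        ≡⟨ V-const _ ⟨
      V (λ xs → 1ℚ + - 1ℚ * sixth)
        ≤⟨ V-mono (λ xs → ≤-trans (+-monoʳ-≤ 1ℚ (≤-trans (≤-reflexive (neg sixth)) (≤-trans (neg-antimono-≤ (accepted xs)) (≤-reflexive (sym (neg _))))))
             (≤-reflexive (sym (complement xs)))) ⟩
      V (λ xs → V (λ ys → 𝟙 (not (verdictOn S xs ys))))
        ≡⟨ Pr-runs S not ⟨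
      Pr-reject tester S ∎
      where
      open ≤-Reasoning
      nonNeg-gap : ℤ.+ 2 ℚ./ 3 ≤ 1ℚ + - 1ℚ * sixth
      nonNeg-gap = 0≤q-p⇒p≤q (nonNegative⁻¹ (ℤ.+ 1 ℚ./ 6))
      neg : ∀ x → - 1ℚ * x ≡ - x
      neg = solve-∀ ℚ-ring
      complement : ∀ xs → V (λ ys → 𝟙 (not (verdictOn S xs ys))) ≡ 1ℚ + - 1ℚ * V (λ ys → 𝟙 (verdictOn S xs ys))
      complement xs = trans (𝔼-cong (vecs X m) (∏ w) (λ ys → trans (𝟙-not (verdictOn S xs ys)) (cong (1ℚ +_) (sym (neg (𝟙 (verdictOn S xs ys)))))))
        (trans (𝔼-+ (vecs X m) (∏ w) _ _) (cong₂ _+_ (V-const 1ℚ) (𝔼-* (vecs X m) (∏ w) (- 1ℚ) _)))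
      accepted : ∀ xs → V (λ ys → 𝟙 (verdictOn S xs ys)) ≤ sixth
      accepted xs with hypothesis (label S xs) in e
      ... | nothing = ≤-trans (≤-reflexive (V-const 0ℚ)) (nonNegative⁻¹ sixth)
      ... | just g  = far-rejected S g (≤-trans (far g (convex g (search-sound (fits (label S xs)) (subsets n) e))) (≤-reflexive (dist-U S g)))
        where
        convex : ∀ g → fits (label S xs) g ≡ true → Convex g
        convex g e = does⇒ (convex? g) (proj₁ (∧⇒ e))

    module _ (tail-small : ∀ (S : Subset n) → Convex S → fromℕ 192 * tail d (λ x → 𝟙 (S x)) ≤ ε) (dimension-small : fromℕ 192 * dimension n d ≤ K * ε) where

      private
        0<K : 0ℚ < K
        0<K = ≰⇒> λ K≤0 → <-irrefl refl (<-≤-trans 0<mε (≤-trans (*-monoʳ-≤ (<⇒≤ 0<ε) K≤0) (≤-reflexive (*-zeroˡ ε))))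
        0<tolerance : 0ℚ < tolerance
        0<tolerance = positive⁻¹ _ {{pos*pos⇒pos (K * K) {{pos*pos⇒pos K {{positive 0<K}} K {{positive 0<K}}}} (ε * (ℤ.+ 1 ℚ./ 16)) {{pos*pos⇒pos ε {{positive 0<ε}} (ℤ.+ 1 ℚ./ 16)}}}}

      -- At y the estimate has mean m P y, with P the projection, and its variance is at most m
      -- times the mean square of the kernel. Averaged over y, variance and squared bias become m
      -- `dimension` and m² `tail`. The constant is 192 = 2 · 16 · 6: two terms, the 16 of
      -- `tolerance`, and Markov's inequality at probability 1/6.
      estimation-error : ∀ S → Convex S → V (λ xs → discrepancy (label S xs) S) ≤ tolerance * sixth
      estimation-error S convex = begin
        V (λ xs → discrepancy (label S xs) S)
          ≡⟨ 𝔼-swap (vecs X m) (∏ w) X w (λ xs y → (- (K * f y) + estimate (label S xs) y) * (- (K * f y) + estimate (label S xs) y)) ⟩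
        U n (λ y → V (λ xs → (- (K * f y) + estimate (label S xs) y) * (- (K * f y) + estimate (label S xs) y)))
          ≡⟨ U-cong n (λ y → trans (𝔼-cong (vecs X m) (∏ w) (λ xs → cong (λ z → (- (K * f y) + z) * (- (K * f y) + z)) (tally-map _ (λ x → x , S x) xs)))
               (second-moment X w (∑-points n) (φ y) m (- (K * f y)))) ⟩
        U n (λ y → K * (U n (λ x → φ y x * φ y x) - P y * P y) + (- (K * f y) + K * P y) * (- (K * f y) + K * P y))
          ≤⟨ 𝔼-mono X 0≤∏third (λ y → ≤-trans (+-monoˡ-≤ ((- (K * f y) + K * P y) * (- (K * f y) + K * P y)) (*-monoˡ-≤ 0≤K (variance y))) (≤-reflexive (eq₁ K _ (f y) (P y)))) ⟩
        U n (λ y → K * U n (λ x → kernel d x y * kernel d x y) + (K * K) * ((P y - f y) * (P y - f y)))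
          ≡⟨ trans (U-+ n _ _) (cong₂ _+_ (U-* n K _) (U-* n (K * K) _)) ⟩
        K * dimension n d + (K * K) * tail d f
          ≡⟨ eq₂ K (dimension n d) (tail d f) ⟩
        (ℤ.+ 1 ℚ./ 192) * (K * (fromℕ 192 * dimension n d) + (K * K) * (fromℕ 192 * tail d f))
          ≤⟨ *-monoˡ-≤ (nonNegative⁻¹ (ℤ.+ 1 ℚ./ 192)) (+-mono-≤ (*-monoˡ-≤ 0≤K dimension-small) (*-monoˡ-≤ (0≤* 0≤K 0≤K) (tail-small S convex))) ⟩
        (ℤ.+ 1 ℚ./ 192) * (K * (K * ε) + (K * K) * ε)
          ≡⟨ eq₃ K ε ⟩
        tolerance * sixth ∎
        where
        open ≤-Reasoning
        f : Point n → ℚ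
        f x = 𝟙 (S x)
        φ : Point n → Point n → ℚ
        φ y x = 𝟙 (S x) * kernel d x y
        P : Point n → ℚ
        P = project d f
        eq₁ : ∀ k v f p → k * v + (- (k * f) + k * p) * (- (k * f) + k * p) ≡ k * v + (k * k) * ((p - f) * (p - f))
        eq₁ = solve-∀ ℚ-ring
        eq₂ : ∀ k d t → k * d + (k * k) * t ≡ (ℤ.+ 1 ℚ./ 192) * (k * (fromℕ 192 * d) + (k * k) * (fromℕ 192 * t))
        eq₂ = solve-∀ ℚ-ring
        eq₃ : ∀ k e → (ℤ.+ 1 ℚ./ 192) * (k * (k * e) + (k * k) * e) ≡ ((k * k) * (e * (ℤ.+ 1 ℚ./ 16))) * (ℤ.+ 1 ℚ./ 6)
        eq₃ = solve-∀ ℚ-ring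
        indicator-square : ∀ b k → (𝟙 b * k) * (𝟙 b * k) ≤ k * k
        indicator-square true  k = ≤-reflexive (cong₂ _*_ (*-identityˡ k) (*-identityˡ k))
        indicator-square false k = ≤-trans (≤-reflexive (trans (cong₂ _*_ (*-zeroˡ k) (*-zeroˡ k)) (*-zeroˡ 0ℚ))) (0≤p² k)
        variance : ∀ y → U n (λ x → φ y x * φ y x) - P y * P y ≤ U n (λ x → kernel d x y * kernel d x y)
        variance y = ≤-trans (+-mono-≤ (𝔼-mono X 0≤∏third (λ x → indicator-square (S x) (kernel d x y))) (neg-antimono-≤ (0≤p² (P y))))
          (≤-reflexive (+-identityʳ _))

      -- The squared distance of S and g is at most twice the sum of their squared distances from
      -- the estimate.
      fits⇒near : ∀ S xs g → discrepancy xs S ≤ tolerance → discrepancy xs g ≤ tolerance → fromℕ 4 * error S g ≤ ε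
      fits⇒near S xs g S-fits g-fits = *-cancelˡ-≤-pos (K * K) {{pos*pos⇒pos K {{positive 0<K}} K {{positive 0<K}}}} (begin
        (K * K) * (fromℕ 4 * error S g)
          ≡⟨ eq₁ (K * K) (error S g) ⟩
        fromℕ 4 * ((K * K) * error S g)
          ≡⟨ cong (fromℕ 4 *_) (U-* n (K * K) _) ⟨
        fromℕ 4 * U n (λ x → (K * K) * 𝟙 (S x xor g x))
          ≤⟨ *-monoˡ-≤ (0≤fromℕ 4) (𝔼-mono X 0≤∏third (λ y → triangle (S y) (g y) (estimate xs y))) ⟩
        fromℕ 4 * U n (λ y → 2ℚ * ((- (K * 𝟙 (S y)) + estimate xs y) * (- (K * 𝟙 (S y)) + estimate xs y)) + 2ℚ * ((- (K * 𝟙 (g y)) + estimate xs y) * (- (K * 𝟙 (g y)) + estimate xs y)))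
          ≡⟨ cong (fromℕ 4 *_) (trans (U-+ n _ _) (cong₂ _+_ (U-* n 2ℚ _) (U-* n 2ℚ _))) ⟩
        fromℕ 4 * (2ℚ * discrepancy xs S + 2ℚ * discrepancy xs g)
          ≤⟨ *-monoˡ-≤ (0≤fromℕ 4) (+-mono-≤ (*-monoˡ-≤ (nonNegative⁻¹ 2ℚ) S-fits) (*-monoˡ-≤ (nonNegative⁻¹ 2ℚ) g-fits)) ⟩
        fromℕ 4 * (2ℚ * tolerance + 2ℚ * tolerance)
          ≡⟨ eq₂ (K * K) ε ⟩
        (K * K) * ε ∎)
        where
        open ≤-Reasoning
        eq₁ : ∀ k e → k * (fromℕ 4 * e) ≡ fromℕ 4 * (k * e)
        eq₁ = solve-∀ ℚ-ring
        eq₂ : ∀ k e → fromℕ 4 * (2ℚ * (k * (e * (ℤ.+ 1 ℚ./ 16))) + 2ℚ * (k * (e * (ℤ.+ 1 ℚ./ 16)))) ≡ k * e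
        eq₂ = solve-∀ ℚ-ring
        xor-square : ∀ a b → 𝟙 (a xor b) ≡ (𝟙 a - 𝟙 b) * (𝟙 a - 𝟙 b)
        xor-square true  true  = refl
        xor-square true  false = refl
        xor-square false true  = refl
        xor-square false false = refl
        parallelogram : ∀ k a b z → (- (k * a) + z + (- (k * b) + z)) * (- (k * a) + z + (- (k * b) + z)) ≡
          2ℚ * ((- (k * a) + z) * (- (k * a) + z)) + 2ℚ * ((- (k * b) + z) * (- (k * b) + z)) - (k * k) * ((a - b) * (a - b))
        parallelogram = solve-∀ ℚ-ring
        triangle : ∀ a b z → (K * K) * 𝟙 (a xor b) ≤ 2ℚ * ((- (K * 𝟙 a) + z) * (- (K * 𝟙 a) + z)) + 2ℚ * ((- (K * 𝟙 b) + z) * (- (K * 𝟙 b) + z))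
        triangle a b z = ≤-trans (≤-reflexive (cong ((K * K) *_) (xor-square a b)))
          (0≤q-p⇒p≤q (≤-trans (0≤p² (- (K * 𝟙 a) + z + (- (K * 𝟙 b) + z))) (≤-reflexive (parallelogram K (𝟙 a) (𝟙 b) z))))

      -- With a good estimate a copy of S fits, so the search succeeds. It may return another convex
      -- set, but any set that fits is within ε/4 of S.
      accepts : ∀ S → Convex S → ℤ.+ 2 ℚ./ 3 ≤ Pr-accept tester S
      accepts S convex = begin
        ℤ.+ 2 ℚ./ 3
          ≤⟨ ≤-refl ⟩
        1ℚ + - 1ℚ * (sixth + sixth)
          ≤⟨ +-monoʳ-≤ 1ℚ (≤-trans (≤-reflexive (neg (sixth + sixth))) (≤-trans (neg-antimono-≤ (+-monoˡ-≤ sixth misfit)) (≤-reflexive (sym (neg _))))) ⟩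
        1ℚ + - 1ℚ * (V (λ xs → 𝟙 (bad xs)) + sixth)
          ≡⟨ cong (λ z → 1ℚ + - 1ℚ * z) (trans (𝔼-+ (vecs X m) (∏ w) _ _) (cong (V (λ xs → 𝟙 (bad xs)) +_) (V-const sixth))) ⟨
        1ℚ + - 1ℚ * V (λ xs → 𝟙 (bad xs) + sixth)
          ≡⟨ trans (𝔼-+ (vecs X m) (∏ w) _ _) (cong₂ _+_ (V-const 1ℚ) (𝔼-* (vecs X m) (∏ w) (- 1ℚ) _)) ⟨
        V (λ xs → 1ℚ + - 1ℚ * (𝟙 (bad xs) + sixth))
          ≤⟨ V-mono (λ xs → ≤-trans (+-monoʳ-≤ 1ℚ (≤-trans (≤-reflexive (neg _)) (≤-trans (neg-antimono-≤ (rejected xs)) (≤-reflexive (sym (neg _))))))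
               (≤-reflexive (sym (complement xs)))) ⟩
        V (λ xs → V (λ ys → 𝟙 (verdictOn S xs ys)))
          ≡⟨ Pr-runs S id ⟨
        Pr-accept tester S ∎
        where
        open ≤-Reasoning
        neg : ∀ x → - 1ℚ * x ≡ - x
        neg = solve-∀ ℚ-ring
        double-neg : ∀ b → 𝟙 b ≡ 1ℚ + - 1ℚ * 𝟙 (not b)
        double-neg true  = refl
        double-neg false = refl
        complement : ∀ xs → V (λ ys → 𝟙 (verdictOn S xs ys)) ≡ 1ℚ + - 1ℚ * V (λ ys → 𝟙 (not (verdictOn S xs ys)))
        complement xs = trans (𝔼-cong (vecs X m) (∏ w) (λ ys → double-neg (verdictOn S xs ys)))
          (trans (𝔼-+ (vecs X m) (∏ w) _ _) (cong₂ _+_ (V-const 1ℚ) (𝔼-* (vecs X m) (∏ w) (- 1ℚ) _)))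
        bad : Vec (Point n) m → Bool
        bad xs = not (does (discrepancy (label S xs) S ≤? tolerance))
        misfit : V (λ xs → 𝟙 (bad xs)) ≤ sixth
        misfit = *-cancelˡ-≤-pos tolerance {{positive 0<tolerance}} (≤-trans (≤-reflexive (sym (𝔼-* (vecs X m) (∏ w) tolerance _)))
          (≤-trans (V-mono markov) (estimation-error S convex)))
          where
          markov : ∀ xs → tolerance * 𝟙 (bad xs) ≤ discrepancy (label S xs) S
          markov xs = bound (does fit?) refl
            where
            fit? = discrepancy (label S xs) S ≤? tolerance
            bound : ∀ b → does fit? ≡ b → tolerance * 𝟙 (not b) ≤ discrepancy (label S xs) S
            bound true _ = ≤-trans (≤-reflexive (*-zeroʳ tolerance)) (0≤U n (λ y → 0≤p² (- (K * 𝟙 (S y)) + estimate (label S xs) y)))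
            bound false e = ≤-trans (≤-reflexive (*-identityʳ tolerance)) (<⇒≤ (≰⇒> (does⇒¬ fit? e)))
        fitted : ∀ xs → discrepancy (label S xs) S ≤ tolerance → V (λ ys → 𝟙 (not (verdictOn S xs ys))) ≤ 0ℚ + sixth
        rejected : ∀ xs → V (λ ys → 𝟙 (not (verdictOn S xs ys))) ≤ 𝟙 (bad xs) + sixth
        rejected xs = bound (does fit?) refl
          where
          fit? = discrepancy (label S xs) S ≤? tolerance
          bound : ∀ b → does fit? ≡ b → V (λ ys → 𝟙 (not (verdictOn S xs ys))) ≤ 𝟙 (not b) + sixth
          bound false _ = ≤-trans (≤-trans (V-mono (λ ys → 𝟙≤1 (not (verdictOn S xs ys)))) (≤-reflexive (V-const 1ℚ)))
            (≤-trans (≤-reflexive (sym (+-identityʳ 1ℚ))) (+-monoʳ-≤ 1ℚ (nonNegative⁻¹ sixth)))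
          bound true e = fitted xs (does⇒ fit? e)
        fitted xs S-fits = ≤-trans (found (search-complete (fits (label S xs)) S′∈ S′-fits)) (≤-reflexive (sym (+-identityˡ sixth)))
          where
          S′ = proj₁ (subsets-complete S)
          S′∈ = proj₁ (proj₂ (subsets-complete S))
          S′≡S = proj₂ (proj₂ (subsets-complete S))
          S′-discrepancy : discrepancy (label S xs) S′ ≤ tolerance
          S′-discrepancy = ≤-trans (≤-reflexive (U-cong n (λ y → cong (λ b → (- (K * 𝟙 b) + estimate (label S xs) y) * (- (K * 𝟙 b) + estimate (label S xs) y)) (S′≡S y)))) S-fits
          S′-fits : fits (label S xs) S′ ≡ true
          S′-fits = cong₂ _∧_ (dec-true (convex? S′) (convex-resp S′≡S convex)) (dec-true (discrepancy (label S xs) S′ ≤? tolerance) S′-discrepancy)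
          fits⇒discrepancy : ∀ g → fits (label S xs) g ≡ true → discrepancy (label S xs) g ≤ tolerance
          fits⇒discrepancy g e = does⇒ (discrepancy (label S xs) g ≤? tolerance) (proj₂ (∧⇒ e))
          found : (∃ λ g → hypothesis (label S xs) ≡ just g) → V (λ ys → 𝟙 (not (verdictOn S xs ys))) ≤ sixth
          found (g , e) = ≤-trans (≤-reflexive (𝔼-cong (vecs X m) (∏ w) (λ ys → cong (λ h → 𝟙 (not (verdict h (label S ys)))) e)))
            (near-accepted S g (fits⇒near S (label S xs) g S-fits (fits⇒discrepancy g (search-sound (fits (label S xs)) (subsets n) e))))

      tester-correct : IsConvexityTester ε tester
      tester-correct = record { accepts-convex = accepts ; rejects-far = rejects }

-- Estimates of powers

^-+ : ∀ (x : ℚ) m n → x ^ (m ℕ.+ n) ≡ x ^ m * x ^ n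
^-+ x zero    n = sym (*-identityˡ (x ^ n))
^-+ x (suc m) n = trans (cong (x *_) (^-+ x m n)) (sym (*-assoc x (x ^ m) (x ^ n)))

^-distrib-* : ∀ x y n → (x * y) ^ n ≡ x ^ n * y ^ n
^-distrib-* x y zero    = sym (*-identityˡ 1ℚ)
^-distrib-* x y (suc n) = trans (cong ((x * y) *_) (^-distrib-* x y n)) (eq x y (x ^ n) (y ^ n))
  where
  eq : ∀ a b c d → (a * b) * (c * d) ≡ (a * c) * (b * d)
  eq = solve-∀ ℚ-ring

ℕ-^-distrib-* : ∀ k m n → (m ℕ.* n) ℕ.^ k ≡ m ℕ.^ k ℕ.* n ℕ.^ k
ℕ-^-distrib-* zero    m n = refl
ℕ-^-distrib-* (suc k) m n = trans (cong (m ℕ.* n ℕ.*_) (ℕ-^-distrib-* k m n)) (ℕ.[m*n]*[o*p]≡[m*o]*[n*p] m n (m ℕ.^ k) (n ℕ.^ k))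

^-mono : ∀ {x y} n → 0ℚ ≤ x → x ≤ y → x ^ n ≤ y ^ n
^-mono zero    0≤x x≤y = ≤-refl
^-mono (suc n) 0≤x x≤y = *-mono-≤-nonNeg 0≤x (0≤^ n (≤-trans 0≤x x≤y)) x≤y (^-mono n 0≤x x≤y)

^-≤1 : ∀ {x} n → 0ℚ ≤ x → x ≤ 1ℚ → x ^ n ≤ 1ℚ
^-≤1 zero    0≤x x≤1 = ≤-refl
^-≤1 (suc n) 0≤x x≤1 = *-mono-≤-nonNeg 0≤x 0≤1 x≤1 (^-≤1 n 0≤x x≤1)

fromℕ-^ : ∀ m n → fromℕ (m ℕ.^ n) ≡ fromℕ m ^ n
fromℕ-^ m zero    = refl
fromℕ-^ m (suc n) = trans (fromℕ-* m (m ℕ.^ n)) (cong (fromℕ m *_) (fromℕ-^ m n))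

reciprocal-powers : ∀ y n → 0ℚ ≤ y → y ≤ 1ℚ → (1ℚ - y) ^ n * (1ℚ + y) ^ n ≤ 1ℚ
reciprocal-powers y n 0≤y y≤1 = ≤-trans (≤-reflexive (sym (^-distrib-* (1ℚ - y) (1ℚ + y) n)))
  (^-≤1 n (0≤* (p≤q⇒0≤q-p y≤1) (0≤+ 0≤1 0≤y)) (0≤q-p⇒p≤q (≤-trans (0≤p² y) (≤-reflexive (eq y)))))
  where
  eq : ∀ y → y * y ≡ 1ℚ - (1ℚ - y) * (1ℚ + y)
  eq = solve-∀ ℚ-ring

bernoulli⁺ : ∀ y n → 0ℚ ≤ y → 1ℚ + fromℕ n * y ≤ (1ℚ + y) ^ n
bernoulli⁺ y zero    0≤y = ≤-reflexive (trans (cong (1ℚ +_) (*-zeroˡ y)) (+-identityʳ 1ℚ))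
bernoulli⁺ y (suc n) 0≤y = begin
  1ℚ + fromℕ (suc n) * y            ≡⟨ cong (λ z → 1ℚ + z * y) (fromℕ-suc n) ⟩
  1ℚ + (1ℚ + fromℕ n) * y           ≤⟨ 0≤q-p⇒p≤q (≤-trans (0≤* (0≤fromℕ n) (0≤p² y)) (≤-reflexive (eq (fromℕ n) y))) ⟩
  (1ℚ + y) * (1ℚ + fromℕ n * y)     ≤⟨ *-monoˡ-≤ (0≤+ 0≤1 0≤y) (bernoulli⁺ y n 0≤y) ⟩
  (1ℚ + y) * (1ℚ + y) ^ n           ∎
  where
  open ≤-Reasoning
  eq : ∀ n y → n * (y * y) ≡ (1ℚ + y) * (1ℚ + n * y) - (1ℚ + (1ℚ + n) * y)
  eq = solve-∀ ℚ-ring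

reciprocal : ∀ n → ℚ
reciprocal n = (1/ fromℕ (suc n)) {{fromℕ-suc-nonZero n}}

reciprocal-inverse : ∀ n → reciprocal n * fromℕ (suc n) ≡ 1ℚ
reciprocal-inverse n = *-inverseˡ (fromℕ (suc n)) {{fromℕ-suc-nonZero n}}

0≤reciprocal : ∀ n → 0ℚ ≤ reciprocal n
0≤reciprocal n = <⇒≤ (positive⁻¹ (reciprocal n) {{1/pos⇒pos (fromℕ (suc n)) {{positive (0<fromℕ-suc n)}}}})

-- Write D for d + 1. Bernoulli's inequality gives (1 + 1/D)^D ≥ 2, and (1 - 1/D)^D is at most the
-- reciprocal.
power-half : ∀ d → (1ℚ - reciprocal d) ^ suc d ≤ ½
power-half d = *-cancelʳ-≤-pos 2ℚ (begin
  (1ℚ - y) ^ suc d * 2ℚ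
    ≤⟨ *-monoˡ-≤ (0≤^ (suc d) (p≤q⇒0≤q-p y≤1)) (≤-trans (≤-reflexive (cong (1ℚ +_) (trans (sym (reciprocal-inverse d)) (*-comm y (fromℕ (suc d)))))) (bernoulli⁺ y (suc d) (0≤reciprocal d))) ⟩
  (1ℚ - y) ^ suc d * (1ℚ + y) ^ suc d
    ≤⟨ reciprocal-powers y (suc d) (0≤reciprocal d) y≤1 ⟩
  ½ * 2ℚ ∎)
  where
  open ≤-Reasoning
  y = reciprocal d
  y≤1 : y ≤ 1ℚ
  y≤1 = begin
    y                    ≡⟨ *-identityʳ y ⟨
    y * 1ℚ               ≤⟨ *-monoˡ-≤ (0≤reciprocal d) (fromℕ-mono-≤ {1} {suc d} (s≤s z≤n)) ⟩
    y * fromℕ (suc d)    ≡⟨ reciprocal-inverse d ⟩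
    1ℚ                   ∎

-- Compare with 1 / (1 - 2 x)ᴺ.
power-three : ∀ N x → 0ℚ ≤ x → fromℕ 3 * x ≤ 1ℚ → fromℕ N * (fromℕ 3 * x) ≡ 1ℚ → (1ℚ + 2ℚ * x) ^ N ≤ fromℕ 3
power-three N x 0≤x 3x≤1 N3x≡1 = begin
  (1ℚ + y) ^ N                                      ≡⟨ eq₁ ((1ℚ + y) ^ N) ⟩
  fromℕ 3 * (⅓ * (1ℚ + y) ^ N)                      ≤⟨ *-monoˡ-≤ (0≤fromℕ 3) (*-monoʳ-≤ (0≤^ N (0≤+ 0≤1 0≤y)) (≤-trans (≤-reflexive third≡) (bernoulli y N 0≤y y≤1))) ⟩
  fromℕ 3 * ((1ℚ - y) ^ N * (1ℚ + y) ^ N)           ≤⟨ *-monoˡ-≤ (0≤fromℕ 3) (reciprocal-powers y N 0≤y y≤1) ⟩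
  fromℕ 3 * 1ℚ                                      ≡⟨ *-identityʳ (fromℕ 3) ⟩
  fromℕ 3                                           ∎
  where
  open ≤-Reasoning
  y = 2ℚ * x
  0≤y : 0ℚ ≤ y
  0≤y = 0≤* (nonNegative⁻¹ 2ℚ) 0≤x
  y≤1 : y ≤ 1ℚ
  y≤1 = ≤-trans (*-monoʳ-≤ 0≤x (fromℕ-mono-≤ {2} {3} (s≤s (s≤s z≤n)))) 3x≤1
  eq₁ : ∀ z → z ≡ fromℕ 3 * (⅓ * z)
  eq₁ = solve-∀ ℚ-ring
  eq₂ : ∀ n x → 1ℚ - n * (2ℚ * x) ≡ 1ℚ - 2ℚ * ⅓ * (n * (fromℕ 3 * x))
  eq₂ = solve-∀ ℚ-ring
  third≡ : ⅓ ≡ 1ℚ - fromℕ N * y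
  third≡ = sym (trans (eq₂ (fromℕ N) x) (cong (λ z → 1ℚ - 2ℚ * ⅓ * z) N3x≡1))

-- e blocks of N factors cover the n factors, and each block is worth at most 3.
power-block : ∀ a N → 1ℚ ≤ a → a ^ N ≤ fromℕ 3 → ∀ e n → n ℕ.≤ e ℕ.* N → a ^ n ≤ fromℕ (3 ℕ.^ e)
power-block a N 1≤a aᴺ≤3 e n n≤eN = ≤-trans (mono n≤eN) (blocks e)
  where
  0≤a = ≤-trans 0≤1 1≤a
  mono : ∀ {n k} → n ℕ.≤ k → a ^ n ≤ a ^ k
  mono {k = k} z≤n       = 1≤^ k 1≤a
  mono         (s≤s n≤k) = *-monoˡ-≤ 0≤a (mono n≤k)
  blocks : ∀ e → a ^ (e ℕ.* N) ≤ fromℕ (3 ℕ.^ e)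
  blocks zero    = ≤-refl
  blocks (suc e) = begin
    a ^ (N ℕ.+ e ℕ.* N)            ≡⟨ ^-+ a N (e ℕ.* N) ⟩
    a ^ N * a ^ (e ℕ.* N)          ≤⟨ *-mono-≤-nonNeg (0≤^ N 0≤a) (0≤fromℕ (3 ℕ.^ e)) aᴺ≤3 (blocks e) ⟩
    fromℕ 3 * fromℕ (3 ℕ.^ e)      ≡⟨ fromℕ-* 3 (3 ℕ.^ e) ⟨
    fromℕ (3 ℕ.^ suc e)            ∎
    where open ≤-Reasoning

n<3^n : ∀ n → n ℕ.< 3 ℕ.^ n
n<3^n zero    = s≤s z≤n
n<3^n (suc n) = ℕ.≤-trans (s≤s (n<3^n n)) (ℕ.≤-trans (ℕ.+-monoˡ-≤ (3 ℕ.^ n) (ℕ.m^n>0 3 n)) (ℕ.+-monoʳ-≤ (3 ℕ.^ n) (ℕ.m≤m+n (3 ℕ.^ n) _)))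

crossing : ∀ {P : ℕ → Set} → (∀ k → Dec (P k)) → ¬ P 0 → ∀ N → P N → ∃ λ k → ¬ P k × P (suc k)
crossing P? ¬P0 zero    P0 = ⊥-elim (¬P0 P0)
crossing P? ¬P0 (suc N) PN with P? N
... | yes PN′ = crossing P? ¬P0 N PN′
... | no ¬PN  = N , ¬PN , PN

-- The two regimes

dimension-trivial : ∀ n d → dimension n d ≤ fromℕ (3 ℕ.^ n)
dimension-trivial n d = ≤-trans (dimension-bound 1ℚ 1ℚ ≤-refl refl 0≤1 n d)
  (≤-reflexive (trans (cong (_* (1ℚ + 2ℚ * 1ℚ) ^ n) (one d)) (trans (*-identityˡ _) (sym (fromℕ-^ 3 n)))))
  where
  one : ∀ d → 1ℚ ^ d ≡ 1ℚ
  one zero    = refl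
  one (suc d) = trans (*-identityˡ (1ℚ ^ d)) (one d)

-- `dimension-bound` is taken at X = 3^(j + 1). Then X^d ≤ 3^(2 e), and 1 + 2/X, raised to the power
-- 3^j, is at most 3, so that its power n is at most 3^e.
dimension-small-degree : ∀ n j d e → suc j ℕ.* d ℕ.≤ 2 ℕ.* e → n ℕ.≤ e ℕ.* 3 ℕ.^ j → dimension n d ≤ fromℕ (3 ℕ.^ (3 ℕ.* e))
dimension-small-degree n j d e jd≤2e n≤e3ʲ = begin
  dimension n d
    ≤⟨ dimension-bound X x 1≤X xX≡1 0≤x n d ⟩
  X ^ d * (1ℚ + 2ℚ * x) ^ n
    ≤⟨ *-mono-≤-nonNeg (0≤^ d (≤-trans 0≤1 1≤X)) (0≤fromℕ (3 ℕ.^ e)) Xᵈ≤ (power-block (1ℚ + 2ℚ * x) (3 ℕ.^ j) 1≤1+2x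
         (power-three (3 ℕ.^ j) x 0≤x 3x≤1 N3x≡1) e n n≤e3ʲ) ⟩
  fromℕ (3 ℕ.^ (2 ℕ.* e)) * fromℕ (3 ℕ.^ e)
    ≡⟨ trans (sym (fromℕ-* (3 ℕ.^ (2 ℕ.* e)) (3 ℕ.^ e))) (cong fromℕ (trans (sym (ℕ.^-distribˡ-+-* 3 (2 ℕ.* e) e)) (cong (3 ℕ.^_) (ℕ.+-comm (2 ℕ.* e) e)))) ⟩
  fromℕ (3 ℕ.^ (3 ℕ.* e)) ∎
  where
  open ≤-Reasoning
  p = ℕ.pred (3 ℕ.^ suc j)
  suc-p : suc p ≡ 3 ℕ.^ suc j
  suc-p = ℕ.suc-pred (3 ℕ.^ suc j) {{ℕ.m^n≢0 3 (suc j)}}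
  X = fromℕ (3 ℕ.^ suc j)
  x = reciprocal p
  0≤x = 0≤reciprocal p
  xX≡1 : x * X ≡ 1ℚ
  xX≡1 = trans (cong (λ k → x * fromℕ k) (sym suc-p)) (reciprocal-inverse p)
  1≤X : 1ℚ ≤ X
  1≤X = fromℕ-mono-≤ {1} {3 ℕ.^ suc j} (ℕ.m^n>0 3 (suc j))
  1≤1+2x : 1ℚ ≤ 1ℚ + 2ℚ * x
  1≤1+2x = ≤-trans (≤-reflexive (sym (+-identityʳ 1ℚ))) (+-monoʳ-≤ 1ℚ (0≤* (nonNegative⁻¹ 2ℚ) 0≤x))
  eq : ∀ n x → n * (fromℕ 3 * x) ≡ x * (fromℕ 3 * n)
  eq = solve-∀ ℚ-ring
  N3x≡1 : fromℕ (3 ℕ.^ j) * (fromℕ 3 * x) ≡ 1ℚ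
  N3x≡1 = trans (eq (fromℕ (3 ℕ.^ j)) x) (trans (cong (x *_) (sym (fromℕ-* 3 (3 ℕ.^ j)))) xX≡1)
  3x≤1 : fromℕ 3 * x ≤ 1ℚ
  3x≤1 = ≤-trans (≤-trans (≤-reflexive (sym (*-identityˡ (fromℕ 3 * x)))) (*-monoʳ-≤ (0≤* (0≤fromℕ 3) 0≤x) (fromℕ-mono-≤ {1} {3 ℕ.^ j} (ℕ.m^n>0 3 j)))) (≤-reflexive N3x≡1)
  Xᵈ≤ : X ^ d ≤ fromℕ (3 ℕ.^ (2 ℕ.* e))
  Xᵈ≤ = ≤-trans (≤-reflexive (trans (sym (fromℕ-^ (3 ℕ.^ suc j) d)) (cong fromℕ (ℕ.^-*-assoc 3 (suc j) d)))) (fromℕ-mono-≤ (ℕ.^-monoʳ-≤ 3 jd≤2e))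

-- The walk has M = r² steps, and n M² ≤ d² keeps its total drift of order 1/√n. Then c M C ≤ 6 for
-- the probability C of a change and c = `central M`; since c ≥ 1/(2 r), this leaves r C ≤ 12, and
-- the tail is at most 4 C.
tail-small-degree : ∀ {n} (S : Subset n) → Convex S → ∀ r d → 2 ℕ.≤ r → 1 ℕ.≤ n → n ℕ.* (r ℕ.* r) ℕ.* (r ℕ.* r) ℕ.≤ d ℕ.* d →
  fromℕ r * tail d (λ x → 𝟙 (S x)) ≤ fromℕ 48
tail-small-degree {n} S convex (suc (suc r₀)) (suc d₀) 2≤r 1≤n nM²≤d² = begin
  R * tail d (λ x → 𝟙 (S x))
    ≤⟨ *-monoˡ-≤ (0≤fromℕ r) (tail≤changeProbability η 0≤η 12η≤1 S d (≤-trans (≤-reflexive (cong (_^ d) ρ≡)) (power-half d₀))) ⟩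
  R * (4ℚ * C)
    ≡⟨ eq₁ R C ⟩
  4ℚ * (R * C)
    ≤⟨ *-monoˡ-≤ (nonNegative⁻¹ 4ℚ) RC≤12 ⟩
  fromℕ 48 ∎
  where
  open ≤-Reasoning
  r = suc (suc r₀)
  d = suc d₀
  M = r ℕ.* r
  m = ℕ.pred M
  R = fromℕ r
  c = central M
  y = reciprocal d₀
  -- Chosen so that the correlation per coordinate is 1 - 9 η = 1 - 1/d, whose power d is at most ½.
  η = (ℤ.+ 1 ℚ./ 9) * y
  C = changeProbability S η 0ℚ
  0≤η : 0ℚ ≤ η
  0≤η = 0≤* (nonNegative⁻¹ (ℤ.+ 1 ℚ./ 9)) (0≤reciprocal d₀)
  M≤d : M ℕ.≤ d
  M≤d = ℕ.≮⇒≥ λ d<M → ℕ.<-irrefl refl (ℕ.<-≤-trans (ℕ.*-mono-< d<M d<M)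
    (ℕ.≤-trans (ℕ.≤-trans (ℕ.≤-reflexive (cong (ℕ._* M) (sym (ℕ.*-identityˡ M)))) (ℕ.*-monoˡ-≤ M (ℕ.*-monoˡ-≤ M 1≤n))) nM²≤d²))
  2≤d : 2 ℕ.≤ d
  2≤d = ℕ.≤-trans (ℕ.≤-trans 2≤r (ℕ.m≤m*n r r)) M≤d
  yd≡1 : y * fromℕ d ≡ 1ℚ
  yd≡1 = reciprocal-inverse d₀
  2y≤1 : fromℕ 2 * y ≤ 1ℚ
  2y≤1 = ≤-trans (*-monoʳ-≤ (0≤reciprocal d₀) (fromℕ-mono-≤ 2≤d)) (≤-reflexive (trans (*-comm (fromℕ d) y) yd≡1))
  12η≤1 : fromℕ 12 * η ≤ 1ℚ
  12η≤1 = ≤-trans (≤-reflexive (eq₂ y)) (≤-trans (*-monoˡ-≤ (nonNegative⁻¹ (ℤ.+ 2 ℚ./ 3)) 2y≤1) (0≤q-p⇒p≤q (nonNegative⁻¹ (ℤ.+ 1 ℚ./ 3))))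
    where
    eq₂ : ∀ y → fromℕ 12 * ((ℤ.+ 1 ℚ./ 9) * y) ≡ (ℤ.+ 2 ℚ./ 3) * (fromℕ 2 * y)
    eq₂ = solve-∀ ℚ-ring
  ρ≡ : ρ η ≡ 1ℚ - y
  ρ≡ = eq₂ y
    where
    eq₂ : ∀ y → 1ℚ - fromℕ 9 * ((ℤ.+ 1 ℚ./ 9) * y) ≡ 1ℚ - y
    eq₂ = solve-∀ ℚ-ring
  My≤1 : fromℕ M * y ≤ 1ℚ
  My≤1 = ≤-trans (*-monoʳ-≤ (0≤reciprocal d₀) (fromℕ-mono-≤ M≤d)) (≤-reflexive (trans (*-comm (fromℕ d) y) yd≡1))
  9Mη≤1 : fromℕ 9 * (fromℕ M * η) ≤ 1ℚ
  9Mη≤1 = ≤-trans (≤-reflexive (eq₂ (fromℕ M) y)) My≤1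
    where
    eq₂ : ∀ m y → fromℕ 9 * (m * ((ℤ.+ 1 ℚ./ 9) * y)) ≡ m * y
    eq₂ = solve-∀ ℚ-ring
  nM²y²≤1 : fromℕ n * ((fromℕ M * y) * (fromℕ M * y)) ≤ 1ℚ
  nM²y²≤1 = begin
    fromℕ n * ((fromℕ M * y) * (fromℕ M * y))     ≡⟨ eq₂ (fromℕ n) (fromℕ M) y ⟩
    (fromℕ n * fromℕ M * fromℕ M) * (y * y)       ≡⟨ cong (_* (y * y)) (trans (cong (_* fromℕ M) (sym (fromℕ-* n M))) (sym (fromℕ-* (n ℕ.* M) M))) ⟩
    fromℕ (n ℕ.* M ℕ.* M) * (y * y)               ≤⟨ *-monoʳ-≤ (0≤p² y) (fromℕ-mono-≤ nM²≤d²) ⟩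
    fromℕ (d ℕ.* d) * (y * y)                     ≡⟨ cong (_* (y * y)) (fromℕ-* d d) ⟩
    (fromℕ d * fromℕ d) * (y * y)                 ≡⟨ eq₃ (fromℕ d) y ⟩
    (y * fromℕ d) * (y * fromℕ d)                 ≡⟨ cong (λ z → z * z) yd≡1 ⟩
    1ℚ                                            ∎
    where
    eq₂ : ∀ n m y → n * ((m * y) * (m * y)) ≡ (n * m * m) * (y * y)
    eq₂ = solve-∀ ℚ-ring
    eq₃ : ∀ d y → (d * d) * (y * y) ≡ (y * d) * (y * d)
    eq₃ = solve-∀ ℚ-ring
  small : fromℕ n * (fromℕ 48 * ((fromℕ m * η) * (fromℕ m * η))) ≤ 1ℚ
  small = begin
    fromℕ n * (fromℕ 48 * ((fromℕ m * η) * (fromℕ m * η)))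
      ≤⟨ *-monoˡ-≤ (0≤fromℕ n) (*-monoˡ-≤ (0≤fromℕ 48) (*-mono-≤-nonNeg 0≤mη (0≤* (0≤fromℕ M) 0≤η) mη≤Mη mη≤Mη)) ⟩
    fromℕ n * (fromℕ 48 * ((fromℕ M * η) * (fromℕ M * η)))
      ≡⟨ eq₂ (fromℕ n) (fromℕ M) y ⟩
    (ℤ.+ 16 ℚ./ 27) * (fromℕ n * ((fromℕ M * y) * (fromℕ M * y)))
      ≤⟨ *-monoˡ-≤ (nonNegative⁻¹ (ℤ.+ 16 ℚ./ 27)) nM²y²≤1 ⟩
    (ℤ.+ 16 ℚ./ 27) * 1ℚ
      ≤⟨ 0≤q-p⇒p≤q (nonNegative⁻¹ (ℤ.+ 11 ℚ./ 27)) ⟩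
    1ℚ ∎
    where
    eq₂ : ∀ n m y → n * (fromℕ 48 * ((m * ((ℤ.+ 1 ℚ./ 9) * y)) * (m * ((ℤ.+ 1 ℚ./ 9) * y)))) ≡ (ℤ.+ 16 ℚ./ 27) * (n * ((m * y) * (m * y)))
    eq₂ = solve-∀ ℚ-ring
    0≤mη : 0ℚ ≤ fromℕ m * η
    0≤mη = 0≤* (0≤fromℕ m) 0≤η
    mη≤Mη : fromℕ m * η ≤ fromℕ M * η
    mη≤Mη = *-monoʳ-≤ 0≤η (fromℕ-mono-≤ (ℕ.pred[n]≤n {M}))
  cMC≤6 : c * (fromℕ M * C) ≤ fromℕ 6
  cMC≤6 = changeProbability-bound S convex η m 0≤η 12η≤1 9Mη≤1 small
  1≤2Rc : 1ℚ ≤ 2ℚ * R * c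
  -- As M is the square of r, the left side of `central-lower` is a square too, and its root is
  -- taken by comparing squares.
  1≤2Rc = ≮⇒≥ λ z<1 → <-irrefl refl (begin-strict
    1ℚ                                ≤⟨ central-lower m ⟩
    4ℚ * fromℕ M * (c * c)            ≡⟨ cong (λ z → 4ℚ * z * (c * c)) (fromℕ-* r r) ⟩
    4ℚ * (R * R) * (c * c)            ≡⟨ eq₂ R c ⟩
    (2ℚ * R * c) * (2ℚ * R * c)       ≤⟨ *-monoˡ-≤ (0≤* (0≤* (nonNegative⁻¹ 2ℚ) (0≤fromℕ r)) (0≤central M)) (<⇒≤ z<1) ⟩
    (2ℚ * R * c) * 1ℚ                 ≡⟨ *-identityʳ _ ⟩
    2ℚ * R * c                        <⟨ z<1 ⟩
    1ℚ                                ∎)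
    where
    eq₂ : ∀ r c → 4ℚ * (r * r) * (c * c) ≡ (2ℚ * r * c) * (2ℚ * r * c)
    eq₂ = solve-∀ ℚ-ring
  0≤C : 0ℚ ≤ C
  0≤C = 0≤𝔼 (vecs moves n) (∏-nonneg (moveWeight-nonneg η 0ℚ 0≤η 12η≤1 (nonNegative⁻¹ 1ℚ) (nonNegative⁻¹ 1ℚ)))
    (λ v → 0≤𝟙 (S (Vec.map before v) xor S (Vec.map after v)))
  eq₁ : ∀ r c → r * (4ℚ * c) ≡ 4ℚ * (r * c)
  eq₁ = solve-∀ ℚ-ring
  RC≤12 : R * C ≤ fromℕ 12
  RC≤12 = begin
    R * C                             ≡⟨ *-identityʳ (R * C) ⟨
    (R * C) * 1ℚ                      ≤⟨ *-monoˡ-≤ (0≤* (0≤fromℕ r) 0≤C) 1≤2Rc ⟩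
    (R * C) * (2ℚ * R * c)            ≡⟨ eq₂ R C c ⟩
    2ℚ * (c * ((R * R) * C))          ≡⟨ cong (λ z → 2ℚ * (c * (z * C))) (fromℕ-* r r) ⟨
    2ℚ * (c * (fromℕ M * C))          ≤⟨ *-monoˡ-≤ (nonNegative⁻¹ 2ℚ) cMC≤6 ⟩
    fromℕ 12                          ∎
    where
    eq₂ : ∀ r x c → (r * x) * (2ℚ * r * c) ≡ 2ℚ * (c * ((r * r) * x))
    eq₂ = solve-∀ ℚ-ring
tail-small-degree         S convex (suc zero)     _    (s≤s ()) 1≤n _
tail-small-degree {suc n} S convex (suc (suc r₀)) zero 2≤r      1≤n ()

-- The size of the exponents

module _ (a b : ℕ) (ε : ℚ) (0<ε : 0ℚ < ε) (r : ℕ) (1≤r : 1 ℕ.≤ r) (rε≤a : fromℕ r * ε ≤ fromℕ a) where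

  -- The exponents are first compared with n^(3/4) r. Multiplication by r⁴ pairs r with ε, and r ε ≤
  -- a turns r into a/ε.
  exponent-bound : ∀ n k → 2 ℕ.≤ n → k ℕ.^ 4 ℕ.≤ b ℕ.^ 4 ℕ.* (n ℕ.^ 3 ℕ.* r ℕ.^ 4) →
    (fromℕ k * ε) ^ 4 ≤ fromℕ ((a ℕ.* b) ℕ.^ 4 ℕ.* n ℕ.^ 3 ℕ.* ⌊log₂ n ⌋)
  exponent-bound n k 2≤n k⁴≤ = *-cancelʳ-≤-pos (fromℕ (r ℕ.^ 4)) {{positive 0<r⁴}} (begin
    (fromℕ k * ε) ^ 4 * fromℕ (r ℕ.^ 4)
      ≡⟨ cong₂ _*_ (^-distrib-* (fromℕ k) ε 4) (fromℕ-^ r 4) ⟩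
    (fromℕ k ^ 4 * ε ^ 4) * fromℕ r ^ 4
      ≡⟨ trans (*-assoc (fromℕ k ^ 4) (ε ^ 4) (fromℕ r ^ 4)) (cong₂ _*_ (sym (fromℕ-^ k 4)) (trans (*-comm (ε ^ 4) (fromℕ r ^ 4)) (sym (^-distrib-* (fromℕ r) ε 4)))) ⟩
    fromℕ (k ℕ.^ 4) * (fromℕ r * ε) ^ 4
      ≤⟨ *-mono-≤-nonNeg (0≤fromℕ (k ℕ.^ 4)) (0≤^ 4 (0≤fromℕ a)) (fromℕ-mono-≤ k⁴≤) (^-mono 4 (0≤* (0≤fromℕ r) (<⇒≤ 0<ε)) rε≤a) ⟩
    fromℕ (b ℕ.^ 4 ℕ.* (n ℕ.^ 3 ℕ.* r ℕ.^ 4)) * fromℕ a ^ 4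
      ≡⟨ trans (cong (fromℕ (b ℕ.^ 4 ℕ.* (n ℕ.^ 3 ℕ.* r ℕ.^ 4)) *_) (sym (fromℕ-^ a 4))) (sym (fromℕ-* (b ℕ.^ 4 ℕ.* (n ℕ.^ 3 ℕ.* r ℕ.^ 4)) (a ℕ.^ 4))) ⟩
    fromℕ (b ℕ.^ 4 ℕ.* (n ℕ.^ 3 ℕ.* r ℕ.^ 4) ℕ.* a ℕ.^ 4)
      ≡⟨ cong fromℕ (trans (eq (b ℕ.^ 4) (n ℕ.^ 3) (r ℕ.^ 4) (a ℕ.^ 4)) (cong (λ z → z ℕ.* n ℕ.^ 3 ℕ.* 1 ℕ.* r ℕ.^ 4) (sym (ℕ-^-distrib-* 4 a b)))) ⟩
    fromℕ ((a ℕ.* b) ℕ.^ 4 ℕ.* n ℕ.^ 3 ℕ.* 1 ℕ.* r ℕ.^ 4)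
      -- The factor 1 is ⌊log₂ 2⌋, at most ⌊log₂ n⌋.
      ≤⟨ fromℕ-mono-≤ (ℕ.*-monoˡ-≤ (r ℕ.^ 4) (ℕ.*-monoʳ-≤ ((a ℕ.* b) ℕ.^ 4 ℕ.* n ℕ.^ 3) (⌊log₂⌋-mono-≤ 2≤n))) ⟩
    fromℕ ((a ℕ.* b) ℕ.^ 4 ℕ.* n ℕ.^ 3 ℕ.* ⌊log₂ n ⌋ ℕ.* r ℕ.^ 4)
      ≡⟨ fromℕ-* ((a ℕ.* b) ℕ.^ 4 ℕ.* n ℕ.^ 3 ℕ.* ⌊log₂ n ⌋) (r ℕ.^ 4) ⟩
    fromℕ ((a ℕ.* b) ℕ.^ 4 ℕ.* n ℕ.^ 3 ℕ.* ⌊log₂ n ⌋) * fromℕ (r ℕ.^ 4) ∎)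
    where
    open ≤-Reasoning
    0<r⁴ : 0ℚ < fromℕ (r ℕ.^ 4)
    0<r⁴ = <-≤-trans (positive⁻¹ 1ℚ) (fromℕ-mono-≤ {1} (ℕ.m^n>0 r {{ℕ.>-nonZero 1≤r}} 4))
    eq : ∀ b n r a → b ℕ.* (n ℕ.* r) ℕ.* a ≡ a ℕ.* b ℕ.* n ℕ.* 1 ℕ.* r
    eq = ℕ-Solver.solve-∀

-- Two halves of r · 3^q samples. The factor r is absorbed crudely by 3^r, since an exponent r is
-- small beside n^(3/4) r.
samples-bound : ∀ r q → r ℕ.* 3 ℕ.^ q ℕ.+ r ℕ.* 3 ℕ.^ q ℕ.≤ 3 ℕ.^ (q ℕ.+ r ℕ.+ 1)
samples-bound r q = begin
  r ℕ.* Q ℕ.+ r ℕ.* Q          ≡⟨ eq r Q ⟩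
  Q ℕ.* r ℕ.* 2                ≤⟨ ℕ.*-mono-≤ (ℕ.*-monoʳ-≤ Q (ℕ.<⇒≤ (n<3^n r))) (s≤s (s≤s z≤n)) ⟩
  Q ℕ.* 3 ℕ.^ r ℕ.* 3          ≡⟨ trans (cong (ℕ._* 3) (sym (ℕ.^-distribˡ-+-* 3 q r))) (sym (ℕ.^-distribˡ-+-* 3 (q ℕ.+ r) 1)) ⟩
  3 ℕ.^ (q ℕ.+ r ℕ.+ 1)        ∎
  where
  open ℕ.≤-Reasoning
  Q = 3 ℕ.^ q
  eq : ∀ r q → r ℕ.* q ℕ.+ r ℕ.* q ≡ q ℕ.* r ℕ.* 2
  eq = ℕ-Solver.solve-∀

-- For n < r⁴ the exponent n of the full function space is below n^(3/4) r already. The cases tell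
-- which of n and r dominates the sum.
exponent-dense : ∀ b n r → 3 ℕ.≤ b → 1 ℕ.≤ n → n ℕ.< r ℕ.^ 4 → 1 ℕ.≤ r → (n ℕ.+ r ℕ.+ 1) ℕ.^ 4 ℕ.≤ b ℕ.^ 4 ℕ.* (n ℕ.^ 3 ℕ.* r ℕ.^ 4)
exponent-dense b n r 3≤b 1≤n n<r⁴ 1≤r with ℕ.≤-total n r
... | inj₁ n≤r = begin
  (n ℕ.+ r ℕ.+ 1) ℕ.^ 4                ≤⟨ ℕ.^-monoˡ-≤ 4 (ℕ.≤-trans (ℕ.+-mono-≤ (ℕ.+-monoˡ-≤ r n≤r) 1≤r) (3x r)) ⟩
  (b ℕ.* r) ℕ.^ 4                      ≡⟨ ℕ-^-distrib-* 4 b r ⟩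
  b ℕ.^ 4 ℕ.* r ℕ.^ 4                  ≤⟨ ℕ.*-monoʳ-≤ (b ℕ.^ 4) (ℕ.m≤n*m (r ℕ.^ 4) (n ℕ.^ 3) {{ℕ.m^n≢0 n 3 {{ℕ.>-nonZero 1≤n}}}}) ⟩
  b ℕ.^ 4 ℕ.* (n ℕ.^ 3 ℕ.* r ℕ.^ 4)    ∎
  where
  open ℕ.≤-Reasoning
  eq : ∀ x → x ℕ.+ x ℕ.+ x ≡ 3 ℕ.* x
  eq = ℕ-Solver.solve-∀
  3x : ∀ x → x ℕ.+ x ℕ.+ x ℕ.≤ b ℕ.* x
  3x x = ℕ.≤-trans (ℕ.≤-reflexive (eq x)) (ℕ.*-monoˡ-≤ x 3≤b)
... | inj₂ r≤n = begin
  (n ℕ.+ r ℕ.+ 1) ℕ.^ 4                ≤⟨ ℕ.^-monoˡ-≤ 4 (ℕ.≤-trans (ℕ.+-mono-≤ (ℕ.+-monoʳ-≤ n r≤n) 1≤n) (3x n)) ⟩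
  (b ℕ.* n) ℕ.^ 4                      ≡⟨ ℕ-^-distrib-* 4 b n ⟩
  b ℕ.^ 4 ℕ.* n ℕ.^ 4                  ≡⟨ cong (b ℕ.^ 4 ℕ.*_) (ℕ.*-comm n (n ℕ.^ 3)) ⟩
  b ℕ.^ 4 ℕ.* (n ℕ.^ 3 ℕ.* n)          ≤⟨ ℕ.*-monoʳ-≤ (b ℕ.^ 4) (ℕ.*-monoʳ-≤ (n ℕ.^ 3) (ℕ.<⇒≤ n<r⁴)) ⟩
  b ℕ.^ 4 ℕ.* (n ℕ.^ 3 ℕ.* r ℕ.^ 4)    ∎
  where
  open ℕ.≤-Reasoning
  eq : ∀ x → x ℕ.+ x ℕ.+ x ≡ 3 ℕ.* x
  eq = ℕ-Solver.solve-∀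
  3x : ∀ x → x ℕ.+ x ℕ.+ x ℕ.≤ b ℕ.* x
  3x x = ℕ.≤-trans (ℕ.≤-reflexive (eq x)) (ℕ.*-monoˡ-≤ x 3≤b)

-- The sparse regime: with N = 3ʲ, the degree d is about n / N² and the logarithm of the dimension about n / N.
module Sparse (n r j : ℕ) (1≤r : 1 ℕ.≤ r) (lower : (3 ℕ.^ j ℕ.* r) ℕ.^ 4 ℕ.≤ n) where

  N e d : ℕ
  N = 3 ℕ.^ j
  instance
    N≢0 : ℕ.NonZero N
    N≢0 = ℕ.m^n≢0 3 j
  e = suc (n ℕ./ N)
  d = suc (e ℕ./ N)

  private
    divides-up : ∀ k → k ℕ.≤ suc (k ℕ./ N) ℕ.* N
    divides-up k = ℕ.≤-trans (ℕ.≤-reflexive (ℕ.m≡m%n+[m/n]*n k N)) (ℕ.+-monoˡ-≤ (k ℕ./ N ℕ.* N) (ℕ.<⇒≤ (ℕ.m%n<n k N)))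
    divides-down : ∀ k → suc (k ℕ./ N) ℕ.* N ℕ.≤ k ℕ.+ N
    divides-down k = ℕ.≤-trans (ℕ.+-monoʳ-≤ N (ℕ.m/n*n≤m k N)) (ℕ.≤-reflexive (ℕ.+-comm N k))
    x = N ℕ.* r
    1≤x : 1 ℕ.≤ x
    1≤x = ℕ.*-mono-≤ (ℕ.m^n>0 3 j) 1≤r
    open ℕ.≤-Reasoning
    x≤n : x ℕ.≤ n
    x≤n = ℕ.≤-trans (ℕ.m≤m*n x (x ℕ.^ 3) {{ℕ.m^n≢0 x 3 {{ℕ.>-nonZero 1≤x}}}}) lower
    N≤x : N ℕ.≤ x
    N≤x = ℕ.m≤m*n N r {{ℕ.>-nonZero 1≤r}}
    x²≤n : x ℕ.* x ℕ.≤ n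
    x²≤n = ℕ.≤-trans (ℕ.≤-trans (ℕ.m≤m*n (x ℕ.* x) (x ℕ.* x) {{ℕ.>-nonZero (ℕ.*-mono-≤ 1≤x 1≤x)}}) (ℕ.≤-reflexive (eq x))) lower
      where
      eq : ∀ x → x ℕ.* x ℕ.* (x ℕ.* x) ≡ x ℕ.* (x ℕ.* (x ℕ.* (x ℕ.* 1)))
      eq = ℕ-Solver.solve-∀

  n≤eN : n ℕ.≤ e ℕ.* N
  n≤eN = divides-up n

  N≤e : N ℕ.≤ e
  N≤e = ℕ.*-cancelʳ-≤ N e N (ℕ.≤-trans (ℕ.*-mono-≤ N≤x N≤x) (ℕ.≤-trans x²≤n n≤eN))

  1≤n : 1 ℕ.≤ n
  1≤n = ℕ.≤-trans 1≤x x≤n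

  -- A binomial sum of degree d costs a factor log(n/d), of order j, in the exponent. The crude
  -- bound j < 3^j = N absorbs it, because d N is about e.
  degree-exponent : suc j ℕ.* d ℕ.≤ 2 ℕ.* e
  degree-exponent = begin
    suc j ℕ.* d     ≤⟨ ℕ.*-monoˡ-≤ d (n<3^n j) ⟩
    N ℕ.* d         ≡⟨ ℕ.*-comm N d ⟩
    d ℕ.* N         ≤⟨ divides-down e ⟩
    e ℕ.+ N         ≤⟨ ℕ.+-monoʳ-≤ e N≤e ⟩
    e ℕ.+ e         ≡⟨ cong (e ℕ.+_) (ℕ.+-identityʳ e) ⟨
    2 ℕ.* e         ∎

  -- Rounding up twice gives d ≥ n / N², and N⁴ r⁴ ≤ n; hence d² ≥ n² / N⁴ ≥ n r⁴.
  degree-large : n ℕ.* (r ℕ.* r) ℕ.* (r ℕ.* r) ℕ.≤ d ℕ.* d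
  degree-large = ℕ.*-cancelʳ-≤ _ (d ℕ.* d) (N ℕ.^ 4) {{ℕ.m^n≢0 N 4}} (begin
    n ℕ.* (r ℕ.* r) ℕ.* (r ℕ.* r) ℕ.* N ℕ.^ 4     ≡⟨ eq n r N ⟩
    n ℕ.* (N ℕ.* r) ℕ.^ 4                         ≤⟨ ℕ.*-monoʳ-≤ n lower ⟩
    n ℕ.* n                                       ≤⟨ ℕ.*-mono-≤ n≤dN² n≤dN² ⟩
    d ℕ.* N ℕ.* N ℕ.* (d ℕ.* N ℕ.* N)             ≡⟨ eq′ d N ⟩
    d ℕ.* d ℕ.* N ℕ.^ 4                           ∎)
    where
    n≤dN² : n ℕ.≤ d ℕ.* N ℕ.* N
    n≤dN² = ℕ.≤-trans n≤eN (ℕ.*-monoˡ-≤ N (divides-up e))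
    eq : ∀ n r N → n ℕ.* (r ℕ.* r) ℕ.* (r ℕ.* r) ℕ.* (N ℕ.* (N ℕ.* (N ℕ.* (N ℕ.* 1)))) ≡ n ℕ.* ((N ℕ.* r) ℕ.* ((N ℕ.* r) ℕ.* ((N ℕ.* r) ℕ.* ((N ℕ.* r) ℕ.* 1))))
    eq = ℕ-Solver.solve-∀
    eq′ : ∀ d N → d ℕ.* N ℕ.* N ℕ.* (d ℕ.* N ℕ.* N) ≡ d ℕ.* d ℕ.* (N ℕ.* (N ℕ.* (N ℕ.* (N ℕ.* 1))))
    eq′ = ℕ-Solver.solve-∀

  -- Since e N ≤ 2 n, the exponent is at most 8 n / N. The next scale 3 N satisfies n < (3 N r)⁴, so
  -- that 1/N is below 3 r / n^(1/4) and the exponent is O(n^(3/4) r).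
  exponent-sparse : ∀ b c → 10 ℕ.≤ b → 3 ℕ.≤ c → n ℕ.< (3 ℕ.* N ℕ.* r) ℕ.^ 4 →
    (3 ℕ.* e ℕ.+ r ℕ.+ 1) ℕ.^ 4 ℕ.≤ (b ℕ.* c) ℕ.^ 4 ℕ.* (n ℕ.^ 3 ℕ.* r ℕ.^ 4)
  exponent-sparse b c 10≤b 3≤c upper = ℕ.*-cancelʳ-≤ _ _ (N ℕ.^ 4) {{ℕ.m^n≢0 N 4}} (begin
    k ℕ.^ 4 ℕ.* N ℕ.^ 4                                   ≡⟨ ℕ-^-distrib-* 4 k N ⟨
    (k ℕ.* N) ℕ.^ 4                                       ≤⟨ ℕ.^-monoˡ-≤ 4 kN≤bn ⟩
    (b ℕ.* n) ℕ.^ 4                                       ≡⟨ ℕ-^-distrib-* 4 b n ⟩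
    b ℕ.^ 4 ℕ.* (n ℕ.* n ℕ.^ 3)                           ≤⟨ ℕ.*-monoʳ-≤ (b ℕ.^ 4) (ℕ.*-monoˡ-≤ (n ℕ.^ 3) (ℕ.≤-trans (ℕ.<⇒≤ upper)
                                                               (ℕ.^-monoˡ-≤ 4 (ℕ.*-monoˡ-≤ r (ℕ.*-monoˡ-≤ N 3≤c))))) ⟩
    b ℕ.^ 4 ℕ.* ((c ℕ.* N ℕ.* r) ℕ.^ 4 ℕ.* n ℕ.^ 3)       ≡⟨ cong (λ z → b ℕ.^ 4 ℕ.* (z ℕ.* n ℕ.^ 3)) (trans (ℕ-^-distrib-* 4 (c ℕ.* N) r) (cong (ℕ._* r ℕ.^ 4) (ℕ-^-distrib-* 4 c N))) ⟩
    b ℕ.^ 4 ℕ.* (c ℕ.^ 4 ℕ.* N ℕ.^ 4 ℕ.* r ℕ.^ 4 ℕ.* n ℕ.^ 3) ≡⟨ eq (b ℕ.^ 4) (c ℕ.^ 4) (N ℕ.^ 4) (r ℕ.^ 4) (n ℕ.^ 3) ⟩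
    b ℕ.^ 4 ℕ.* c ℕ.^ 4 ℕ.* (n ℕ.^ 3 ℕ.* r ℕ.^ 4) ℕ.* N ℕ.^ 4 ≡⟨ cong (λ z → z ℕ.* (n ℕ.^ 3 ℕ.* r ℕ.^ 4) ℕ.* N ℕ.^ 4) (ℕ-^-distrib-* 4 b c) ⟨
    (b ℕ.* c) ℕ.^ 4 ℕ.* (n ℕ.^ 3 ℕ.* r ℕ.^ 4) ℕ.* N ℕ.^ 4 ∎)
    where
    k = 3 ℕ.* e ℕ.+ r ℕ.+ 1
    eq : ∀ a b c d e → a ℕ.* (b ℕ.* c ℕ.* d ℕ.* e) ≡ a ℕ.* b ℕ.* (e ℕ.* d) ℕ.* c
    eq = ℕ-Solver.solve-∀
    eN≤2n : e ℕ.* N ℕ.≤ n ℕ.+ n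
    eN≤2n = ℕ.≤-trans (divides-down n) (ℕ.+-monoʳ-≤ n (ℕ.≤-trans N≤x x≤n))
    eq₁ : ∀ e r N → (3 ℕ.* e ℕ.+ r ℕ.+ 1) ℕ.* N ≡ 3 ℕ.* (e ℕ.* N) ℕ.+ N ℕ.* r ℕ.+ N
    eq₁ = ℕ-Solver.solve-∀
    eq₂ : ∀ n → 3 ℕ.* (n ℕ.+ n) ℕ.+ n ℕ.+ n ≡ 8 ℕ.* n
    eq₂ = ℕ-Solver.solve-∀
    kN≤bn : k ℕ.* N ℕ.≤ b ℕ.* n
    kN≤bn = begin
      k ℕ.* N                                      ≡⟨ eq₁ e r N ⟩
      3 ℕ.* (e ℕ.* N) ℕ.+ N ℕ.* r ℕ.+ N            ≤⟨ ℕ.+-mono-≤ (ℕ.+-mono-≤ (ℕ.*-monoʳ-≤ 3 eN≤2n) x≤n) (ℕ.≤-trans N≤x x≤n) ⟩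
      3 ℕ.* (n ℕ.+ n) ℕ.+ n ℕ.+ n                  ≡⟨ eq₂ n ⟩
      8 ℕ.* n                                      ≤⟨ ℕ.*-monoˡ-≤ n (ℕ.≤-trans (ℕ.m≤m+n 8 2) 10≤b) ⟩
      b ℕ.* n                                      ∎

-- Choosing the parameters

Result : ℕ → ℚ → ℕ → Set
Result C ε n = ∃ λ (A : SampleBasedAlgorithm n) → IsConvexityTester ε A × (2 ℕ.≤ n → SampleBound C ε n (samples A))

module _ (a b c : ℕ) (10≤b : 10 ℕ.≤ b) (3≤c : 3 ℕ.≤ c) (ε : ℚ) (0<ε : 0ℚ < ε) (r : ℕ) (2≤r : 2 ℕ.≤ r)
  (rε≥ : fromℕ 10000 ≤ fromℕ r * ε) (rε≤ : fromℕ r * ε ≤ fromℕ a) where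

  private
    1≤r : 1 ℕ.≤ r
    1≤r = ℕ.<⇒≤ 2≤r

  sample-budget : ∀ q {D} → D ≤ fromℕ (3 ℕ.^ q) → fromℕ 192 * D ≤ fromℕ (r ℕ.* 3 ℕ.^ q) * ε
  sample-budget q {D} D≤ = begin
    fromℕ 192 * D                          ≤⟨ *-mono-≤-nonNeg (0≤fromℕ 192) (0≤fromℕ (3 ℕ.^ q)) (≤-trans (fromℕ-mono-≤ {192} {10000} (ℕ.m≤m+n 192 9808)) rε≥) D≤ ⟩
    (fromℕ r * ε) * fromℕ (3 ℕ.^ q)        ≡⟨ eq (fromℕ r) ε (fromℕ (3 ℕ.^ q)) ⟩
    (fromℕ r * fromℕ (3 ℕ.^ q)) * ε        ≡⟨ cong (_* ε) (fromℕ-* r (3 ℕ.^ q)) ⟨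
    fromℕ (r ℕ.* 3 ℕ.^ q) * ε              ∎
    where
    open ≤-Reasoning
    eq : ∀ r e q → (r * e) * q ≡ (r * q) * e
    eq = solve-∀ ℚ-ring

  -- Each half of the sample has size r · 3^q: the power pays for the dimension, and r for the
  -- constants and for 1/ε.
  build : ∀ n d q → (∀ (S : Subset n) → Convex S → fromℕ 192 * tail d (λ x → 𝟙 (S x)) ≤ ε) → dimension n d ≤ fromℕ (3 ℕ.^ q) →
    (2 ℕ.≤ n → (q ℕ.+ r ℕ.+ 1) ℕ.^ 4 ℕ.≤ (b ℕ.* c) ℕ.^ 4 ℕ.* (n ℕ.^ 3 ℕ.* r ℕ.^ 4)) → Result (a ℕ.* (b ℕ.* c)) ε n
  build n d q tail≤ dim≤ exponent≤ = tester d (r ℕ.* 3 ℕ.^ q) ε ,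
    tester-correct d (r ℕ.* 3 ℕ.^ q) ε 0<ε
      (≤-trans (fromℕ-mono-≤ {24} {192} (ℕ.m≤m+n 24 168)) (≤-trans (≤-reflexive (sym (*-identityʳ (fromℕ 192)))) (sample-budget q (fromℕ-mono-≤ {1} {3 ℕ.^ q} (ℕ.m^n>0 3 q)))))
      tail≤ (sample-budget q dim≤) ,
    λ 2≤n → q ℕ.+ r ℕ.+ 1 , samples-bound r q , exponent-bound a (b ℕ.* c) ε 0<ε r 1≤r rε≤ n (q ℕ.+ r ℕ.+ 1) 2≤n (exponent≤ 2≤n)

  dense-result : ∀ n → n ℕ.< r ℕ.^ 4 → Result (a ℕ.* (b ℕ.* c)) ε n
  dense-result n n<r⁴ = build n (suc n) n
    (λ S _ → ≤-trans (≤-reflexive (trans (cong (fromℕ 192 *_) (tail-vanishes (suc n) (λ x → 𝟙 (S x)) (ℕ.n<1+n n))) (*-zeroʳ (fromℕ 192)))) (<⇒≤ 0<ε))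
    (dimension-trivial n (suc n))
    (λ 2≤n → exponent-dense (b ℕ.* c) n r (ℕ.≤-trans 3≤c (ℕ.m≤n*m c b {{ℕ.>-nonZero (ℕ.≤-trans (s≤s z≤n) 10≤b)}})) (ℕ.<⇒≤ 2≤n) n<r⁴ 1≤r)

  sparse-result : ∀ n j → (3 ℕ.^ j ℕ.* r) ℕ.^ 4 ℕ.≤ n → n ℕ.< (3 ℕ.^ suc j ℕ.* r) ℕ.^ 4 → Result (a ℕ.* (b ℕ.* c)) ε n
  sparse-result n j lower upper = build n d (3 ℕ.* e) tail≤ε
    (dimension-small-degree n j d e degree-exponent n≤eN) (λ _ → exponent-sparse b c 10≤b 3≤c upper)
    where
    open Sparse n r j 1≤r lower
    open ≤-Reasoning
    eq : ∀ r t → r * (fromℕ 192 * t) ≡ fromℕ 192 * (r * t)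
    eq = solve-∀ ℚ-ring
    tail≤ε : ∀ (S : Subset n) → Convex S → fromℕ 192 * tail d (λ x → 𝟙 (S x)) ≤ ε
    tail≤ε S convex = *-cancelˡ-≤-pos (fromℕ r) {{positive (<-≤-trans (positive⁻¹ 1ℚ) (fromℕ-mono-≤ 1≤r))}} (begin
      fromℕ r * (fromℕ 192 * tail d (λ x → 𝟙 (S x)))    ≡⟨ eq (fromℕ r) (tail d (λ x → 𝟙 (S x))) ⟩
      fromℕ 192 * (fromℕ r * tail d (λ x → 𝟙 (S x)))    ≤⟨ *-monoˡ-≤ (0≤fromℕ 192) (tail-small-degree S convex r d 2≤r 1≤n degree-large) ⟩
      -- The origin of 10000: r ε has to reach 192 · 48 = 9216.
      fromℕ 192 * fromℕ 48                              ≡⟨ fromℕ-* 192 48 ⟨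
      fromℕ 9216                                        ≤⟨ fromℕ-mono-≤ {9216} {10000} (ℕ.m≤m+n 9216 784) ⟩
      fromℕ 10000                                       ≤⟨ rε≥ ⟩
      fromℕ r * ε                                       ∎)

  result : ∀ n → Result (a ℕ.* (b ℕ.* c)) ε n
  result n = by-density (r ℕ.^ 4 ℕ.≤? n)
    where
    P : ℕ → Set
    P j = n ℕ.< (3 ℕ.^ j ℕ.* r) ℕ.^ 4
    P-n : P n
    P-n = ℕ.<-≤-trans (n<3^n n) (ℕ.≤-trans (ℕ.m≤m*n (3 ℕ.^ n) r {{ℕ.>-nonZero 1≤r}})
      (ℕ.m≤m*n (3 ℕ.^ n ℕ.* r) ((3 ℕ.^ n ℕ.* r) ℕ.^ 3) {{ℕ.m^n≢0 (3 ℕ.^ n ℕ.* r) 3 {{ℕ.>-nonZero (ℕ.*-mono-≤ (ℕ.m^n>0 3 n) 1≤r)}}}}))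
    by-density : Dec (r ℕ.^ 4 ℕ.≤ n) → Result (a ℕ.* (b ℕ.* c)) ε n
    by-density (no r⁴≰n)  = dense-result n (ℕ.≰⇒> r⁴≰n)
    -- The scale j = 0 is admissible because r⁴ ≤ n, and j = n is too large; a crossing in between
    -- gives both bounds of the sparse regime.
    by-density (yes r⁴≤n) = by-scale (crossing (λ j → n ℕ.<? (3 ℕ.^ j ℕ.* r) ℕ.^ 4) (ℕ.≤⇒≯ (ℕ.≤-trans (ℕ.≤-reflexive (cong (ℕ._^ 4) (ℕ.*-identityˡ r))) r⁴≤n)) n P-n)
      where
      by-scale : (∃ λ j → ¬ P j × P (suc j)) → Result (a ℕ.* (b ℕ.* c)) ε n
      by-scale (j , lower , upper) = sparse-result n j (ℕ.≮⇒≥ lower) upper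

-- Any ε > 1 is larger than every distance, so that no set is ε-far from convex.
module _ {n : ℕ} where

  empty : Subset n
  empty _ = false

  empty-convex : Convex empty
  empty-convex x = mk⇔ (λ ()) (λ conv → inhabited conv)
    where
    inhabited : ∀ {y : Fin n → ℚ} → Conv empty y → T false
    inhabited record { size = zero ; weights≡1 = () }
    inhabited record { size = suc k ; point∈S = point∈S } = point∈S zero

  always-accept : SampleBasedAlgorithm n
  always-accept = record { samples = 0 ; bits = 0 ; accepts = λ _ _ → true }

  always-accept-correct : ∀ ε → 1ℚ < ε → IsConvexityTester ε always-accept
  always-accept-correct ε 1<ε = record
    { accepts-convex = λ S _ → 0≤q-p⇒p≤q (nonNegative⁻¹ (ℤ.+ 1 ℚ./ 3))
    ; rejects-far    = λ S far → ⊥-elim (<-irrefl refl (<-≤-trans 1<ε (≤-trans (far empty empty-convex)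
        (≤-trans (≤-reflexive (dist-U S empty)) (≤-trans (𝔼-mono (vecs trits n) 0≤∏third (λ x → 𝟙≤1 (S x xor empty x)))
        (≤-reflexive (𝔼-const (vecs trits n) (∏ third) (∑-points n) 1ℚ)))))))
    }

-- The denominator of ε serves, as its product with ε is the numerator, a positive integer.
archimedean : ∀ ε → 0ℚ < ε → ∃ λ N → 1ℚ ≤ fromℕ N * ε
archimedean ε 0<ε = ℚ.↧ₙ ε , (begin
  1ℚ                        ≤⟨ fromℤ-mono-≤ {ℤ.+ 1} {ℚ.↥ ε} (ℤ.i<j⇒suc[i]≤j (numerator-positive ε (positive 0<ε))) ⟩
  fromℤ (ℚ.↥ ε)             ≡⟨ /-cancel (ℚ.↥ ε) (ℚ.↧ₙ ε) ⟨
  (ℚ.↥ ε ℚ./ ℚ.↧ₙ ε) * fromℕ (ℚ.↧ₙ ε) ≡⟨ cong (_* fromℕ (ℚ.↧ₙ ε)) (↥p/↧p≡p ε) ⟩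
  ε * fromℕ (ℚ.↧ₙ ε)        ≡⟨ *-comm ε (fromℕ (ℚ.↧ₙ ε)) ⟩
  fromℕ (ℚ.↧ₙ ε) * ε        ∎)
  where
  open ≤-Reasoning
  numerator-positive : ∀ p → ℚ.Positive p → ℤ.+ 0 ℤ.< ℚ.↥ p
  numerator-positive (ℚ.mkℚ z _ _) pos = ℤ.positive⁻¹ z {{pos}}

-- The multiples of ε grow in steps of at most 1, so the multiple at which K is first passed is at
-- most K + 1.
scale : ∀ ε → 0ℚ < ε → ε ≤ 1ℚ → ∀ K → 2 ℕ.≤ K → ∃ λ r → 2 ℕ.≤ r × fromℕ K ≤ fromℕ r * ε × fromℕ r * ε ≤ fromℕ (suc K)
scale ε 0<ε ε≤1 K 2≤K = minimal (crossing (λ k → fromℕ K ≤? fromℕ k * ε) not-0 (K ℕ.* N) large)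
  where
  P : ℕ → Set
  P k = fromℕ K ≤ fromℕ k * ε
  N = proj₁ (archimedean ε 0<ε)
  1≤Nε = proj₂ (archimedean ε 0<ε)
  1≤K = fromℕ-mono-≤ {1} (ℕ.<⇒≤ 2≤K)
  not-0 : ¬ P 0
  not-0 le = <-irrefl refl (<-≤-trans (positive⁻¹ 1ℚ) (≤-trans 1≤K (≤-trans le (≤-reflexive (*-zeroˡ ε)))))
  large : P (K ℕ.* N)
  large = ≤-trans (≤-reflexive (sym (*-identityʳ (fromℕ K)))) (≤-trans (*-monoˡ-≤ (0≤fromℕ K) 1≤Nε)
    (≤-reflexive (trans (sym (*-assoc (fromℕ K) (fromℕ N) ε)) (cong (_* ε) (sym (fromℕ-* K N))))))
  2≤r : ∀ k → P (suc k) → 2 ℕ.≤ suc k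
  2≤r zero    le = ⊥-elim (<-irrefl refl (<-≤-trans (positive⁻¹ 1ℚ) (+-monoˡ-≤ (- 1ℚ)
    (≤-trans (fromℕ-mono-≤ 2≤K) (≤-trans le (≤-trans (≤-reflexive (*-identityˡ ε)) ε≤1))))))
  2≤r (suc k) le = s≤s (s≤s z≤n)
  eq : ∀ k e → (1ℚ + k) * e ≡ e + k * e
  eq = solve-∀ ℚ-ring
  minimal : (∃ λ k → ¬ P k × P (suc k)) → ∃ λ r → 2 ℕ.≤ r × fromℕ K ≤ fromℕ r * ε × fromℕ r * ε ≤ fromℕ (suc K)
  minimal (k , below , above) = suc k , 2≤r k above , above , (begin
    fromℕ (suc k) * ε      ≡⟨ cong (_* ε) (fromℕ-suc k) ⟩
    (1ℚ + fromℕ k) * ε     ≡⟨ eq (fromℕ k) ε ⟩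
    ε + fromℕ k * ε        ≤⟨ +-mono-≤ ε≤1 (<⇒≤ (≰⇒> below)) ⟩
    1ℚ + fromℕ K           ≡⟨ fromℕ-suc K ⟨
    fromℕ (suc K)          ∎)
    where open ≤-Reasoning

-- The constants are kept abstract, because unfolding multiplication by their fourth powers is infeasible.
testers : ∀ a b c → 10001 ℕ.≤ a → 10 ℕ.≤ b → 3 ℕ.≤ c → ∃ λ (C : ℕ) →
    ∀ (ε : ℚ) → 0ℚ < ε →
    ∃ λ (A : ∀ n → SampleBasedAlgorithm n) →
    (∀ n → IsConvexityTester ε (A n)) ×
    (∀ n → 2 ℕ.≤ n → SampleBound C ε n (samples (A n)))
testers a b c 10001≤a 10≤b 3≤c = C , λ ε 0<ε → choose ε 0<ε (ε ≤? 1ℚ)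
  where
  C = a ℕ.* (b ℕ.* c)
  choose : ∀ ε → 0ℚ < ε → Dec (ε ≤ 1ℚ) → ∃ λ (A : ∀ n → SampleBasedAlgorithm n) →
    (∀ n → IsConvexityTester ε (A n)) × (∀ n → 2 ℕ.≤ n → SampleBound C ε n (samples (A n)))
  choose ε 0<ε (no ε≰1) = (λ n → always-accept) , (λ n → always-accept-correct ε (≰⇒> ε≰1)) ,
    λ n _ → 0 , z≤n , ≤-trans (≤-reflexive (cong (_^ 4) (*-zeroˡ ε))) (0≤fromℕ (C ℕ.^ 4 ℕ.* n ℕ.^ 3 ℕ.* ⌊log₂ n ⌋))
  choose ε 0<ε (yes ε≤1) = (λ n → proj₁ (R n)) , (λ n → proj₁ (proj₂ (R n))) , (λ n → proj₂ (proj₂ (R n)))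
    where
    r-scaled = scale ε 0<ε ε≤1 10000 (s≤s (s≤s z≤n))
    R : ∀ n → Result C ε n
    R = result a b c 10≤b 3≤c ε 0<ε (proj₁ r-scaled) (proj₁ (proj₂ r-scaled)) (proj₁ (proj₂ (proj₂ r-scaled)))
      (≤-trans (proj₂ (proj₂ (proj₂ r-scaled))) (fromℕ-mono-≤ 10001≤a))

corollary1p6 : ∃ λ (C : ℕ) →
    ∀ (ε : ℚ) → 0ℚ < ε →
    ∃ λ (A : ∀ n → SampleBasedAlgorithm n) →
    (∀ n → IsConvexityTester ε (A n)) ×
    (∀ n → 2 ℕ.≤ n → SampleBound C ε n (samples (A n)))
corollary1p6 = testers 10001 10 3 ℕ.≤-refl ℕ.≤-refl ℕ.≤-refl
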